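{- Let $p$ be a prime and let $d$ be an integer with $d\mid p-1$ and $1<d<p-1$. Let $\mu_d=\{x\in\mathbb F_p: x^d=1\}$ be the set of $d$-th roots of unity in $\mathbb F_p$. If there is a set $A\subset\mathbb F_p$ with $A-A=\mu_d\cup\{0\}$, where $A-A=\{a_1-a_2: a_1,a_2\in A\}$, then $d=2$ or $d=6$. -}

module Defs where

open import Data.Nat using (ℕ; _+_; _∸_; _^_; _%_; NonZero)
open import Data.Nat.Primality using (Prime)
open import Data.Fin using (Fin; toℕ)
open import Data.Product using (∃₂; _×_)
open import Relation.Binary.PropositionalEquality using (_≡_)

-- Elements of 𝔽_p are represented by Fin p (residues 0..p-1);
-- subtraction in 𝔽_p, given as a natural-number residue:
subₚ : (p : ℕ) .{{_ : NonZero p}} → Fin p → Fin p → ℕ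
subₚ p a b = (toℕ a + (p ∸ toℕ b)) % p

μ : (p d : ℕ) .{{_ : NonZero p}} → Fin p → Set
μ p d x = (toℕ x ^ d) % p ≡ 1

_∈A-A_ : {p : ℕ} .{{_ : NonZero p}} → Fin p → (Fin p → Set) → Set
_∈A-A_ {p} x A = ∃₂ λ a₁ a₂ → A a₁ × A a₂ × toℕ x ≡ subₚ p a₁ a₂

{-# OPTIONS --safe #-}

-- Let A have n elements and put m = n − 1, P = ∏ (x − a) over A.  With Lagrange weights c_b the
-- Stepanov polynomial f = ∑ c_b (b − x)^(d+m) − 1 has degree d and vanishes to order m on A, so
-- n m ≤ d (Hanson–Petridis); as A − A covers μ_d, d = n m and all differences are distinct.
-- Then P f' − m P' f has degree below n² and order n on A, hence is zero.  Its expansion at a point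
-- of A shows that the transvectant T = (n−2)(4n P'P''' − 3(n−1) P''²) − n(n+1) P P'''' has double
-- zeros on A, so T = 0 as well.  After centring A, the expansion at infinity kills the
-- coefficients of x^(n−1), x^(n−2), x^(n−3) in P if n ≥ 4, and T = 0 kills that of x^(n−k) unless
-- (n+1) k = 6 (n−1).  As in Klein's classification this leaves (n, k) = (5, 4) and (11, 5) (octahedron
-- and icosahedron): the first has repeated differences, the second contradicts the expansion at
-- infinity.  So n ≤ 3.
module Submission where

open import Defs
open import Data.Nat using (ℕ; _∸_; _<_; NonZero)
open import Data.Nat.Divisibility using (_∣_)
open import Data.Nat.Primality using (Prime)
open import Data.Fin using (Fin; toℕ)
open import Data.Sum using (_⊎_)
open import Relation.Binary.PropositionalEquality using (_≡_)
open import Function.Bundles using (_⇔_)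

open import Algebra.Bundles using (CommutativeRing)
import Algebra.Properties.Ring
import Algebra.Solver.Ring
open import Algebra.Solver.Ring.AlmostCommutativeRing using (_-Raw-AlmostCommutative⟶_; fromCommutativeRing)
open import Algebra.Structures using (IsCommutativeRing)
open import Data.Empty using (⊥; ⊥-elim)
open import Data.Fin.Properties using (toℕ-fromℕ<; toℕ-injective; toℕ<n; sequence) renaming (_≟_ to _≟ᶠ_)
open import Data.Integer.Base as ℤ using (ℤ; -[1+_]; _⊖_)
import Data.Integer.Properties as ℤ
open import Data.List.Base using (List; []; _∷_; map; length; _++_; allFin; filter)
open import Data.List.Membership.Propositional using (_∈_)
open import Data.List.Membership.Propositional.Properties using (∈-++⁺ˡ; ∈-++⁺ʳ; ∈-map⁺; ∈-filter⁺; ∈-filter⁻; ∈-allFin)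
open import Data.List.Properties using (length-++; length-map; length-tabulate)
open import Data.List.Relation.Unary.All as All using (All; []; _∷_)
import Data.List.Relation.Unary.All.Properties as All
open import Data.List.Relation.Unary.AllPairs using (AllPairs; []; _∷_)
import Data.List.Relation.Unary.AllPairs.Properties as AllPairs
open import Data.List.Relation.Unary.Any using (here; there)
open import Data.List.Relation.Unary.Unique.Propositional using (Unique)
open import Data.List.Relation.Unary.Unique.Propositional.Properties using (allFin⁺; filter⁺)
open import Data.Maybe.Base using (Maybe; just; nothing)
open import Data.Nat.Base as ℕ using (zero; suc; z≤n; s≤s; _≤_; _%_)
open import Data.Nat.Coprimality using (prime⇒coprime; coprime-Bézout)
open import Data.Nat.Divisibility using (divides)
open import Data.Nat.DivMod using (_mod_; m%n<n; m<n⇒m%n≡m; n%n≡0; [m+kn]%n≡m%n; %-distribˡ-+; %-distribˡ-*)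
open import Data.Nat.GCD using (module Bézout)
open import Data.Nat.ListAction using (product) renaming (sum to sumℕ)
open import Data.Nat.Primality using (prime⇒nonTrivial)
import Data.Nat.Properties as ℕ
open import Data.Nat.Tactic.RingSolver using (solve-∀)
open import Data.Product.Base using (_×_; _,_; proj₁; proj₂; ∃-syntax)
open import Data.Sum.Base using (inj₁; inj₂; [_,_]′)
open import Effect.Monad using (RawMonad)
open import Function.Base using (_∘_)
open import Function.Bundles using (module Equivalence)
open import Level using (0ℓ)
open import Relation.Binary.Definitions using (DecidableEquality; tri<; tri≈; tri>)
open import Relation.Binary.PropositionalEquality using (_≢_; refl; sym; trans; cong; cong₂; subst; module ≡-Reasoning)
open import Relation.Binary.PropositionalEquality.Properties using (isEquivalence)
open import Relation.Nullary using (¬_; Dec; yes; no; contradiction)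
open import Relation.Nullary.Decidable using (decidable-stable; _⊎-dec_; ¬¬-excluded-middle)
open import Relation.Nullary.Negation using (¬¬-Monad)

-- As d = n m, f is a constant multiple of P^m, and P f' = m P' f is the linear form of this fact.
-- On the other hand, the Taylor coefficients of f at a point of A are binomial coefficients times
-- moments of the weights, and these moments are, up to sign, the Laurent coefficients of 1/P there.
-- Comparing P^m with 1/P is what yields conditions on P alone: at first order the two agree
-- identically, at second and third order they give one relation each, and T is designed so that its
-- value and its derivative on A are multiples of these two. T treats infinity as one more root: n +
-- 1 is to be the number of vertices of a polyhedron. Indeed (n + 1) k = 6 (n - 1) reads k = 6 -
-- 12/(n + 1), with n + 1 = 4, 6, 12 for k = 3, 4, 5. The tetrahedron, n = 3, is the genuine case d
-- = 6; this is why factors n - 3 appear and n ≥ 4 is assumed. The obstacle throughout is the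
-- characteristic: every integer that must not vanish in the field has to be traced back to positive
-- integers below p, and the main source for that is 2 d < p.

record DiscreteField : Set₁ where
  infixl 6 _+_
  infixl 7 _*_
  infix  8 -_
  field
    K                 : Set
    _+_ _*_           : K → K → K
    -_                : K → K
    0# 1#             : K
    isCommutativeRing : IsCommutativeRing _≡_ _+_ _*_ -_ 0# 1#
    _≟_               : DecidableEquality K
    1≢0               : 1# ≢ 0#
    _⁻¹               : K → K
    inverseʳ          : ∀ x → x ≢ 0# → x * (x ⁻¹) ≡ 1#

-- Field arithmetic and a ring solver with integer constants.

module FieldArithmetic (F : DiscreteField) where
  open DiscreteField F public

  commutativeRing : CommutativeRing 0ℓ 0ℓ
  commutativeRing = record { isCommutativeRing = isCommutativeRing }

  open CommutativeRing commutativeRing public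
    using (_-_; ring; semiring; +-identityˡ; +-identityʳ; *-identityˡ; *-identityʳ; zeroˡ; zeroʳ; +-assoc; +-comm; *-assoc; *-comm; -‿inverseʳ)
  open import Algebra.Properties.Ring ring using (-‿distribˡ-*; -‿distribʳ-*; -0#≈0#; -‿involutive; -‿+-comm)
  open import Algebra.Properties.Semiring.Mult semiring using (×-homo-+; ×1-homo-*) renaming (_×_ to _⋆_)
  open import Algebra.Properties.Semiring.Exp semiring public using (_^_; ^-homo-*)
  open ≡-Reasoning

  ι : ℕ → K
  ι n = n ⋆ 1#

  ι-+ : ∀ m n → ι (m ℕ.+ n) ≡ ι m + ι n
  ι-+ = ×-homo-+ 1#

  ι-* : ∀ m n → ι (m ℕ.* n) ≡ ι m * ι n
  ι-* = ×1-homo-*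

  private
    ιℤ : ℤ → K
    ιℤ (ℤ.+ n)  = ι n
    ιℤ -[1+ n ] = - ι (suc n)

    ιℤ-⊖ : ∀ m n → ιℤ (m ⊖ n) ≡ ι m - ι n
    ιℤ-⊖ m       zero    = sym (trans (cong (ι m +_) -0#≈0#) (+-identityʳ _))
    ιℤ-⊖ zero    (suc n) = sym (+-identityˡ _)
    ιℤ-⊖ (suc m) (suc n) = begin
      ιℤ (suc m ⊖ suc n)           ≡⟨ cong ιℤ (ℤ.[1+m]⊖[1+n]≡m⊖n m n) ⟩
      ιℤ (m ⊖ n)                   ≡⟨ ιℤ-⊖ m n ⟩
      ι m - ι n                    ≡⟨ cong (_- ι n) (+-identityʳ (ι m)) ⟨
      (ι m + 0#) - ι n             ≡⟨ cong (λ x → (ι m + x) - ι n) (-‿inverseʳ 1#) ⟨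
      (ι m + (1# - 1#)) - ι n      ≡⟨ cong (_- ι n) (+-assoc (ι m) 1# (- 1#)) ⟨
      ((ι m + 1#) - 1#) - ι n      ≡⟨ cong (λ x → (x - 1#) - ι n) (+-comm (ι m) 1#) ⟩
      ((1# + ι m) - 1#) - ι n      ≡⟨ +-assoc _ _ _ ⟩
      (1# + ι m) + ((- 1#) - ι n)  ≡⟨ cong ((1# + ι m) +_) (-‿+-comm 1# (ι n)) ⟩
      (1# + ι m) - (1# + ι n)      ∎

    ιℤ-neg : ∀ i → ιℤ (ℤ.- i) ≡ - ιℤ i
    ιℤ-neg (ℤ.+ zero)    = sym -0#≈0#
    ιℤ-neg (ℤ.+ (suc n)) = refl
    ιℤ-neg -[1+ n ]      = sym (-‿involutive _)

    ιℤ-+ : ∀ i j → ιℤ (i ℤ.+ j) ≡ ιℤ i + ιℤ j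
    ιℤ-+ (ℤ.+ m)  (ℤ.+ n)  = ι-+ m n
    ιℤ-+ (ℤ.+ m)  -[1+ n ] = ιℤ-⊖ m (suc n)
    ιℤ-+ -[1+ m ] (ℤ.+ n)  = trans (ιℤ-⊖ n (suc m)) (+-comm _ _)
    ιℤ-+ -[1+ m ] -[1+ n ] = begin
      - ι (suc (suc (m ℕ.+ n)))  ≡⟨ cong (λ k → - ι (suc k)) (ℕ.+-suc m n) ⟨
      - ι (suc m ℕ.+ suc n)      ≡⟨ cong -_ (ι-+ (suc m) (suc n)) ⟩
      - (ι (suc m) + ι (suc n))  ≡⟨ -‿+-comm _ _ ⟨
      (- ι (suc m)) - ι (suc n)  ∎

    ιℤ-*-+ : ∀ m j → ιℤ (ℤ.+ m ℤ.* j) ≡ ι m * ιℤ j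
    ιℤ-*-+ m (ℤ.+ n)  = trans (cong ιℤ (sym (ℤ.pos-* m n))) (ι-* m n)
    ιℤ-*-+ m -[1+ n ] = begin
      ιℤ (ℤ.+ m ℤ.* -[1+ n ])          ≡⟨ cong ιℤ (ℤ.neg-distribʳ-* (ℤ.+ m) (ℤ.+ suc n)) ⟨
      ιℤ (ℤ.- (ℤ.+ m ℤ.* ℤ.+ suc n))   ≡⟨ ιℤ-neg (ℤ.+ m ℤ.* ℤ.+ suc n) ⟩
      - ιℤ (ℤ.+ m ℤ.* ℤ.+ suc n)       ≡⟨ cong -_ (ιℤ-*-+ m (ℤ.+ suc n)) ⟩
      - (ι m * ι (suc n))              ≡⟨ -‿distribʳ-* _ _ ⟩
      ι m * (- ι (suc n))              ∎

    ιℤ-* : ∀ i j → ιℤ (i ℤ.* j) ≡ ιℤ i * ιℤ j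
    ιℤ-* (ℤ.+ m)  j = ιℤ-*-+ m j
    ιℤ-* -[1+ m ] j = begin
      ιℤ (-[1+ m ] ℤ.* j)            ≡⟨ cong ιℤ (ℤ.neg-distribˡ-* (ℤ.+ suc m) j) ⟨
      ιℤ (ℤ.- (ℤ.+ suc m ℤ.* j))     ≡⟨ ιℤ-neg (ℤ.+ suc m ℤ.* j) ⟩
      - ιℤ (ℤ.+ suc m ℤ.* j)         ≡⟨ cong -_ (ιℤ-*-+ (suc m) j) ⟩
      - (ι (suc m) * ιℤ j)           ≡⟨ -‿distribˡ-* _ _ ⟩
      (- ι (suc m)) * ιℤ j           ∎

    -- ι 1 unfolds to 1# + 0#; the solver's constants must instead map 1 to 1# on the nose,
    -- so that it recognises ι (suc k) as 1# + ι k.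
    ⟦_⟧ℤ : ℤ → K
    ⟦ ℤ.+ 1 ⟧ℤ    = 1#
    ⟦ i@(ℤ.+ _) ⟧ℤ    = ιℤ i
    ⟦ i@(-[1+ _ ]) ⟧ℤ = ιℤ i

    ⟦⟧≡ιℤ : ∀ i → ⟦ i ⟧ℤ ≡ ιℤ i
    ⟦⟧≡ιℤ (ℤ.+ 0)             = refl
    ⟦⟧≡ιℤ (ℤ.+ 1)             = sym (+-identityʳ 1#)
    ⟦⟧≡ιℤ (ℤ.+ (suc (suc n))) = refl
    ⟦⟧≡ιℤ -[1+ n ]            = refl

    morphism : ℤ.+-*-rawRing -Raw-AlmostCommutative⟶ fromCommutativeRing commutativeRing
    morphism = record
      { ⟦_⟧    = ⟦_⟧ℤ
      ; +-homo = λ i j → trans (⟦⟧≡ιℤ (i ℤ.+ j)) (trans (ιℤ-+ i j) (sym (cong₂ _+_ (⟦⟧≡ιℤ i) (⟦⟧≡ιℤ j))))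
      ; *-homo = λ i j → trans (⟦⟧≡ιℤ (i ℤ.* j)) (trans (ιℤ-* i j) (sym (cong₂ _*_ (⟦⟧≡ιℤ i) (⟦⟧≡ιℤ j))))
      ; -‿homo = λ i → trans (⟦⟧≡ιℤ (ℤ.- i)) (trans (ιℤ-neg i) (sym (cong -_ (⟦⟧≡ιℤ i))))
      ; 0-homo = refl
      ; 1-homo = refl }

    ⟦⟧-weaklyDecidable : ∀ i j → Maybe (⟦ i ⟧ℤ ≡ ⟦ j ⟧ℤ)
    ⟦⟧-weaklyDecidable i j with i ℤ.≟ j
    ... | yes i≡j = just (cong ⟦_⟧ℤ i≡j)
    ... | no  _   = nothing

  open Algebra.Solver.Ring ℤ.+-*-rawRing (fromCommutativeRing commutativeRing) morphism ⟦⟧-weaklyDecidable public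
    using (Polynomial; solve; _:=_; _:+_; _:*_; _:-_; :-_; con)

  κ : ∀ {n} → ℕ → Polynomial n
  κ c = con (ℤ.+ c)

  x-y≡0⇒x≡y : ∀ x y → x - y ≡ 0# → x ≡ y
  x-y≡0⇒x≡y x y eq = begin
    x              ≡⟨ solve 2 (λ x y → x := (x :- y) :+ y) refl x y ⟩
    (x - y) + y    ≡⟨ cong (_+ y) eq ⟩
    0# + y         ≡⟨ +-identityˡ y ⟩
    y              ∎

  x≡y⇒x-y≡0 : ∀ {x y} → x ≡ y → x - y ≡ 0#
  x≡y⇒x-y≡0 {x} refl = -‿inverseʳ x

  xy≡0⇒y≡0 : ∀ {x y} → x ≢ 0# → x * y ≡ 0# → y ≡ 0#
  xy≡0⇒y≡0 {x} {y} x≢0 xy≡0 = begin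
    y                  ≡⟨ *-identityˡ y ⟨
    1# * y             ≡⟨ cong (_* y) (inverseʳ x x≢0) ⟨
    (x * (x ⁻¹)) * y   ≡⟨ solve 3 (λ x z y → (x :* z) :* y := z :* (x :* y)) refl x (x ⁻¹) y ⟩
    (x ⁻¹) * (x * y)   ≡⟨ cong ((x ⁻¹) *_) xy≡0 ⟩
    (x ⁻¹) * 0#        ≡⟨ zeroʳ _ ⟩
    0#                 ∎

  *-≢0 : ∀ {x y} → x ≢ 0# → y ≢ 0# → x * y ≢ 0#
  *-≢0 x≢0 y≢0 xy≡0 = y≢0 (xy≡0⇒y≡0 x≢0 xy≡0)

  0*≡0 : ∀ {x} y → x ≡ 0# → x * y ≡ 0#
  0*≡0 y refl = zeroˡ y

  *0≡0 : ∀ x {y} → y ≡ 0# → x * y ≡ 0#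
  *0≡0 x refl = zeroʳ x

  0+0≡0 : ∀ {x y} → x ≡ 0# → y ≡ 0# → x + y ≡ 0#
  0+0≡0 refl refl = +-identityˡ 0#

-- Finite sums and sums over antidiagonals.

module Sums (F : DiscreteField) where
  open FieldArithmetic F public
  open ≡-Reasoning

  ∑ : ℕ → (ℕ → K) → K
  ∑ zero    h = 0#
  ∑ (suc n) h = h 0 + ∑ n (h ∘ suc)

  ∑-cong : ∀ n {g h : ℕ → K} → (∀ i → g i ≡ h i) → ∑ n g ≡ ∑ n h
  ∑-cong zero    eq = refl
  ∑-cong (suc n) eq = cong₂ _+_ (eq 0) (∑-cong n (eq ∘ suc))

  ∑-+ : ∀ n (g h : ℕ → K) → ∑ n (λ i → g i + h i) ≡ ∑ n g + ∑ n h
  ∑-+ zero    g h = sym (+-identityˡ 0#)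
  ∑-+ (suc n) g h = trans (cong (g 0 + h 0 +_) (∑-+ n (g ∘ suc) (h ∘ suc)))
    (solve 4 (λ a b c d → a :+ b :+ (c :+ d) := a :+ c :+ (b :+ d)) refl _ _ _ _)

  ∑-* : ∀ n c (h : ℕ → K) → ∑ n (λ i → c * h i) ≡ c * ∑ n h
  ∑-* zero    c h = sym (zeroʳ c)
  ∑-* (suc n) c h = trans (cong (c * h 0 +_) (∑-* n c (h ∘ suc)))
    (solve 3 (λ c a b → c :* a :+ c :* b := c :* (a :+ b)) refl _ _ _)

  ∑-zero : ∀ n {h : ℕ → K} → (∀ i → i < n → h i ≡ 0#) → ∑ n h ≡ 0#
  ∑-zero zero    z = refl
  ∑-zero (suc n) z = 0+0≡0 (z 0 (s≤s z≤n)) (∑-zero n (λ i i<n → z (suc i) (s≤s i<n)))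

  ∑-single : ∀ n {h : ℕ → K} a → a < n → (∀ i → i < n → i ≢ a → h i ≡ 0#) → ∑ n h ≡ h a
  ∑-single (suc n) zero    a<n z = trans (cong (_ +_) (∑-zero n (λ i i<n → z (suc i) (s≤s i<n) λ ()))) (+-identityʳ _)
  ∑-single (suc n) (suc a) (s≤s a<n) z = trans
    (cong₂ _+_ (z 0 (s≤s z≤n) (λ ())) (∑-single n a a<n (λ i i<n i≢a → z (suc i) (s≤s i<n) (i≢a ∘ ℕ.suc-injective))))
    (+-identityˡ _)

  ∑-pair : ∀ n {h : ℕ → K} a b → a < b → b < n → (∀ i → i < n → i ≢ a → i ≢ b → h i ≡ 0#) → ∑ n h ≡ h a + h b
  ∑-pair (suc n) zero (suc b) a<b (s≤s b<n) z = cong (_ +_)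
    (∑-single n b b<n (λ i i<n i≢b → z (suc i) (s≤s i<n) (λ ()) (i≢b ∘ ℕ.suc-injective)))
  ∑-pair (suc n) (suc a) (suc b) (s≤s a<b) (s≤s b<n) z = trans
    (cong₂ _+_ (z 0 (s≤s z≤n) (λ ()) (λ ()))
      (∑-pair n a b a<b b<n (λ i i<n i≢a i≢b → z (suc i) (s≤s i<n) (i≢a ∘ ℕ.suc-injective) (i≢b ∘ ℕ.suc-injective))))
    (+-identityˡ _)

  antidiagonal : (ℕ → ℕ → K) → ℕ → K
  antidiagonal h k = ∑ (suc k) (λ i → h i (k ∸ i))

  antidiagonal-cong : ∀ {g h : ℕ → ℕ → K} → (∀ i j → g i j ≡ h i j) → ∀ k → antidiagonal g k ≡ antidiagonal h k
  antidiagonal-cong eq k = ∑-cong (suc k) (λ i → eq i (k ∸ i))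

  antidiagonal-+ : ∀ (g h : ℕ → ℕ → K) k → antidiagonal (λ i j → g i j + h i j) k ≡ antidiagonal g k + antidiagonal h k
  antidiagonal-+ g h k = ∑-+ (suc k) (λ i → g i (k ∸ i)) (λ i → h i (k ∸ i))

  antidiagonal-* : ∀ c (h : ℕ → ℕ → K) k → antidiagonal (λ i j → c * h i j) k ≡ c * antidiagonal h k
  antidiagonal-* c h k = ∑-* (suc k) c (λ i → h i (k ∸ i))

  private
    i+[k∸i]≡k : ∀ {i k} → i < suc k → i ℕ.+ (k ∸ i) ≡ k
    i+[k∸i]≡k (s≤s i≤k) = ℕ.m+[n∸m]≡n i≤k

    i+j≡k⇒i<1+k : ∀ {i j k} → i ℕ.+ j ≡ k → i < suc k
    i+j≡k⇒i<1+k refl = s≤s (ℕ.m≤m+n _ _)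

    at : ∀ (h : ℕ → ℕ → K) {i j k} → i ℕ.+ j ≡ k → h i (k ∸ i) ≡ h i j
    at h {i} {j} refl = cong (h i) (ℕ.m+n∸m≡n i j)

  antidiagonal-zero : ∀ {h : ℕ → ℕ → K} k → (∀ i j → i ℕ.+ j ≡ k → h i j ≡ 0#) → antidiagonal h k ≡ 0#
  antidiagonal-zero k z = ∑-zero (suc k) (λ i i<k → z i (k ∸ i) (i+[k∸i]≡k i<k))

  antidiagonal-single : ∀ {h : ℕ → ℕ → K} k {i₀ j₀} → i₀ ℕ.+ j₀ ≡ k →
                        (∀ i j → i ℕ.+ j ≡ k → i ≢ i₀ → h i j ≡ 0#) → antidiagonal h k ≡ h i₀ j₀
  antidiagonal-single {h} k {i₀} e₀ z = trans
    (∑-single (suc k) i₀ (i+j≡k⇒i<1+k e₀) (λ i i<k → z i (k ∸ i) (i+[k∸i]≡k i<k)))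
    (at h e₀)

  antidiagonal-pair : ∀ {h : ℕ → ℕ → K} k {i₀ j₀ i₁ j₁} → i₀ < i₁ → i₀ ℕ.+ j₀ ≡ k → i₁ ℕ.+ j₁ ≡ k →
                      (∀ i j → i ℕ.+ j ≡ k → i ≢ i₀ → i ≢ i₁ → h i j ≡ 0#) →
                      antidiagonal h k ≡ h i₀ j₀ + h i₁ j₁
  antidiagonal-pair {h} k {i₀} {j₀} {i₁} {j₁} i₀<i₁ e₀ e₁ z = trans
    (∑-pair (suc k) i₀ i₁ i₀<i₁ (i+j≡k⇒i<1+k e₁) (λ i i<k → z i (k ∸ i) (i+[k∸i]≡k i<k)))
    (cong₂ _+_ (at h e₀) (at h e₁))

  -- A derivative shifts an index and brings in a factor that vanishes at index 0. Such a factor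
  -- absorbs the shift, so products of derivatives of different orders become weighted sums over one
  -- and the same antidiagonal.
  antidiagonal-sucˡ : ∀ (h : ℕ → ℕ → K) → (∀ j → h 0 j ≡ 0#) → ∀ k →
                      antidiagonal (h ∘ suc) k ≡ antidiagonal h (suc k)
  antidiagonal-sucˡ h z k = sym (trans (cong (_+ antidiagonal (h ∘ suc) k) (z (suc k))) (+-identityˡ _))

  antidiagonal-sucʳ : ∀ (h : ℕ → ℕ → K) → (∀ i → h i 0 ≡ 0#) → ∀ k →
                      antidiagonal (λ i j → h i (suc j)) k ≡ antidiagonal h (suc k)
  antidiagonal-sucʳ h z zero    = cong (h 0 1 +_) (sym (0+0≡0 (z 1) refl))
  antidiagonal-sucʳ h z (suc k) = cong (h 0 (suc (suc k)) +_) (antidiagonal-sucʳ (h ∘ suc) (z ∘ suc) k)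

-- Polynomials, Taylor expansion and zeros with multiplicity.

module Polynomials (F : DiscreteField) where
  open Sums F public
  open ≡-Reasoning

  infix  4 _≈_
  infixl 6 _⊕_
  infixl 7 _⊗_ _·_

  -- Coefficients from the constant term upwards. Trailing zeros are allowed, so polynomials are
  -- compared by `_≈_` and degrees are only bounded, through `Degree<`.
  Poly : Set
  Poly = List K

  coeff : Poly → ℕ → K
  coeff []      k       = 0#
  coeff (c ∷ f) zero    = c
  coeff (c ∷ f) (suc k) = coeff f k

  _≈_ : Poly → Poly → Set
  f ≈ g = ∀ k → coeff f k ≡ coeff g k

  Degree< : ℕ → Poly → Set
  Degree< n f = ∀ k → n ≤ k → coeff f k ≡ 0#

  _⊕_ : Poly → Poly → Poly
  []      ⊕ g       = g
  (a ∷ f) ⊕ []      = a ∷ f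
  (a ∷ f) ⊕ (b ∷ g) = a + b ∷ f ⊕ g

  _·_ : K → Poly → Poly
  a · []      = []
  a · (b ∷ f) = a * b ∷ a · f

  _⊗_ : Poly → Poly → Poly
  []      ⊗ g = []
  (a ∷ f) ⊗ g = a · g ⊕ (0# ∷ f ⊗ g)

  linear : K → K → Poly → Poly
  linear a b f = a · f ⊕ (0# ∷ b · f)

  eval : Poly → K → K
  eval []      x = 0#
  eval (c ∷ f) x = c + x * eval f x

  D : Poly → Poly
  D []      = []
  D (c ∷ f) = f ⊕ (0# ∷ D f)

  -- Horner's scheme for f(x + z). Its coefficients are the Taylor coefficients at z, obtained
  -- without dividing by factorials.
  shift : K → Poly → Poly
  shift z []      = []
  shift z (c ∷ f) = (c ∷ []) ⊕ linear z 1# (shift z f)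

  coeff-⊕ : ∀ f g k → coeff (f ⊕ g) k ≡ coeff f k + coeff g k
  coeff-⊕ []      g       k       = sym (+-identityˡ _)
  coeff-⊕ (a ∷ f) []      k       = sym (+-identityʳ _)
  coeff-⊕ (a ∷ f) (b ∷ g) zero    = refl
  coeff-⊕ (a ∷ f) (b ∷ g) (suc k) = coeff-⊕ f g k

  coeff-· : ∀ a f k → coeff (a · f) k ≡ a * coeff f k
  coeff-· a []      k       = sym (zeroʳ a)
  coeff-· a (b ∷ f) zero    = refl
  coeff-· a (b ∷ f) (suc k) = coeff-· a f k

  coeff-linear-0 : ∀ a b f → coeff (linear a b f) 0 ≡ a * coeff f 0
  coeff-linear-0 a b f = trans (coeff-⊕ (a · f) _ 0) (trans (+-identityʳ _) (coeff-· a f 0))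

  coeff-linear-suc : ∀ a b f k → coeff (linear a b f) (suc k) ≡ a * coeff f (suc k) + b * coeff f k
  coeff-linear-suc a b f k = trans (coeff-⊕ (a · f) _ (suc k)) (cong₂ _+_ (coeff-· a f (suc k)) (coeff-· b f k))

  coeff-D : ∀ f k → coeff (D f) k ≡ ι (suc k) * coeff f (suc k)
  coeff-D []      k       = sym (zeroʳ _)
  coeff-D (c ∷ f) zero    = trans (coeff-⊕ f _ 0) (solve 1 (λ x → x :+ κ 0 := (κ 1 :+ κ 0) :* x) refl _)
  coeff-D (c ∷ f) (suc k) = trans (coeff-⊕ f _ (suc k)) (trans (cong (coeff f (suc k) +_) (coeff-D f k))
    (solve 2 (λ x k → x :+ (κ 1 :+ k) :* x := (κ 1 :+ (κ 1 :+ k)) :* x) refl _ (ι k)))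

  coeff-shift-0 : ∀ z c f → coeff (shift z (c ∷ f)) 0 ≡ c + z * coeff (shift z f) 0
  coeff-shift-0 z c f = trans (coeff-⊕ (c ∷ []) (linear z 1# (shift z f)) 0) (cong (c +_) (coeff-linear-0 z 1# (shift z f)))

  coeff-shift-suc : ∀ z c f k → coeff (shift z (c ∷ f)) (suc k) ≡ z * coeff (shift z f) (suc k) + coeff (shift z f) k
  coeff-shift-suc z c f k = trans (coeff-⊕ (c ∷ []) (linear z 1# (shift z f)) (suc k)) (trans (+-identityˡ _)
    (trans (coeff-linear-suc z 1# (shift z f) k) (cong (z * coeff (shift z f) (suc k) +_) (*-identityˡ _))))

  convolution : (ℕ → K) → (ℕ → K) → ℕ → K
  convolution u v = antidiagonal (λ i j → u i * v j)

  convolution-cong : ∀ {u u′ v v′ : ℕ → K} → (∀ i → u i ≡ u′ i) → (∀ i → v i ≡ v′ i) →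
                     ∀ k → convolution u v k ≡ convolution u′ v′ k
  convolution-cong eq eq′ = antidiagonal-cong (λ i j → cong₂ _*_ (eq i) (eq′ j))

  coeff-⊗ : ∀ f g k → coeff (f ⊗ g) k ≡ convolution (coeff f) (coeff g) k
  coeff-⊗ []      g k       = sym (antidiagonal-zero k (λ i j _ → zeroˡ (coeff g j)))
  coeff-⊗ (a ∷ f) g zero    = trans (coeff-⊕ (a · g) _ 0) (cong (_+ 0#) (coeff-· a g 0))
  coeff-⊗ (a ∷ f) g (suc k) = trans (coeff-⊕ (a · g) _ (suc k)) (cong₂ _+_ (coeff-· a g (suc k)) (coeff-⊗ f g k))

  eval-⊕ : ∀ f g x → eval (f ⊕ g) x ≡ eval f x + eval g x
  eval-⊕ []      g       x = sym (+-identityˡ _)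
  eval-⊕ (a ∷ f) []      x = sym (+-identityʳ _)
  eval-⊕ (a ∷ f) (b ∷ g) x = trans (cong (λ y → a + b + x * y) (eval-⊕ f g x))
    (solve 5 (λ a b x y z → a :+ b :+ x :* (y :+ z) := a :+ x :* y :+ (b :+ x :* z)) refl _ _ _ _ _)

  eval-· : ∀ a f x → eval (a · f) x ≡ a * eval f x
  eval-· a []      x = sym (zeroʳ a)
  eval-· a (b ∷ f) x = trans (cong (λ y → a * b + x * y) (eval-· a f x))
    (solve 4 (λ a b x y → a :* b :+ x :* (a :* y) := a :* (b :+ x :* y)) refl _ _ _ _)

  eval-⊗ : ∀ f g x → eval (f ⊗ g) x ≡ eval f x * eval g x
  eval-⊗ []      g x = sym (zeroˡ _)
  eval-⊗ (a ∷ f) g x = trans (eval-⊕ (a · g) _ x)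
    (trans (cong₂ (λ y z → y + (0# + x * z)) (eval-· a g x) (eval-⊗ f g x))
    (solve 4 (λ a x y z → a :* z :+ (κ 0 :+ x :* (y :* z)) := (a :+ x :* y) :* z) refl _ _ _ _))

  eval-linear : ∀ a b f x → eval (linear a b f) x ≡ (a + b * x) * eval f x
  eval-linear a b f x = trans (eval-⊕ (a · f) _ x) (trans (cong₂ (λ y z → y + (0# + x * z)) (eval-· a f x) (eval-· b f x))
    (solve 4 (λ a b x y → a :* y :+ (κ 0 :+ x :* (b :* y)) := (a :+ b :* x) :* y) refl _ _ _ _))

  eval-shift : ∀ z f x → eval (shift z f) x ≡ eval f (x + z)
  eval-shift z []      x = refl
  eval-shift z (c ∷ f) x = trans (eval-⊕ (c ∷ []) (linear z 1# (shift z f)) x)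
    (trans (cong (eval (c ∷ []) x +_) (trans (eval-linear z 1# (shift z f) x) (cong ((z + 1# * x) *_) (eval-shift z f x))))
    (solve 4 (λ c x z y → c :+ x :* κ 0 :+ (z :+ κ 1 :* x) :* y := c :+ (x :+ z) :* y) refl _ _ _ _))

  coeff₀-shift : ∀ z f → coeff (shift z f) 0 ≡ eval f z
  coeff₀-shift z []      = refl
  coeff₀-shift z (c ∷ f) = trans (coeff-shift-0 z c f) (cong (λ y → c + z * y) (coeff₀-shift z f))

  eval-zero : ∀ f x → (∀ k → coeff f k ≡ 0#) → eval f x ≡ 0#
  eval-zero []      x z = refl
  eval-zero (c ∷ f) x z = 0+0≡0 (z 0) (*0≡0 x (eval-zero f x (z ∘ suc)))

  eval-∑ : ∀ n f x → Degree< n f → eval f x ≡ ∑ n (λ i → coeff f i * x ^ i)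
  eval-∑ n       []      x z = sym (∑-zero n (λ i _ → zeroˡ _))
  eval-∑ zero    (c ∷ f) x z = eval-zero (c ∷ f) x (λ k → z k z≤n)
  eval-∑ (suc n) (c ∷ f) x z = cong₂ _+_ (sym (*-identityʳ c))
    (trans (cong (x *_) (eval-∑ n f x (λ k n≤k → z (suc k) (s≤s n≤k))))
    (trans (sym (∑-* n x _)) (∑-cong n (λ i → solve 3 (λ x c y → x :* (c :* y) := c :* (x :* y)) refl _ _ _))))

  shift-zero : ∀ z f → (∀ k → coeff f k ≡ 0#) → ∀ k → coeff (shift z f) k ≡ 0#
  shift-zero z []      zf k       = refl
  shift-zero z (c ∷ f) zf zero    = trans (coeff-shift-0 z c f) (0+0≡0 (zf 0) (*0≡0 z (shift-zero z f (zf ∘ suc) 0)))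
  shift-zero z (c ∷ f) zf (suc k) = trans (coeff-shift-suc z c f k)
    (0+0≡0 (*0≡0 z (shift-zero z f (zf ∘ suc) (suc k))) (shift-zero z f (zf ∘ suc) k))

  shift-cong : ∀ z f g → f ≈ g → shift z f ≈ shift z g
  shift-cong z []      g       eq k       = sym (shift-zero z g (λ k → sym (eq k)) k)
  shift-cong z (c ∷ f) []      eq k       = shift-zero z (c ∷ f) eq k
  shift-cong z (c ∷ f) (b ∷ g) eq zero    = trans (coeff-shift-0 z c f)
    (trans (cong₂ (λ x y → x + z * y) (eq 0) (shift-cong z f g (eq ∘ suc) 0)) (sym (coeff-shift-0 z b g)))
  shift-cong z (c ∷ f) (b ∷ g) eq (suc k) = trans (coeff-shift-suc z c f k)
    (trans (cong₂ (λ x y → z * x + y) (shift-cong z f g (eq ∘ suc) (suc k)) (shift-cong z f g (eq ∘ suc) k))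
    (sym (coeff-shift-suc z b g k)))

  shift-⊕ : ∀ z f g k → coeff (shift z (f ⊕ g)) k ≡ coeff (shift z f) k + coeff (shift z g) k
  shift-⊕ z []      g       k       = sym (+-identityˡ _)
  shift-⊕ z (a ∷ f) []      k       = sym (+-identityʳ _)
  shift-⊕ z (a ∷ f) (b ∷ g) zero    = trans (coeff-shift-0 z (a + b) (f ⊕ g))
    (trans (cong (λ y → a + b + z * y) (shift-⊕ z f g 0))
    (trans (solve 5 (λ a b z x y → a :+ b :+ z :* (x :+ y) := a :+ z :* x :+ (b :+ z :* y)) refl _ _ _ _ _)
    (sym (cong₂ _+_ (coeff-shift-0 z a f) (coeff-shift-0 z b g)))))
  shift-⊕ z (a ∷ f) (b ∷ g) (suc k) = trans (coeff-shift-suc z (a + b) (f ⊕ g) k)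
    (trans (cong₂ (λ x y → z * x + y) (shift-⊕ z f g (suc k)) (shift-⊕ z f g k))
    (trans (solve 5 (λ z a b c d → z :* (a :+ b) :+ (c :+ d) := z :* a :+ c :+ (z :* b :+ d)) refl _ _ _ _ _)
    (sym (cong₂ _+_ (coeff-shift-suc z a f k) (coeff-shift-suc z b g k)))))

  shift-· : ∀ z a f k → coeff (shift z (a · f)) k ≡ a * coeff (shift z f) k
  shift-· z a []      k       = sym (zeroʳ a)
  shift-· z a (b ∷ f) zero    = trans (coeff-shift-0 z (a * b) (a · f))
    (trans (cong (λ y → a * b + z * y) (shift-· z a f 0))
    (trans (solve 4 (λ a b z x → a :* b :+ z :* (a :* x) := a :* (b :+ z :* x)) refl _ _ _ _)
    (cong (a *_) (sym (coeff-shift-0 z b f)))))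
  shift-· z a (b ∷ f) (suc k) = trans (coeff-shift-suc z (a * b) (a · f) k)
    (trans (cong₂ (λ x y → z * x + y) (shift-· z a f (suc k)) (shift-· z a f k))
    (trans (solve 4 (λ z a x y → z :* (a :* x) :+ a :* y := a :* (z :* x :+ y)) refl _ _ _ _)
    (cong (a *_) (sym (coeff-shift-suc z b f k)))))

  shift-linear : ∀ z a b f → shift z (linear a b f) ≈ linear (a + b * z) b (shift z f)
  shift-linear z a b f zero = begin
    coeff (shift z (linear a b f)) 0
      ≡⟨ shift-⊕ z (a · f) _ 0 ⟩
    coeff (shift z (a · f)) 0 + coeff (shift z (0# ∷ b · f)) 0
      ≡⟨ cong₂ _+_ (shift-· z a f 0) (coeff-shift-0 z 0# (b · f)) ⟩
    a * coeff (shift z f) 0 + (0# + z * coeff (shift z (b · f)) 0)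
      ≡⟨ cong (λ y → a * coeff (shift z f) 0 + (0# + z * y)) (shift-· z b f 0) ⟩
    a * coeff (shift z f) 0 + (0# + z * (b * coeff (shift z f) 0))
      ≡⟨ solve 4 (λ a b z x → a :* x :+ (κ 0 :+ z :* (b :* x)) := (a :+ b :* z) :* x) refl _ _ _ _ ⟩
    (a + b * z) * coeff (shift z f) 0
      ≡⟨ coeff-linear-0 (a + b * z) b (shift z f) ⟨
    coeff (linear (a + b * z) b (shift z f)) 0 ∎
  shift-linear z a b f (suc k) = begin
    coeff (shift z (linear a b f)) (suc k)
      ≡⟨ shift-⊕ z (a · f) _ (suc k) ⟩
    coeff (shift z (a · f)) (suc k) + coeff (shift z (0# ∷ b · f)) (suc k)
      ≡⟨ cong₂ _+_ (shift-· z a f (suc k)) (coeff-shift-suc z 0# (b · f) k) ⟩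
    a * x + (z * coeff (shift z (b · f)) (suc k) + coeff (shift z (b · f)) k)
      ≡⟨ cong₂ (λ s t → a * x + (z * s + t)) (shift-· z b f (suc k)) (shift-· z b f k) ⟩
    a * x + (z * (b * x) + b * y)
      ≡⟨ solve 5 (λ a b z x y → a :* x :+ (z :* (b :* x) :+ b :* y) := (a :+ b :* z) :* x :+ b :* y) refl _ _ _ _ _ ⟩
    (a + b * z) * x + b * y
      ≡⟨ coeff-linear-suc (a + b * z) b (shift z f) k ⟨
    coeff (linear (a + b * z) b (shift z f)) (suc k) ∎
    where x = coeff (shift z f) (suc k)
          y = coeff (shift z f) k

  coeff-shift-D : ∀ z f k → coeff (shift z (D f)) k ≡ ι (suc k) * coeff (shift z f) (suc k)
  coeff-shift-D z []      k    = sym (zeroʳ _)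
  coeff-shift-D z (c ∷ f) zero = begin
    coeff (shift z (f ⊕ (0# ∷ D f))) 0
      ≡⟨ shift-⊕ z f (0# ∷ D f) 0 ⟩
    coeff (shift z f) 0 + coeff (shift z (0# ∷ D f)) 0
      ≡⟨ cong (coeff (shift z f) 0 +_) (trans (coeff-shift-0 z 0# (D f)) (cong (λ y → 0# + z * y) (coeff-shift-D z f 0))) ⟩
    coeff (shift z f) 0 + (0# + z * (ι 1 * coeff (shift z f) 1))
      ≡⟨ solve 3 (λ x z y → x :+ (κ 0 :+ z :* ((κ 1 :+ κ 0) :* y)) := (κ 1 :+ κ 0) :* (z :* y :+ x)) refl _ _ _ ⟩
    ι 1 * (z * coeff (shift z f) 1 + coeff (shift z f) 0)
      ≡⟨ cong (ι 1 *_) (coeff-shift-suc z c f 0) ⟨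
    ι 1 * coeff (shift z (c ∷ f)) 1 ∎
  coeff-shift-D z (c ∷ f) (suc k) = begin
    coeff (shift z (f ⊕ (0# ∷ D f))) (suc k)
      ≡⟨ shift-⊕ z f (0# ∷ D f) (suc k) ⟩
    x + coeff (shift z (0# ∷ D f)) (suc k)
      ≡⟨ cong (x +_) (trans (coeff-shift-suc z 0# (D f) k)
           (cong₂ (λ s t → z * s + t) (coeff-shift-D z f (suc k)) (coeff-shift-D z f k))) ⟩
    x + (z * (ι (suc (suc k)) * y) + ι (suc k) * x)
      ≡⟨ solve 4 (λ x z y k → x :+ (z :* ((κ 1 :+ k) :* y) :+ k :* x) := (κ 1 :+ k) :* (z :* y :+ x)) refl x z y (ι (suc k)) ⟩
    ι (suc (suc k)) * (z * y + x)
      ≡⟨ cong (ι (suc (suc k)) *_) (coeff-shift-suc z c f (suc k)) ⟨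
    ι (suc (suc k)) * coeff (shift z (c ∷ f)) (suc (suc k)) ∎
    where x = coeff (shift z f) (suc k)
          y = coeff (shift z f) (suc (suc k))

  ⊗-distribʳ-⊕ : ∀ f h g k → coeff ((f ⊕ h) ⊗ g) k ≡ coeff (f ⊗ g) k + coeff (h ⊗ g) k
  ⊗-distribʳ-⊕ f h g k = begin
    coeff ((f ⊕ h) ⊗ g) k
      ≡⟨ coeff-⊗ (f ⊕ h) g k ⟩
    convolution (coeff (f ⊕ h)) (coeff g) k
      ≡⟨ antidiagonal-cong (λ i j → trans (cong (_* coeff g j) (coeff-⊕ f h i))
           (solve 3 (λ x y z → (x :+ y) :* z := x :* z :+ y :* z) refl (coeff f i) (coeff h i) (coeff g j))) k ⟩
    antidiagonal (λ i j → coeff f i * coeff g j + coeff h i * coeff g j) k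
      ≡⟨ antidiagonal-+ (λ i j → coeff f i * coeff g j) (λ i j → coeff h i * coeff g j) k ⟩
    convolution (coeff f) (coeff g) k + convolution (coeff h) (coeff g) k
      ≡⟨ cong₂ _+_ (coeff-⊗ f g k) (coeff-⊗ h g k) ⟨
    coeff (f ⊗ g) k + coeff (h ⊗ g) k ∎

  ·-⊗-assoc : ∀ a f g k → coeff ((a · f) ⊗ g) k ≡ a * coeff (f ⊗ g) k
  ·-⊗-assoc a f g k = begin
    coeff ((a · f) ⊗ g) k
      ≡⟨ coeff-⊗ (a · f) g k ⟩
    convolution (coeff (a · f)) (coeff g) k
      ≡⟨ antidiagonal-cong (λ i j → trans (cong (_* coeff g j) (coeff-· a f i)) (*-assoc a (coeff f i) (coeff g j))) k ⟩
    antidiagonal (λ i j → a * (coeff f i * coeff g j)) k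
      ≡⟨ antidiagonal-* a (λ i j → coeff f i * coeff g j) k ⟩
    a * convolution (coeff f) (coeff g) k
      ≡⟨ cong (a *_) (coeff-⊗ f g k) ⟨
    a * coeff (f ⊗ g) k ∎

  linear-⊗ : ∀ a b f g → linear a b f ⊗ g ≈ linear a b (f ⊗ g)
  linear-⊗ a b f g zero = begin
    coeff (linear a b f ⊗ g) 0
      ≡⟨ ⊗-distribʳ-⊕ (a · f) (0# ∷ b · f) g 0 ⟩
    coeff ((a · f) ⊗ g) 0 + coeff ((0# ∷ b · f) ⊗ g) 0
      ≡⟨ cong₂ _+_ (·-⊗-assoc a f g 0) (trans (coeff-⊕ (0# · g) _ 0) (cong (_+ 0#) (coeff-· 0# g 0))) ⟩
    a * coeff (f ⊗ g) 0 + (0# * coeff g 0 + 0#)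
      ≡⟨ solve 2 (λ x y → x :+ (κ 0 :* y :+ κ 0) := x) refl _ _ ⟩
    a * coeff (f ⊗ g) 0
      ≡⟨ coeff-linear-0 a b (f ⊗ g) ⟨
    coeff (linear a b (f ⊗ g)) 0 ∎
  linear-⊗ a b f g (suc k) = begin
    coeff (linear a b f ⊗ g) (suc k)
      ≡⟨ ⊗-distribʳ-⊕ (a · f) (0# ∷ b · f) g (suc k) ⟩
    coeff ((a · f) ⊗ g) (suc k) + coeff ((0# ∷ b · f) ⊗ g) (suc k)
      ≡⟨ cong₂ _+_ (·-⊗-assoc a f g (suc k)) (trans (coeff-⊕ (0# · g) _ (suc k))
           (cong₂ _+_ (coeff-· 0# g (suc k)) (·-⊗-assoc b f g k))) ⟩
    a * coeff (f ⊗ g) (suc k) + (0# * coeff g (suc k) + b * coeff (f ⊗ g) k)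
      ≡⟨ solve 3 (λ x y z → x :+ (κ 0 :* y :+ z) := x :+ z) refl _ _ _ ⟩
    a * coeff (f ⊗ g) (suc k) + b * coeff (f ⊗ g) k
      ≡⟨ coeff-linear-suc a b (f ⊗ g) k ⟨
    coeff (linear a b (f ⊗ g)) (suc k) ∎

  linear-cong : ∀ a b f g → f ≈ g → linear a b f ≈ linear a b g
  linear-cong a b f g eq zero    = trans (coeff-linear-0 a b f) (trans (cong (a *_) (eq 0)) (sym (coeff-linear-0 a b g)))
  linear-cong a b f g eq (suc k) = trans (coeff-linear-suc a b f k)
    (trans (cong₂ (λ x y → a * x + b * y) (eq (suc k)) (eq k)) (sym (coeff-linear-suc a b g k)))

  private
    coeff-0∷[] : ∀ k → coeff (0# ∷ []) k ≡ 0#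
    coeff-0∷[] zero    = refl
    coeff-0∷[] (suc k) = refl

  shift-⊗ : ∀ z f g → shift z (f ⊗ g) ≈ shift z f ⊗ shift z g
  shift-⊗ z []      g k = refl
  shift-⊗ z (a ∷ f) g k = begin
    coeff (shift z (a · g ⊕ (0# ∷ f ⊗ g))) k
      ≡⟨ shift-⊕ z (a · g) (0# ∷ f ⊗ g) k ⟩
    coeff (shift z (a · g)) k + coeff (shift z (0# ∷ f ⊗ g)) k
      ≡⟨ cong₂ _+_ (shift-· z a g k) (trans (coeff-⊕ (0# ∷ []) (linear z 1# (shift z (f ⊗ g))) k)
           (cong₂ _+_ (coeff-0∷[] k) (linear-cong z 1# (shift z (f ⊗ g)) (shift z f ⊗ shift z g) (shift-⊗ z f g) k))) ⟩
    a * coeff (shift z g) k + (0# + coeff (linear z 1# (shift z f ⊗ shift z g)) k)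
      ≡⟨ solve 2 (λ x y → x :+ (κ 0 :+ y) := x :+ κ 0 :+ y) refl _ _ ⟩
    a * coeff (shift z g) k + 0# + coeff (linear z 1# (shift z f ⊗ shift z g)) k
      ≡⟨ cong₂ _+_ (cong₂ _+_ (coeff-· a (shift z g) k) (coeff-0∷[] k)) (linear-⊗ z 1# (shift z f) (shift z g) k) ⟨
    coeff (a · shift z g) k + coeff (0# ∷ []) k + coeff (linear z 1# (shift z f) ⊗ shift z g) k
      ≡⟨ cong (_+ coeff (linear z 1# (shift z f) ⊗ shift z g) k) (coeff-⊕ (a · shift z g) (0# ∷ []) k) ⟨
    coeff ((a ∷ []) ⊗ shift z g) k + coeff (linear z 1# (shift z f) ⊗ shift z g) k
      ≡⟨ ⊗-distribʳ-⊕ (a ∷ []) (linear z 1# (shift z f)) (shift z g) k ⟨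
    coeff (shift z (a ∷ f) ⊗ shift z g) k ∎

  Degree<-⊗ : ∀ a b f g → Degree< a f → Degree< (suc b) g → Degree< (a ℕ.+ b) (f ⊗ g)
  Degree<-⊗ a b f g df dg k a+b≤k = trans (coeff-⊗ f g k) (antidiagonal-zero k z)
    where
    z : ∀ i j → i ℕ.+ j ≡ k → coeff f i * coeff g j ≡ 0#
    z i j refl with a ℕ.≤? i
    ... | yes a≤i = 0*≡0 _ (df i a≤i)
    ... | no  a≰i = *0≡0 _ (dg j (ℕ.+-cancelˡ-< a b j (ℕ.≤-<-trans a+b≤k (ℕ.+-monoˡ-< j (ℕ.≰⇒> a≰i)))))

  -- Synthetic division by x - a: the intermediate values of Horner's scheme at a are the
  -- coefficients of the quotient, and the last value is the remainder.
  quotient : K → Poly → Poly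
  quotient a []      = []
  quotient a (c ∷ f) = eval f a ∷ quotient a f

  quotient-linear : ∀ a f → f ≈ (eval f a ∷ []) ⊕ linear (- a) 1# (quotient a f)
  quotient-linear a []      zero          = sym (+-identityˡ 0#)
  quotient-linear a []      (suc k)       = refl
  quotient-linear a (c ∷ f) zero          = solve 3 (λ c a y → c := c :+ a :* y :+ ((:- a) :* y :+ κ 0)) refl _ _ _
  quotient-linear a (c ∷ f) (suc k)       = trans (quotient-linear a f k) (lemma k)
    where
    lemma : ∀ k → coeff ((eval f a ∷ []) ⊕ linear (- a) 1# (quotient a f)) k ≡
                  coeff ((eval (c ∷ f) a ∷ []) ⊕ linear (- a) 1# (eval f a ∷ quotient a f)) (suc k)
    lemma zero = begin
      coeff ((eval f a ∷ []) ⊕ linear (- a) 1# (quotient a f)) 0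
        ≡⟨ coeff-⊕ (eval f a ∷ []) (linear (- a) 1# (quotient a f)) 0 ⟩
      eval f a + coeff (linear (- a) 1# (quotient a f)) 0
        ≡⟨ cong (eval f a +_) (coeff-linear-0 (- a) 1# (quotient a f)) ⟩
      eval f a + (- a) * coeff (quotient a f) 0
        ≡⟨ solve 2 (λ x y → x :+ y := y :+ κ 1 :* x) refl _ _ ⟩
      (- a) * coeff (quotient a f) 0 + 1# * eval f a
        ≡⟨ coeff-linear-suc (- a) 1# (eval f a ∷ quotient a f) 0 ⟨
      coeff (linear (- a) 1# (eval f a ∷ quotient a f)) 1 ∎
    lemma (suc k) = begin
      coeff ((eval f a ∷ []) ⊕ linear (- a) 1# (quotient a f)) (suc k)
        ≡⟨ trans (coeff-⊕ (eval f a ∷ []) (linear (- a) 1# (quotient a f)) (suc k)) (+-identityˡ _) ⟩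
      coeff (linear (- a) 1# (quotient a f)) (suc k)
        ≡⟨ coeff-linear-suc (- a) 1# (quotient a f) k ⟩
      (- a) * coeff (quotient a f) (suc k) + 1# * coeff (quotient a f) k
        ≡⟨ coeff-linear-suc (- a) 1# (eval f a ∷ quotient a f) (suc k) ⟨
      coeff (linear (- a) 1# (eval f a ∷ quotient a f)) (suc (suc k)) ∎

  Degree<-quotient : ∀ a n f → Degree< (suc n) f → Degree< n (quotient a f)
  Degree<-quotient a n       []      df k       n≤k       = refl
  Degree<-quotient a zero    (c ∷ f) df zero    n≤k       = eval-zero f a (λ k → df (suc k) (s≤s z≤n))
  Degree<-quotient a zero    (c ∷ f) df (suc k) n≤k       = Degree<-quotient a zero f (λ j _ → df (suc j) (s≤s z≤n)) k z≤n
  Degree<-quotient a (suc n) (c ∷ f) df (suc k) (s≤s n≤k) =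
    Degree<-quotient a n f (λ j n<j → df (suc j) (s≤s n<j)) k n≤k

  -- Taylor coefficients rather than derivatives measure the multiplicity, since iterated
  -- derivatives lose information in positive characteristic.
  VanishesTo : ℕ → K → Poly → Set
  VanishesTo r a f = ∀ j → j < r → coeff (shift a f) j ≡ 0#

  module _ (a : K) (f : Poly) (fa≡0 : eval f a ≡ 0#) (w : K) where

    private
      q = quotient a f

      shift-f : ∀ k → coeff (shift w f) k ≡ coeff (linear (- a + 1# * w) 1# (shift w q)) k
      shift-f k = begin
        coeff (shift w f) k
          ≡⟨ shift-cong w f ((eval f a ∷ []) ⊕ linear (- a) 1# q) (quotient-linear a f) k ⟩
        coeff (shift w ((eval f a ∷ []) ⊕ linear (- a) 1# q)) k
          ≡⟨ shift-⊕ w (eval f a ∷ []) (linear (- a) 1# q) k ⟩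
        coeff (shift w (eval f a ∷ [])) k + coeff (shift w (linear (- a) 1# q)) k
          ≡⟨ cong₂ _+_ (shift-zero w (eval f a ∷ []) (λ { zero → fa≡0 ; (suc k) → refl }) k) (shift-linear w (- a) 1# q k) ⟩
        0# + coeff (linear (- a + 1# * w) 1# (shift w q)) k
          ≡⟨ +-identityˡ _ ⟩
        coeff (linear (- a + 1# * w) 1# (shift w q)) k ∎

      shift-f-0 : coeff (shift w f) 0 ≡ (w - a) * coeff (shift w q) 0
      shift-f-0 = trans (shift-f 0) (trans (coeff-linear-0 _ _ (shift w q))
        (solve 3 (λ w a y → (:- a :+ κ 1 :* w) :* y := (w :- a) :* y) refl _ _ _))

      shift-f-suc : ∀ k → coeff (shift w f) (suc k) ≡ (w - a) * coeff (shift w q) (suc k) + coeff (shift w q) k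
      shift-f-suc k = trans (shift-f (suc k)) (trans (coeff-linear-suc _ _ (shift w q) k)
        (solve 4 (λ w a x y → (:- a :+ κ 1 :* w) :* x :+ κ 1 :* y := (w :- a) :* x :+ y) refl _ _ _ _))

    VanishesTo-quotient-≡ : ∀ r → w ≡ a → VanishesTo (suc r) w f → VanishesTo r w q
    VanishesTo-quotient-≡ r w≡a van k k<r = begin
      coeff (shift w q) k                                           ≡⟨ +-identityˡ _ ⟨
      0# + coeff (shift w q) k                                      ≡⟨ cong (_+ coeff (shift w q) k) (0*≡0 _ (x≡y⇒x-y≡0 w≡a)) ⟨
      (w - a) * coeff (shift w q) (suc k) + coeff (shift w q) k     ≡⟨ shift-f-suc k ⟨
      coeff (shift w f) (suc k)                                     ≡⟨ van (suc k) (s≤s k<r) ⟩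
      0#                                                            ∎

    -- At w the factor x - a has the nonzero constant term w - a, so the coefficients of f determine
    -- those of the quotient by a triangular system, solved upwards from index 0.
    VanishesTo-quotient-≢ : ∀ r → a ≢ w → VanishesTo r w f → VanishesTo r w q
    VanishesTo-quotient-≢ r a≢w van zero    k<r = xy≡0⇒y≡0 (λ e → a≢w (sym (x-y≡0⇒x≡y w a e))) (trans (sym shift-f-0) (van 0 k<r))
    VanishesTo-quotient-≢ r a≢w van (suc k) k<r = xy≡0⇒y≡0 (λ e → a≢w (sym (x-y≡0⇒x≡y w a e))) (begin
      (w - a) * coeff (shift w q) (suc k)                            ≡⟨ +-identityʳ _ ⟨
      (w - a) * coeff (shift w q) (suc k) + 0#                       ≡⟨ cong ((w - a) * coeff (shift w q) (suc k) +_)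
                                                                          (VanishesTo-quotient-≢ r a≢w van k (ℕ.<-trans (ℕ.n<1+n k) k<r)) ⟨
      (w - a) * coeff (shift w q) (suc k) + coeff (shift w q) k      ≡⟨ shift-f-suc k ⟨
      coeff (shift w f) (suc k)                                      ≡⟨ van (suc k) k<r ⟩
      0#                                                             ∎)

  -- Dividing by x - a lowers the degree bound and the multiplicity at a by one and keeps the
  -- multiplicities at the other points. The orders may differ from point to point because the
  -- induction lowers them one at a time.
  zero-by-multiplicities : ∀ n f (rs : List (K × ℕ)) → AllPairs (λ x y → proj₁ x ≢ proj₁ y) rs →
    All (λ (a , r) → VanishesTo r a f) rs → n ≤ sumℕ (map proj₂ rs) → Degree< n f → ∀ k → coeff f k ≡ 0#
  zero-by-multiplicities zero    f rs distinct van n≤ df k = df k z≤n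
  zero-by-multiplicities (suc n) f ((a , zero) ∷ rs) (_ ∷ distinct) (_ ∷ van) n≤ df =
    zero-by-multiplicities (suc n) f rs distinct van n≤ df
  zero-by-multiplicities (suc n) f ((a , suc r) ∷ rs) (a≢ ∷ distinct) (va ∷ van) (s≤s n≤) df = f≡0
    where
    q = quotient a f
    fa≡0 : eval f a ≡ 0#
    fa≡0 = trans (sym (coeff₀-shift a f)) (va 0 (s≤s z≤n))
    van-q : ∀ {rs} → All (λ (b , _) → a ≢ b) rs → All (λ (b , r) → VanishesTo r b f) rs → All (λ (b , r) → VanishesTo r b q) rs
    van-q []         []         = []
    van-q (a≢b ∷ a≢) (vb ∷ van) = VanishesTo-quotient-≢ a f fa≡0 _ _ a≢b vb ∷ van-q a≢ van
    q≡0 : ∀ k → coeff q k ≡ 0#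
    q≡0 = zero-by-multiplicities n q ((a , r) ∷ rs) (a≢ ∷ distinct)
      (VanishesTo-quotient-≡ a f fa≡0 a r refl va ∷ van-q a≢ van) n≤ (Degree<-quotient a n f df)
    linear-q≡0 : ∀ k → coeff (linear (- a) 1# q) k ≡ 0#
    linear-q≡0 zero    = trans (coeff-linear-0 _ _ q) (*0≡0 _ (q≡0 0))
    linear-q≡0 (suc k) = trans (coeff-linear-suc _ _ q k) (0+0≡0 (*0≡0 _ (q≡0 (suc k))) (*0≡0 _ (q≡0 k)))
    f≡0 : ∀ k → coeff f k ≡ 0#
    f≡0 k = trans (quotient-linear a f k) (trans (coeff-⊕ (eval f a ∷ []) (linear (- a) 1# q) k)
      (0+0≡0 (const≡0 k) (linear-q≡0 k)))
      where
      const≡0 : ∀ k → coeff (eval f a ∷ []) k ≡ 0#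
      const≡0 zero    = fa≡0
      const≡0 (suc k) = refl

  zero-by-roots : ∀ r f (A : List K) → Unique A → All (λ a → VanishesTo r a f) A →
                  Degree< (length A ℕ.* r) f → ∀ k → coeff f k ≡ 0#
  zero-by-roots r f A unique van df = zero-by-multiplicities (length A ℕ.* r) f (map (_, r) A)
    (AllPairs.map⁺ unique) (All.map⁺ van) (ℕ.≤-reflexive (total A)) df
    where
    total : ∀ A → length A ℕ.* r ≡ sumℕ (map proj₂ (map (_, r) A))
    total []      = refl
    total (a ∷ A) = cong (r ℕ.+_) (total A)

-- Binomial coefficients and powers of linear polynomials.

module Binomials (F : DiscreteField) where
  open Polynomials F public
  open ≡-Reasoning

  -- The binomial coefficient (j + e choose j).
  bin : ℕ → ℕ → K
  bin zero    e       = 1#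
  bin (suc j) zero    = 1#
  bin (suc j) (suc e) = bin j (suc e) + bin (suc j) e

  bin-0 : ∀ j → bin j 0 ≡ 1#
  bin-0 zero    = refl
  bin-0 (suc j) = refl

  bin-comm : ∀ j e → bin j e ≡ bin e j
  bin-comm zero    e       = sym (bin-0 e)
  bin-comm (suc j) zero    = refl
  bin-comm (suc j) (suc e) = trans (cong₂ _+_ (bin-comm j (suc e)) (bin-comm (suc j) e)) (+-comm _ _)

  private
    absorbˡ : ∀ j e → ι (suc j) * bin (suc j) e ≡ (ι (suc j) + ι e) * bin j e
    absorbʳ : ∀ j e → ι (suc e) * bin j (suc e) ≡ (ι j + ι (suc e)) * bin j e

  -- The quotient of neighbouring binomial coefficients in one row, cleared of denominators so that
  -- it holds in every characteristic. It follows from the two absorption identities, which in turn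
  -- recurse through it on a smaller row.
  bin-ratio : ∀ j e → ι (suc j) * bin (suc j) e ≡ ι (suc e) * bin j (suc e)
  bin-ratio j e = trans (absorbˡ j e) (trans
    (solve 3 (λ j e b → (κ 1 :+ j :+ e) :* b := (j :+ (κ 1 :+ e)) :* b) refl (ι j) (ι e) (bin j e))
    (sym (absorbʳ j e)))

  absorbˡ j zero    = trans (cong (ι (suc j) *_) (sym (bin-0 j)))
    (solve 2 (λ j b → j :* b := (j :+ κ 0) :* b) refl _ _)
  absorbˡ j (suc e) = begin
    ι (suc j) * (bin j (suc e) + bin (suc j) e)               ≡⟨ solve 3 (λ x y z → x :* (y :+ z) := x :* y :+ x :* z) refl _ _ _ ⟩
    ι (suc j) * bin j (suc e) + ι (suc j) * bin (suc j) e     ≡⟨ cong (ι (suc j) * bin j (suc e) +_) (bin-ratio j e) ⟩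
    ι (suc j) * bin j (suc e) + ι (suc e) * bin j (suc e)     ≡⟨ solve 3 (λ x y z → x :* z :+ y :* z := (x :+ y) :* z) refl _ _ _ ⟩
    (ι (suc j) + ι (suc e)) * bin j (suc e)                   ∎
  absorbʳ zero    e = solve 1 (λ e → e :* κ 1 := (κ 0 :+ e) :* κ 1) refl _
  absorbʳ (suc j) e = begin
    ι (suc e) * (bin j (suc e) + bin (suc j) e)               ≡⟨ solve 3 (λ x y z → x :* (y :+ z) := x :* y :+ x :* z) refl _ _ _ ⟩
    ι (suc e) * bin j (suc e) + ι (suc e) * bin (suc j) e     ≡⟨ cong (_+ ι (suc e) * bin (suc j) e) (bin-ratio j e) ⟨
    ι (suc j) * bin (suc j) e + ι (suc e) * bin (suc j) e     ≡⟨ solve 3 (λ x y z → x :* z :+ y :* z := (x :+ y) :* z) refl _ _ _ ⟩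
    (ι (suc j) + ι (suc e)) * bin (suc j) e                   ∎

  linearPower : K → K → ℕ → Poly
  linearPower a b zero    = 1# ∷ []
  linearPower a b (suc n) = linear a b (linearPower a b n)

  Degree<-linearPower : ∀ a b n → Degree< (suc n) (linearPower a b n)
  Degree<-linearPower a b zero    (suc k) _         = refl
  Degree<-linearPower a b (suc n) (suc k) (s≤s n<k) = trans (coeff-linear-suc a b (linearPower a b n) k)
    (0+0≡0 (*0≡0 a (Degree<-linearPower a b n (suc k) (ℕ.m≤n⇒m≤1+n n<k))) (*0≡0 b (Degree<-linearPower a b n k n<k)))

  coeff-linearPower : ∀ a b n j e → j ℕ.+ e ≡ n → coeff (linearPower a b n) j ≡ bin j e * (a ^ e * b ^ j)
  coeff-linearPower a b zero    zero    zero    _    = solve 0 (κ 1 := κ 1 :* (κ 1 :* κ 1)) refl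
  coeff-linearPower a b (suc n) zero    (suc e) refl = begin
    coeff (linear a b (linearPower a b n)) 0   ≡⟨ coeff-linear-0 a b (linearPower a b n) ⟩
    a * coeff (linearPower a b n) 0            ≡⟨ cong (a *_) (coeff-linearPower a b n 0 n refl) ⟩
    a * (1# * (a ^ n * 1#))                    ≡⟨ solve 2 (λ a x → a :* (κ 1 :* (x :* κ 1)) := κ 1 :* (a :* x :* κ 1)) refl _ _ ⟩
    1# * (a * a ^ n * 1#)                      ∎
  coeff-linearPower a b (suc n) (suc j) zero    eq   = begin
    coeff (linear a b (linearPower a b n)) (suc j)
      ≡⟨ coeff-linear-suc a b (linearPower a b n) j ⟩
    a * coeff (linearPower a b n) (suc j) + b * coeff (linearPower a b n) j
      ≡⟨ cong₂ (λ x y → a * x + b * y)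
           (Degree<-linearPower a b n (suc j) (ℕ.≤-reflexive (sym (trans (sym (ℕ.+-identityʳ (suc j))) eq))))
           (coeff-linearPower a b n j 0 (ℕ.suc-injective eq)) ⟩
    a * 0# + b * (bin j 0 * (1# * b ^ j))
      ≡⟨ cong (λ x → a * 0# + b * (x * (1# * b ^ j))) (bin-0 j) ⟩
    a * 0# + b * (1# * (1# * b ^ j))
      ≡⟨ solve 3 (λ a b x → a :* κ 0 :+ b :* (κ 1 :* (κ 1 :* x)) := κ 1 :* (κ 1 :* (b :* x))) refl _ _ _ ⟩
    1# * (1# * (b * b ^ j)) ∎
  coeff-linearPower a b (suc n) (suc j) (suc e) eq   = begin
    coeff (linear a b (linearPower a b n)) (suc j)
      ≡⟨ coeff-linear-suc a b (linearPower a b n) j ⟩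
    a * coeff (linearPower a b n) (suc j) + b * coeff (linearPower a b n) j
      ≡⟨ cong₂ (λ x y → a * x + b * y)
           (coeff-linearPower a b n (suc j) e (trans (sym (ℕ.+-suc j e)) (ℕ.suc-injective eq)))
           (coeff-linearPower a b n j (suc e) (ℕ.suc-injective eq)) ⟩
    a * (bin (suc j) e * (a ^ e * (b * b ^ j))) + b * (bin j (suc e) * (a * a ^ e * b ^ j))
      ≡⟨ solve 6 (λ a b x y s t → a :* (x :* (s :* (b :* t))) :+ b :* (y :* (a :* s :* t)) := (y :+ x) :* (a :* s :* (b :* t)))
           refl a b (bin (suc j) e) (bin j (suc e)) (a ^ e) (b ^ j) ⟩
    (bin j (suc e) + bin (suc j) e) * (a * a ^ e * (b * b ^ j)) ∎

  shift-linearPower : ∀ z a b n → shift z (linearPower a b n) ≈ linearPower (a + b * z) b n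
  shift-linearPower z a b zero    zero    = +-identityʳ 1#
  shift-linearPower z a b zero    (suc k) = refl
  shift-linearPower z a b (suc n) k       = trans (shift-linear z a b (linearPower a b n) k)
    (linear-cong (a + b * z) b (shift z (linearPower a b n)) (linearPower (a + b * z) b n) (shift-linearPower z a b n) k)

  eval-linearPower : ∀ a b n x → eval (linearPower a b n) x ≡ (a + b * x) ^ n
  eval-linearPower a b zero    x = solve 1 (λ x → κ 1 :+ x :* κ 0 := κ 1) refl x
  eval-linearPower a b (suc n) x = trans (eval-linear a b (linearPower a b n) x) (cong ((a + b * x) *_) (eval-linearPower a b n x))

-- The monic polynomial with prescribed roots.

module RootPolynomials (F : DiscreteField) where
  open Binomials F public
  open ≡-Reasoning

  rootPoly : List K → Poly
  rootPoly []      = 1# ∷ []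
  rootPoly (b ∷ A) = linear (- b) 1# (rootPoly A)

  eval-rootPoly-∷ : ∀ b A x → eval (rootPoly (b ∷ A)) x ≡ (x - b) * eval (rootPoly A) x
  eval-rootPoly-∷ b A x = trans (eval-linear (- b) 1# (rootPoly A) x)
    (cong (_* eval (rootPoly A) x) (solve 2 (λ b x → :- b :+ κ 1 :* x := x :- b) refl b x))

  eval-rootPoly-∈ : ∀ A {x} → x ∈ A → eval (rootPoly A) x ≡ 0#
  eval-rootPoly-∈ (b ∷ A) {x} (here refl) = trans (eval-rootPoly-∷ b A x) (0*≡0 _ (-‿inverseʳ x))
  eval-rootPoly-∈ (b ∷ A) {x} (there x∈A) = trans (eval-rootPoly-∷ b A x) (*0≡0 _ (eval-rootPoly-∈ A x∈A))

  eval-rootPoly-≡0 : ∀ A {x} → eval (rootPoly A) x ≡ 0# → x ∈ A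
  eval-rootPoly-≡0 []      {x} eq = contradiction (trans (solve 1 (λ x → κ 1 := κ 1 :+ x :* κ 0) refl x) eq) 1≢0
  eval-rootPoly-≡0 (b ∷ A) {x} eq with x ≟ b
  ... | yes x≡b = here x≡b
  ... | no  x≢b = there (eval-rootPoly-≡0 A (xy≡0⇒y≡0 (x≢b ∘ x-y≡0⇒x≡y x b) (trans (sym (eval-rootPoly-∷ b A x)) eq)))

  module _ (z : K) where

    taylor-rootPoly-0 : ∀ b A → coeff (shift z (rootPoly (b ∷ A))) 0 ≡ (z - b) * coeff (shift z (rootPoly A)) 0
    taylor-rootPoly-0 b A = trans (shift-linear z (- b) 1# (rootPoly A) 0) (trans (coeff-linear-0 _ _ (shift z (rootPoly A)))
      (solve 3 (λ b z x → (:- b :+ κ 1 :* z) :* x := (z :- b) :* x) refl b z _))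

    taylor-rootPoly-suc : ∀ b A k → coeff (shift z (rootPoly (b ∷ A))) (suc k) ≡
                          (z - b) * coeff (shift z (rootPoly A)) (suc k) + coeff (shift z (rootPoly A)) k
    taylor-rootPoly-suc b A k = trans (shift-linear z (- b) 1# (rootPoly A) (suc k)) (trans (coeff-linear-suc _ _ (shift z (rootPoly A)) k)
      (solve 4 (λ b z x y → (:- b :+ κ 1 :* z) :* x :+ κ 1 :* y := (z :- b) :* x :+ y) refl b z _ _))

    taylor-rootPoly-degree : ∀ A → Degree< (suc (length A)) (shift z (rootPoly A))
    taylor-rootPoly-degree []      (suc k) _         = refl
    taylor-rootPoly-degree (b ∷ A) (suc k) (s≤s A<k) = trans (taylor-rootPoly-suc b A k)
      (0+0≡0 (*0≡0 _ (taylor-rootPoly-degree A (suc k) (ℕ.m≤n⇒m≤1+n A<k))) (taylor-rootPoly-degree A k A<k))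

    taylor-rootPoly-lead : ∀ A → coeff (shift z (rootPoly A)) (length A) ≡ 1#
    taylor-rootPoly-lead []      = +-identityʳ 1#
    taylor-rootPoly-lead (b ∷ A) = trans (taylor-rootPoly-suc b A (length A))
      (trans (cong₂ _+_ (*0≡0 _ (taylor-rootPoly-degree A _ ℕ.≤-refl)) (taylor-rootPoly-lead A)) (+-identityˡ 1#))

    deviation : List K → K
    deviation []      = 0#
    deviation (b ∷ A) = (z - b) + deviation A

    taylor-rootPoly-second : ∀ b A → coeff (shift z (rootPoly (b ∷ A))) (length A) ≡ deviation (b ∷ A)
    taylor-rootPoly-second b []       = trans (taylor-rootPoly-0 b [])
      (solve 1 (λ x → x :* (κ 1 :+ κ 0) := x :+ κ 0) refl _)
    taylor-rootPoly-second b (b′ ∷ A) = trans (taylor-rootPoly-suc b (b′ ∷ A) (length A))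
      (cong₂ _+_ (trans (cong ((z - b) *_) (taylor-rootPoly-lead (b′ ∷ A))) (*-identityʳ _)) (taylor-rootPoly-second b′ A))

-- Lagrange weights, their moments and the Stepanov polynomial.

module Weights (F : DiscreteField) where
  open RootPolynomials F public
  open ≡-Reasoning

  weighted : List (K × K) → (K → K) → K
  weighted []            h = 0#
  weighted ((b , c) ∷ L) h = c * h b + weighted L h

  weighted-cong : ∀ L {g h : K → K} → (∀ {b} → b ∈ map proj₁ L → g b ≡ h b) → weighted L g ≡ weighted L h
  weighted-cong []            eq = refl
  weighted-cong ((b , c) ∷ L) eq = cong₂ _+_ (cong (c *_) (eq (here refl))) (weighted-cong L (eq ∘ there))

  weighted-+ : ∀ L (g h : K → K) → weighted L (λ b → g b + h b) ≡ weighted L g + weighted L h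
  weighted-+ []            g h = sym (+-identityˡ 0#)
  weighted-+ ((b , c) ∷ L) g h = trans (cong (c * (g b + h b) +_) (weighted-+ L g h))
    (solve 5 (λ c x y s t → c :* (x :+ y) :+ (s :+ t) := c :* x :+ s :+ (c :* y :+ t)) refl _ _ _ _ _)

  weighted-* : ∀ L a (h : K → K) → weighted L (λ b → a * h b) ≡ a * weighted L h
  weighted-* []            a h = sym (zeroʳ a)
  weighted-* ((b , c) ∷ L) a h = trans (cong (c * (a * h b) +_) (weighted-* L a h))
    (solve 4 (λ c a x s → c :* (a :* x) :+ a :* s := a :* (c :* x :+ s)) refl _ _ _ _)

  weighted-0 : ∀ L → weighted L (λ _ → 0#) ≡ 0#
  weighted-0 []            = refl
  weighted-0 ((b , c) ∷ L) = 0+0≡0 (zeroʳ c) (weighted-0 L)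

  weighted-∑ : ∀ L n (g : ℕ → K → K) → weighted L (λ b → ∑ n (λ i → g i b)) ≡ ∑ n (λ i → weighted L (g i))
  weighted-∑ L zero    g = weighted-0 L
  weighted-∑ L (suc n) g = trans (weighted-+ L (g 0) _) (cong (weighted L (g 0) +_) (weighted-∑ L n (g ∘ suc)))

  moment : List (K × K) → K → ℕ → K
  moment L z e = weighted L (λ b → (b - z) ^ e)

  -- These are the weights of the divided difference on A, the reciprocals of P'(b). A moment is the
  -- divided difference of (x - z)^k; on m + 1 points it is 0 for k below m and the leading
  -- coefficient 1 for k = m, whatever z is.
  record IsLagrange (A : List K) (m : ℕ) (L : List (K × K)) : Set where
    field
      points      : map proj₁ L ≡ A
      moment-<    : ∀ z k → k < m → moment L z k ≡ 0#
      moment-≡    : ∀ z → moment L z m ≡ 1#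

  private
    divide : K → K × K → K × K
    divide a (b , c) = b , c * ((b - a) ⁻¹)

    points-divide : ∀ a L → map proj₁ (map (divide a) L) ≡ map proj₁ L
    points-divide a []            = refl
    points-divide a ((b , c) ∷ L) = cong (b ∷_) (points-divide a L)

    weighted-divide : ∀ a L h → All (a ≢_) (map proj₁ L) → weighted (map (divide a) L) (λ b → (b - a) * h b) ≡ weighted L h
    weighted-divide a []            h []         = refl
    weighted-divide a ((b , c) ∷ L) h (a≢b ∷ a≢) = cong₂ _+_ (begin
      c * ((b - a) ⁻¹) * ((b - a) * h b)      ≡⟨ solve 4 (λ c i x h → c :* i :* (x :* h) := c :* (x :* i) :* h) refl _ _ _ _ ⟩
      c * ((b - a) * ((b - a) ⁻¹)) * h b      ≡⟨ cong (λ x → c * x * h b) (inverseʳ (b - a) (λ e → a≢b (sym (x-y≡0⇒x≡y b a e)))) ⟩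
      c * 1# * h b                            ≡⟨ cong (_* h b) (*-identityʳ c) ⟩
      c * h b                                 ∎) (weighted-divide a L h a≢)

  -- A new point a divides each old weight by b - a, and its own weight is chosen to make the sum of
  -- all weights zero. Writing b - z as (b - a) + (a - z) then expresses each new moment through an
  -- old one and a new one, both of order one less.
  lagrange : ∀ A m → Unique A → length A ≡ suc m → ∃[ L ] IsLagrange A m L
  lagrange (b ∷ [])     zero    _                   _  = (b , 1#) ∷ [] , record
    { points   = refl
    ; moment-< = λ z k ()
    ; moment-≡ = λ z → solve 0 (κ 1 :* κ 1 :+ κ 0 := κ 1) refl }
  lagrange (a ∷ A@(_ ∷ _)) (suc m) (a≢ ∷ unique) eq with lagrange A m unique (ℕ.suc-injective eq)
  ... | L , record { points = points ; moment-< = moment-< ; moment-≡ = moment-≡ } = L″ , record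
    { points   = cong (a ∷_) (trans (points-divide a L) points)
    ; moment-< = vanish
    ; moment-≡ = λ z → trans (step z m) (trans (cong₂ (λ x y → x + (a - z) * y) (moment-≡ z) (vanish z m ℕ.≤-refl))
                   (solve 1 (λ x → κ 1 :+ x :* κ 0 := κ 1) refl _)) }
    where
    L′ = map (divide a) L
    L″ = (a , - weighted L′ (λ _ → 1#)) ∷ L′
    step : ∀ z k → moment L″ z (suc k) ≡ moment L z k + (a - z) * moment L″ z k
    step z k = begin
      weighted L″ (λ b → (b - z) * (b - z) ^ k)
        ≡⟨ weighted-cong L″ (λ {b} _ → solve 4 (λ a b z x → (b :- z) :* x := (b :- a) :* x :+ (a :- z) :* x) refl a b z ((b - z) ^ k)) ⟩
      weighted L″ (λ b → (b - a) * (b - z) ^ k + (a - z) * (b - z) ^ k)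
        ≡⟨ weighted-+ L″ (λ b → (b - a) * (b - z) ^ k) (λ b → (a - z) * (b - z) ^ k) ⟩
      weighted L″ (λ b → (b - a) * (b - z) ^ k) + weighted L″ (λ b → (a - z) * (b - z) ^ k)
        ≡⟨ cong₂ _+_ (cong₂ _+_ (solve 3 (λ c a x → c :* ((a :- a) :* x) := κ 0) refl _ a ((a - z) ^ k))
                                (weighted-divide a L (λ b → (b - z) ^ k) (subst (All (a ≢_)) (sym points) a≢)))
                     (weighted-* L″ (a - z) (λ b → (b - z) ^ k)) ⟩
      0# + moment L z k + (a - z) * moment L″ z k
        ≡⟨ cong (_+ (a - z) * moment L″ z k) (+-identityˡ _) ⟩
      moment L z k + (a - z) * moment L″ z k ∎
    vanish : ∀ z k → k < suc m → moment L″ z k ≡ 0#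
    vanish z zero    _         = solve 1 (λ x → :- x :* κ 1 :+ x := κ 0) refl _
    vanish z (suc k) (s≤s k<m) = trans (step z k) (0+0≡0 (moment-< z k k<m) (*0≡0 _ (vanish z k (ℕ.m<n⇒m<1+n k<m))))

  stepanovPoly : List (K × K) → ℕ → Poly
  stepanovPoly []            N = - 1# ∷ []
  stepanovPoly ((b , c) ∷ L) N = c · linearPower b (- 1#) N ⊕ stepanovPoly L N

  taylor-stepanovPoly : ∀ z L N j → coeff (shift z (stepanovPoly L N)) j ≡
                        weighted L (λ b → coeff (linearPower (b - z) (- 1#) N) j) + coeff (- 1# ∷ []) j
  taylor-stepanovPoly z []            N zero    = solve 0 (:- κ 1 :+ κ 0 := κ 0 :+ :- κ 1) refl
  taylor-stepanovPoly z []            N (suc j) = sym (+-identityˡ 0#)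
  taylor-stepanovPoly z ((b , c) ∷ L) N j       = begin
    coeff (shift z (c · linearPower b (- 1#) N ⊕ stepanovPoly L N)) j
      ≡⟨ shift-⊕ z (c · linearPower b (- 1#) N) (stepanovPoly L N) j ⟩
    coeff (shift z (c · linearPower b (- 1#) N)) j + coeff (shift z (stepanovPoly L N)) j
      ≡⟨ cong₂ _+_ (trans (shift-· z c (linearPower b (- 1#) N) j) (cong (c *_) (trans (shift-linearPower z b (- 1#) N j)
             (cong (λ x → coeff (linearPower x (- 1#) N) j) (solve 2 (λ b z → b :+ (:- κ 1) :* z := b :- z) refl b z)))))
           (taylor-stepanovPoly z L N j) ⟩
    c * coeff (linearPower (b - z) (- 1#) N) j + (weighted L (λ b → coeff (linearPower (b - z) (- 1#) N) j) + coeff (- 1# ∷ []) j)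
      ≡⟨ +-assoc _ _ _ ⟨
    weighted ((b , c) ∷ L) (λ b → coeff (linearPower (b - z) (- 1#) N) j) + coeff (- 1# ∷ []) j ∎

  taylor-stepanovPoly-moment : ∀ z L N j e → j ℕ.+ e ≡ N → coeff (shift z (stepanovPoly L N)) j ≡
                               bin j e * (- 1#) ^ j * moment L z e + coeff (- 1# ∷ []) j
  taylor-stepanovPoly-moment z L N j e eq = trans (taylor-stepanovPoly z L N j) (cong (_+ coeff (- 1# ∷ []) j) (trans
    (weighted-cong L (λ {b} _ → trans (coeff-linearPower (b - z) (- 1#) N j e eq)
      (solve 3 (λ x y s → x :* (y :* s) := x :* s :* y) refl (bin j e) ((b - z) ^ e) ((- 1#) ^ j))))
    (weighted-* L (bin j e * (- 1#) ^ j) (λ b → (b - z) ^ e))))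

  taylor-stepanovPoly-> : ∀ z L N j → N < j → coeff (shift z (stepanovPoly L N)) j ≡ 0#
  taylor-stepanovPoly-> z L N (suc j) N<j = trans (taylor-stepanovPoly z L N (suc j)) (trans (+-identityʳ _)
    (trans (weighted-cong L (λ {b} _ → Degree<-linearPower (b - z) (- 1#) N (suc j) N<j)) (weighted-0 L)))

  -- The equation P(b) = 0 is expanded in powers of b - z, multiplied by (b - z)^e and summed with
  -- the weights.
  moment-recurrence : ∀ A L z e → map proj₁ L ≡ A →
    ∑ (suc (length A)) (λ i → coeff (shift z (rootPoly A)) i * moment L z (i ℕ.+ e)) ≡ 0#
  moment-recurrence A L z e refl = begin
    ∑ n (λ i → coeff U i * moment L z (i ℕ.+ e))
      ≡⟨ ∑-cong n (λ i → sym (weighted-* L (coeff U i) (λ b → (b - z) ^ (i ℕ.+ e)))) ⟩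
    ∑ n (λ i → weighted L (λ b → coeff U i * (b - z) ^ (i ℕ.+ e)))
      ≡⟨ weighted-∑ L n (λ i b → coeff U i * (b - z) ^ (i ℕ.+ e)) ⟨
    weighted L (λ b → ∑ n (λ i → coeff U i * (b - z) ^ (i ℕ.+ e)))
      ≡⟨ weighted-cong L vanish ⟩
    weighted L (λ _ → 0#)
      ≡⟨ weighted-0 L ⟩
    0# ∎
    where
    n = suc (length A)
    U = shift z (rootPoly A)
    vanish : ∀ {b} → b ∈ A → ∑ n (λ i → coeff U i * (b - z) ^ (i ℕ.+ e)) ≡ 0#
    vanish {b} b∈A = begin
      ∑ n (λ i → coeff U i * (b - z) ^ (i ℕ.+ e))
        ≡⟨ ∑-cong n (λ i → trans (cong (coeff U i *_) (^-homo-* (b - z) i e))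
             (solve 3 (λ u x y → u :* (x :* y) := y :* (u :* x)) refl (coeff U i) ((b - z) ^ i) ((b - z) ^ e))) ⟩
      ∑ n (λ i → (b - z) ^ e * (coeff U i * (b - z) ^ i))
        ≡⟨ ∑-* n ((b - z) ^ e) (λ i → coeff U i * (b - z) ^ i) ⟩
      (b - z) ^ e * ∑ n (λ i → coeff U i * (b - z) ^ i)
        ≡⟨ cong ((b - z) ^ e *_) (eval-∑ n U (b - z) (taylor-rootPoly-degree z A)) ⟨
      (b - z) ^ e * eval U (b - z)
        ≡⟨ cong ((b - z) ^ e *_) (trans (eval-shift z (rootPoly A) (b - z))
             (cong (eval (rootPoly A)) (solve 2 (λ b z → b :- z :+ z := b) refl b z))) ⟩
      (b - z) ^ e * eval (rootPoly A) b
        ≡⟨ *0≡0 _ (eval-rootPoly-∈ A b∈A) ⟩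
      0# ∎

-- The Hanson-Petridis bound.

module Stepanov (F : DiscreteField) where
  open Weights F public
  open ≡-Reasoning

  shift-0 : ∀ f → shift 0# f ≈ f
  shift-0 []      k       = refl
  shift-0 (c ∷ f) zero    = trans (coeff-shift-0 0# c f) (solve 2 (λ c x → c :+ κ 0 :* x := c) refl _ _)
  shift-0 (c ∷ f) (suc k) = trans (coeff-shift-suc 0# c f k)
    (trans (solve 2 (λ x y → κ 0 :* x :+ y := y) refl _ _) (shift-0 f k))

  Degree<-D : ∀ n f → Degree< (suc n) f → Degree< n (D f)
  Degree<-D n f df k n≤k = trans (coeff-D f k) (*0≡0 _ (df (suc k) (s≤s n≤k)))

  root⇒VanishesTo-1 : ∀ f a → eval f a ≡ 0# → VanishesTo 1 a f
  root⇒VanishesTo-1 f a fa≡0 zero _ = trans (coeff₀-shift a f) fa≡0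
  root⇒VanishesTo-1 f a fa≡0 (suc j) (s≤s ())

  1^n≡1 : ∀ n → 1# ^ n ≡ 1#
  1^n≡1 zero    = refl
  1^n≡1 (suc n) = trans (*-identityˡ _) (1^n≡1 n)

  -1^n≢0 : ∀ n → (- 1#) ^ n ≢ 0#
  -1^n≢0 zero    = 1≢0
  -1^n≢0 (suc n) = *-≢0 (λ e → 1≢0 (trans (solve 0 (κ 1 := :- (:- κ 1)) refl) (trans (cong -_ e) (solve 0 (:- κ 0 := κ 0) refl)))) (-1^n≢0 n)

  module Setting
    (p d m : ℕ)
    (ι≢0 : ∀ k → 0 < k → k < p → ι k ≢ 0#)
    (0<d : 0 < d) (0<m : 0 < m) (d+d<p : d ℕ.+ d < p)
    (A : List K) (unique : Unique A) (|A|≡1+m : length A ≡ suc m)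
    (A-A⊆μ : ∀ {a b} → a ∈ A → b ∈ A → a ≢ b → (a - b) ^ d ≡ 1#)
    where

    bin≢0 : ∀ j e → j ℕ.+ e < p → bin j e ≢ 0#
    bin≢0 zero    e _     = 1≢0
    bin≢0 (suc j) e 1+j+e<p bin≡0 =
      *-≢0 (ι≢0 (suc e) (s≤s z≤n) (ℕ.≤-<-trans (ℕ.m≤n+m (suc e) j) j+1+e<p)) (bin≢0 j (suc e) j+1+e<p)
           (trans (sym (bin-ratio j e)) (*0≡0 _ bin≡0))
      where
      j+1+e<p : j ℕ.+ suc e < p
      j+1+e<p = subst (_< p) (sym (ℕ.+-suc j e)) 1+j+e<p

    -- The remaining exponent is positive so that the case b = a is covered too, where both sides
    -- are zero.
    difference-power : ∀ {a b} → a ∈ A → b ∈ A → ∀ i → (b - a) ^ (d ℕ.+ suc i) ≡ (b - a) ^ suc i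
    difference-power {a} {b} a∈A b∈A i = trans (^-homo-* (b - a) d (suc i)) lemma
      where
      lemma : (b - a) ^ d * (b - a) ^ suc i ≡ (b - a) ^ suc i
      lemma with b ≟ a
      ... | yes b≡a = trans (*0≡0 _ (0*≡0 _ (x≡y⇒x-y≡0 b≡a))) (sym (0*≡0 _ (x≡y⇒x-y≡0 b≡a)))
      ... | no  b≢a = trans (cong (_* (b - a) ^ suc i) (A-A⊆μ b∈A a∈A b≢a)) (*-identityˡ _)

    -- For a fixed a in A, all of A consists of roots of (x - a)^(d+1) - (x - a). This crude bound
    -- comes before the sharp one, whose proof needs d + m < p for the leading binomial coefficient
    -- of f.
    m≤d : m ≤ d
    m≤d with m ℕ.≤? d
    ... | yes m≤d = m≤d
    ... | no  m≰d = contradiction |A|≡1+m (impossible A refl)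
      where
      impossible : ∀ B → B ≡ A → length B ≢ suc m
      impossible (a ∷ B) refl |A|≡ = 1≢0 (trans (sym lead) (zero-by-roots 1 g A unique
        (All.tabulate λ {b} b∈A → root⇒VanishesTo-1 g b (root b∈A)) degree (suc d)))
        where
        g = linearPower (- a) 1# (suc d) ⊕ (- 1#) · linearPower (- a) 1# 1
        bound : ∀ k → length A ℕ.* 1 ≤ k → suc d < k
        bound k le = ℕ.≤-trans (s≤s (ℕ.≰⇒> m≰d)) (subst (_≤ k) (trans (ℕ.*-identityʳ _) |A|≡) le)
        degree : Degree< (length A ℕ.* 1) g
        degree k le = trans (coeff-⊕ (linearPower (- a) 1# (suc d)) _ k) (0+0≡0
          (Degree<-linearPower (- a) 1# (suc d) k (bound k le))
          (trans (coeff-· (- 1#) (linearPower (- a) 1# 1) k) (*0≡0 _ (Degree<-linearPower (- a) 1# 1 k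
            (ℕ.≤-trans (s≤s (s≤s z≤n)) (bound k le))))))
        lead : coeff g (suc d) ≡ 1#
        lead = begin
          coeff g (suc d)
            ≡⟨ coeff-⊕ (linearPower (- a) 1# (suc d)) ((- 1#) · linearPower (- a) 1# 1) (suc d) ⟩
          coeff (linearPower (- a) 1# (suc d)) (suc d) + coeff ((- 1#) · linearPower (- a) 1# 1) (suc d)
            ≡⟨ cong₂ _+_ (trans (coeff-linearPower (- a) 1# (suc d) (suc d) 0 (ℕ.+-identityʳ _))
                           (cong (λ x → 1# * (1# * x)) (1^n≡1 (suc d))))
                         (trans (coeff-· (- 1#) (linearPower (- a) 1# 1) (suc d))
                           (*0≡0 _ (Degree<-linearPower (- a) 1# 1 (suc d) (s≤s 0<d)))) ⟩
          1# * (1# * 1#) + 0#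
            ≡⟨ solve 0 (κ 1 :* (κ 1 :* κ 1) :+ κ 0 := κ 1) refl ⟩
          1# ∎
        root : ∀ {b} → b ∈ A → eval g b ≡ 0#
        root {b} b∈A = begin
          eval g b
            ≡⟨ eval-⊕ (linearPower (- a) 1# (suc d)) ((- 1#) · linearPower (- a) 1# 1) b ⟩
          eval (linearPower (- a) 1# (suc d)) b + eval ((- 1#) · linearPower (- a) 1# 1) b
            ≡⟨ cong₂ _+_ (eval-linearPower (- a) 1# (suc d) b)
                 (trans (eval-· (- 1#) (linearPower (- a) 1# 1) b) (cong ((- 1#) *_) (eval-linearPower (- a) 1# 1 b))) ⟩
          (- a + 1# * b) ^ suc d + (- 1#) * (- a + 1# * b) ^ 1
            ≡⟨ cong (λ x → x ^ suc d + (- 1#) * x ^ 1) (solve 2 (λ a b → :- a :+ κ 1 :* b := b :- a) refl a b) ⟩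
          (b - a) ^ suc d + (- 1#) * (b - a) ^ 1
            ≡⟨ cong (λ x → x + (- 1#) * (b - a) ^ 1) (trans (cong ((b - a) ^_) (ℕ.+-comm 1 d)) (difference-power (here refl) b∈A 0)) ⟩
          (b - a) ^ 1 + (- 1#) * (b - a) ^ 1
            ≡⟨ solve 1 (λ x → x :+ (:- κ 1) :* x := κ 0) refl _ ⟩
          0# ∎

    N : ℕ
    N = d ℕ.+ m

    N<p : N < p
    N<p = ℕ.≤-<-trans (ℕ.+-monoʳ-≤ d m≤d) d+d<p

    private
      lagrange-A = lagrange A m unique |A|≡1+m

    L : List (K × K)
    L = proj₁ lagrange-A

    open IsLagrange (proj₂ lagrange-A) public

    P f : Poly
    P = rootPoly A
    f = stepanovPoly L N

    U Φ M : K → ℕ → K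
    U z = coeff (shift z P)
    Φ z = coeff (shift z f)
    M z = moment L z

    U-degree : ∀ z k → suc m < k → U z k ≡ 0#
    U-degree z k lt = taylor-rootPoly-degree z A k (subst (_< k) (sym |A|≡1+m) lt)

    U-lead : ∀ z → U z (suc m) ≡ 1#
    U-lead z = subst (λ k → U z k ≡ 1#) |A|≡1+m (taylor-rootPoly-lead z A)

    U-root : ∀ {a} → a ∈ A → U a 0 ≡ 0#
    U-root {a} a∈A = trans (coeff₀-shift a P) (eval-rootPoly-∈ A a∈A)

    M-recurrence : ∀ z e → ∑ (suc (suc m)) (λ i → U z i * M z (i ℕ.+ e)) ≡ 0#
    M-recurrence z e = subst (λ k → ∑ (suc k) (λ i → U z i * M z (i ℕ.+ e)) ≡ 0#) |A|≡1+m (moment-recurrence A L z e points)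

    M-periodic : ∀ {a} → a ∈ A → ∀ i → M a (d ℕ.+ suc i) ≡ M a (suc i)
    M-periodic a∈A i = weighted-cong L (λ {b} b∈L → difference-power a∈A (subst (b ∈_) points b∈L) i)

    Φ-suc : ∀ z j e → suc j ℕ.+ e ≡ N → Φ z (suc j) ≡ bin (suc j) e * (- 1#) ^ suc j * M z e
    Φ-suc z j e eq = trans (taylor-stepanovPoly-moment z L N (suc j) e eq) (+-identityʳ _)

    -- The j-th coefficient carries the moment of order d + m - j, and this order is below m when j
    -- exceeds d.
    Φ-degree : ∀ z j → d < j → Φ z j ≡ 0#
    Φ-degree z (suc j) d<j with suc j ℕ.≤? N
    ... | no  j≰N = taylor-stepanovPoly-> z L N (suc j) (ℕ.≰⇒> j≰N)
    ... | yes j≤N = trans (Φ-suc z j (N ∸ suc j) (ℕ.m+[n∸m]≡n j≤N)) (*0≡0 _ (moment-< z _ lt))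
      where
      lt : N ∸ suc j < m
      lt = ℕ.+-cancelˡ-< (suc j) _ _ (subst (_< suc j ℕ.+ m) (sym (ℕ.m+[n∸m]≡n j≤N)) (ℕ.+-monoˡ-< m d<j))

    Φ-lead : ∀ z → Φ z d ≡ bin d m * (- 1#) ^ d
    Φ-lead z = lemma d refl
      where
      lemma : ∀ d′ → d′ ≡ d → Φ z d′ ≡ bin d′ m * (- 1#) ^ d′
      lemma zero     refl = contradiction 0<d λ ()
      lemma (suc d′) refl = trans (Φ-suc z d′ m refl) (trans (cong (_ *_) (moment-≡ z)) (*-identityʳ _))

    Φ-lead≢0 : ∀ z → Φ z d ≢ 0#
    Φ-lead≢0 z eq = *-≢0 (bin≢0 d m N<p) (-1^n≢0 d) (trans (sym (Φ-lead z)) eq)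

    -- The moment in the j-th coefficient has order d + (m - j), which periodicity on A lowers to m
    -- - j. For j > 0 it vanishes; for j = 0 it equals 1 and is cancelled by the constant -1 in f.
    Φ-root : ∀ {a} → a ∈ A → ∀ j → j < m → Φ a j ≡ 0#
    Φ-root {a} a∈A zero    j<m = begin
      Φ a 0                          ≡⟨ taylor-stepanovPoly-moment a L N 0 N refl ⟩
      1# * 1# * M a N + - 1#         ≡⟨ cong (λ x → 1# * 1# * x + - 1#) (M-N m refl) ⟩
      1# * 1# * 1# + - 1#            ≡⟨ solve 0 (κ 1 :* κ 1 :* κ 1 :+ :- κ 1 := κ 0) refl ⟩
      0#                             ∎
      where
      M-N : ∀ m′ → m′ ≡ m → M a (d ℕ.+ m′) ≡ 1#
      M-N zero     refl = contradiction 0<m λ ()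
      M-N (suc m′) refl = trans (M-periodic a∈A m′) (moment-≡ a)
    Φ-root {a} a∈A (suc j) j<m = begin
      Φ a (suc j)                                                      ≡⟨ Φ-suc a j (d ℕ.+ suc i) sum-eq ⟩
      bin (suc j) (d ℕ.+ suc i) * (- 1#) ^ suc j * M a (d ℕ.+ suc i)   ≡⟨ *0≡0 _ (trans (M-periodic a∈A i) (moment-< a (suc i) i<m)) ⟩
      0#                                                               ∎
      where
      i = m ∸ suc (suc j)
      m-eq : m ≡ suc j ℕ.+ suc i
      m-eq = trans (sym (ℕ.m+[n∸m]≡n j<m)) (sym (ℕ.+-suc (suc j) i))
      sum-eq : suc j ℕ.+ (d ℕ.+ suc i) ≡ N
      sum-eq = trans (sym (ℕ.+-assoc (suc j) d (suc i))) (trans (cong (ℕ._+ suc i) (ℕ.+-comm (suc j) d))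
        (trans (ℕ.+-assoc d (suc j) (suc i)) (cong (d ℕ.+_) (sym m-eq))))
      i<m : suc i < m
      i<m = subst (suc i <_) (sym m-eq) (s≤s (ℕ.m≤n+m (suc i) j))

    Degree<-P : Degree< (suc (suc m)) P
    Degree<-P k lt = trans (sym (shift-0 P k)) (U-degree 0# k lt)

    Degree<-f : Degree< (suc d) f
    Degree<-f k lt = trans (sym (shift-0 f k)) (Φ-degree 0# k lt)

    |A|[|A|-1]≤d : suc m ℕ.* m ≤ d
    |A|[|A|-1]≤d with suc m ℕ.* m ℕ.≤? d
    ... | yes le = le
    ... | no  ≰d = contradiction (shift-zero 0# f f≡0 d) (Φ-lead≢0 0#)
      where
      f≡0 : ∀ k → coeff f k ≡ 0#
      f≡0 = zero-by-roots m f A unique (All.tabulate Φ-root)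
        (λ k le → Degree<-f k (ℕ.≤-trans (ℕ.≰⇒> ≰d) (subst (λ n → n ℕ.* m ≤ k) |A|≡1+m le)))

-- For n = m + 1 the left side is (n + 1) k - 6 (n - 1) at k = 6 + l, and the right side is 2 d when
-- d = n m. So for 6 ≤ k ≤ n the resonance is a positive integer below p.
resonance-bound : ∀ m n l → 2 ≤ m → 6 ℕ.+ l ≤ n → 12 ℕ.+ (2 ℕ.+ m) ℕ.* l ≤ n ℕ.* m ℕ.+ n ℕ.* m
resonance-bound m n l 2≤m 6+l≤n = begin
  12 ℕ.+ (2 ℕ.+ m) ℕ.* l                ≤⟨ ℕ.+-monoˡ-≤ ((2 ℕ.+ m) ℕ.* l) (ℕ.*-monoˡ-≤ 6 (ℕ.m≤m+n 2 m)) ⟩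
  (2 ℕ.+ m) ℕ.* 6 ℕ.+ (2 ℕ.+ m) ℕ.* l   ≡⟨ ℕ.*-distribˡ-+ (2 ℕ.+ m) 6 l ⟨
  (2 ℕ.+ m) ℕ.* (6 ℕ.+ l)               ≤⟨ ℕ.*-mono-≤ (ℕ.+-monoˡ-≤ m 2≤m) 6+l≤n ⟩
  (m ℕ.+ m) ℕ.* n                       ≡⟨ ℕ.*-comm (m ℕ.+ m) n ⟩
  n ℕ.* (m ℕ.+ m)                       ≡⟨ ℕ.*-distribˡ-+ n m m ⟩
  n ℕ.* m ℕ.+ n ℕ.* m                   ∎
  where open ℕ.≤-Reasoning

-- The extremal case d = n (n - 1) with n ≥ 4.

module Extremal (F : DiscreteField) where
  open Stepanov F public
  open ≡-Reasoning

  total : List K → K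
  total []      = 0#
  total (b ∷ A) = b + total A

  deviation-total : ∀ z A → deviation z A ≡ ι (length A) * z - total A
  deviation-total z []      = solve 1 (λ z → κ 0 := κ 0 :* z :- κ 0) refl z
  deviation-total z (b ∷ A) = trans (cong (z - b +_) (deviation-total z A))
    (solve 4 (λ z b l s → z :- b :+ (l :* z :- s) := (κ 1 :+ l) :* z :- (b :+ s)) refl z b (ι (length A)) (total A))

  ι-product≢0 : ∀ fs → All (λ x → ι x ≢ 0#) fs → ι (product fs) ≢ 0#
  ι-product≢0 []       []           e = 1≢0 (trans (sym (+-identityʳ 1#)) e)
  ι-product≢0 (x ∷ fs) (x≢0 ∷ fs≢0) e = *-≢0 x≢0 (ι-product≢0 fs fs≢0) (trans (sym (ι-* x (product fs))) e)

  -- All numbers are variables here: instantiating them keeps ι applied to large literals unevaluated.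
  ratio-chain : ∀ a₁ a₂ a₃ a₄ a₅ b₁ b₂ b₃ b₄ b₅ c fs (C₀ C₁ C₂ C₃ C₄ C₅ : K) →
    ι b₁ * C₀ ≡ ι a₁ * C₁ → ι b₂ * C₁ ≡ ι a₂ * C₂ → ι b₃ * C₂ ≡ ι a₃ * C₃ → ι b₄ * C₃ ≡ ι a₄ * C₄ → ι b₅ * C₄ ≡ ι a₅ * C₅ →
    b₁ ℕ.* (b₂ ℕ.* (b₃ ℕ.* (b₄ ℕ.* b₅))) ≡ a₁ ℕ.* (a₂ ℕ.* (a₃ ℕ.* (a₄ ℕ.* (a₅ ℕ.* c)))) ℕ.+ product fs →
    All (λ x → ι x ≢ 0#) fs → C₀ ≢ 0# → C₅ ≢ ι c * C₀
  ratio-chain a₁ a₂ a₃ a₄ a₅ b₁ b₂ b₃ b₄ b₅ c fs C₀ C₁ C₂ C₃ C₄ C₅ r₁ r₂ r₃ r₄ r₅ eq fs≢0 C₀≢0 C₅≡ =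
    *-≢0 (ι-product≢0 fs fs≢0) C₀≢0 (begin
      ι (product fs) * C₀
        ≡⟨ solve 3 (λ x y c → x :* c := (y :+ x) :* c :- y :* c) refl (ι (product fs)) (ι a) C₀ ⟩
      (ι a + ι (product fs)) * C₀ - ι a * C₀
        ≡⟨ cong₂ (λ x y → x * C₀ - y * C₀) (trans (sym (ι-+ a (product fs))) (trans (cong ι (sym eq)) ι-b)) ι-a ⟩
      y₁ * (y₂ * (y₃ * (y₄ * y₅))) * C₀ - x₁ * (x₂ * (x₃ * (x₄ * (x₅ * ι c)))) * C₀
        ≡⟨ cong (_- x₁ * (x₂ * (x₃ * (x₄ * (x₅ * ι c)))) * C₀) chain ⟩
      x₁ * (x₂ * (x₃ * (x₄ * (x₅ * C₅)))) - x₁ * (x₂ * (x₃ * (x₄ * (x₅ * ι c)))) * C₀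
        ≡⟨ cong (λ x → x₁ * (x₂ * (x₃ * (x₄ * (x₅ * x)))) - x₁ * (x₂ * (x₃ * (x₄ * (x₅ * ι c)))) * C₀) C₅≡ ⟩
      x₁ * (x₂ * (x₃ * (x₄ * (x₅ * (ι c * C₀))))) - x₁ * (x₂ * (x₃ * (x₄ * (x₅ * ι c)))) * C₀
        ≡⟨ solve 7 (λ a b c d e f g → a :* (b :* (c :* (d :* (e :* (f :* g))))) :- a :* (b :* (c :* (d :* (e :* f)))) :* g := κ 0) refl x₁ x₂ x₃ x₄ x₅ (ι c) C₀ ⟩
      0# ∎)
    where
    x₁ = ι a₁
    x₂ = ι a₂
    x₃ = ι a₃
    x₄ = ι a₄
    x₅ = ι a₅
    y₁ = ι b₁
    y₂ = ι b₂
    y₃ = ι b₃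
    y₄ = ι b₄
    y₅ = ι b₅
    a = a₁ ℕ.* (a₂ ℕ.* (a₃ ℕ.* (a₄ ℕ.* (a₅ ℕ.* c))))
    ι-a : ι a ≡ x₁ * (x₂ * (x₃ * (x₄ * (x₅ * ι c))))
    ι-a = trans (ι-* a₁ _) (cong (x₁ *_) (trans (ι-* a₂ _) (cong (x₂ *_) (trans (ι-* a₃ _) (cong (x₃ *_)
      (trans (ι-* a₄ _) (cong (x₄ *_) (ι-* a₅ c))))))))
    ι-b : ι (b₁ ℕ.* (b₂ ℕ.* (b₃ ℕ.* (b₄ ℕ.* b₅)))) ≡ y₁ * (y₂ * (y₃ * (y₄ * y₅)))
    ι-b = trans (ι-* b₁ _) (cong (y₁ *_) (trans (ι-* b₂ _) (cong (y₂ *_) (trans (ι-* b₃ _) (cong (y₃ *_) (ι-* b₄ b₅))))))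
    swap : ∀ x y z → x * (y * z) ≡ y * (x * z)
    swap = solve 3 (λ x y z → x :* (y :* z) := y :* (x :* z)) refl
    chain : y₁ * (y₂ * (y₃ * (y₄ * y₅))) * C₀ ≡ x₁ * (x₂ * (x₃ * (x₄ * (x₅ * C₅))))
    chain = begin
      y₁ * (y₂ * (y₃ * (y₄ * y₅))) * C₀
        ≡⟨ solve 6 (λ a b c d e x → a :* (b :* (c :* (d :* e))) :* x := e :* (d :* (c :* (b :* (a :* x))))) refl y₁ y₂ y₃ y₄ y₅ C₀ ⟩
      y₅ * (y₄ * (y₃ * (y₂ * (y₁ * C₀))))
        ≡⟨ cong (λ x → y₅ * (y₄ * (y₃ * x))) (trans (cong (y₂ *_) r₁) (trans (swap y₂ x₁ C₁) (cong (x₁ *_) r₂))) ⟩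
      y₅ * (y₄ * (y₃ * (x₁ * (x₂ * C₂))))
        ≡⟨ solve 6 (λ a b c d e x → a :* (b :* (c :* (d :* (e :* x)))) := d :* (e :* (a :* (b :* (c :* x))))) refl y₅ y₄ y₃ x₁ x₂ C₂ ⟩
      x₁ * (x₂ * (y₅ * (y₄ * (y₃ * C₂))))
        ≡⟨ cong (λ x → x₁ * (x₂ * (y₅ * x))) (trans (cong (y₄ *_) r₃) (trans (swap y₄ x₃ C₃) (cong (x₃ *_) r₄))) ⟩
      x₁ * (x₂ * (y₅ * (x₃ * (x₄ * C₄))))
        ≡⟨ cong (λ x → x₁ * (x₂ * x)) (solve 4 (λ a b c x → a :* (b :* (c :* x)) := b :* (c :* (a :* x))) refl y₅ x₃ x₄ C₄) ⟩
      x₁ * (x₂ * (x₃ * (x₄ * (y₅ * C₄))))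
        ≡⟨ cong (λ x → x₁ * (x₂ * (x₃ * (x₄ * x)))) r₅ ⟩
      x₁ * (x₂ * (x₃ * (x₄ * (x₅ * C₅)))) ∎

  module _
    -- Writing d and n with the offset 4 lets d - 1, ..., d - 4 and the first coefficients of P
    -- unfold by computation, without truncated subtraction.
    (p d′ t : ℕ)
    (ι≢0 : ∀ k → 0 < k → k < p → ι k ≢ 0#)
    (d+d<p : (4 ℕ.+ d′) ℕ.+ (4 ℕ.+ d′) < p)
    (A : List K) (unique : Unique A) (|A|≡n : length A ≡ 4 ℕ.+ t)
    (A-A⊆μ : ∀ {a b} → a ∈ A → b ∈ A → a ≢ b → (a - b) ^ (4 ℕ.+ d′) ≡ 1#)
    (d≡nm : 4 ℕ.+ d′ ≡ (4 ℕ.+ t) ℕ.* (3 ℕ.+ t))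
    where

    private
      d n m : ℕ
      d = 4 ℕ.+ d′
      n = 4 ℕ.+ t
      m = 3 ℕ.+ t

    open Setting p d m ι≢0 (s≤s z≤n) (s≤s z≤n) d+d<p A unique |A|≡n A-A⊆μ public

    ν : K
    ν = ι n

    ι-d : ι d ≡ ν * ι m
    ι-d = trans (cong ι d≡nm) (ι-* n m)

    ι≢0-small : ∀ k → 0 < k → k ≤ N → ι k ≢ 0#
    ι≢0-small k 0<k k≤N = ι≢0 k 0<k (ℕ.≤-<-trans k≤N N<p)

    ν≢0 : ν ≢ 0#
    ν≢0 = ι≢0-small n (s≤s z≤n) (ℕ.+-monoˡ-≤ m {1} {d} (s≤s z≤n))

    1+ν≢0 : 1# + ν ≢ 0#
    1+ν≢0 = ι≢0-small (suc n) (s≤s z≤n) (ℕ.+-monoˡ-≤ m {2} {d} (s≤s (s≤s z≤n)))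

    -- The factor n - 3 separates the range n ≥ 4 from the actual solution n = 3. It is cancelled in
    -- `cubic-relation` and in `Low-3`.
    ν-3≢0 : ι m - ι 2 ≢ 0#
    ν-3≢0 e = ι≢0-small (suc t) (s≤s z≤n) (ℕ.≤-trans (ℕ.m≤n+m (suc t) 2) (ℕ.m≤n+m m d))
      (trans (solve 1 (λ x → x := κ 1 :+ (κ 1 :+ x) :- κ 2) refl (ι (suc t))) e)

    ι-d≢0 : ι d ≢ 0#
    ι-d≢0 = ι≢0-small d (s≤s z≤n) (ℕ.m≤m+n d m)

    ι[d-1] : ι (3 ℕ.+ d′) ≡ ν * ι m - 1#
    ι[d-1] = trans (solve 1 (λ x → x := κ 1 :+ x :- κ 1) refl _) (cong (_- 1#) ι-d)

    ι[d-2] : ι (2 ℕ.+ d′) ≡ ν * ι m - ι 2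
    ι[d-2] = trans (solve 1 (λ x → x := κ 1 :+ (κ 1 :+ x) :- κ 2) refl _) (cong (_- ι 2) ι-d)

    -- The differential identity between f and P.

    G : Poly
    G = P ⊗ D f ⊕ (- ι m) · (D P ⊗ f)

    G-weight : K → ℕ → ℕ → K
    G-weight z i j = (ι j - ι m * ι i) * (U z i * Φ z j)

    -- After multiplication by the local variable, the derivatives merely weight the terms by j and
    -- by i. This is the reason for the index `suc k` on the right.
    taylor-G : ∀ z k → coeff (shift z G) k ≡ antidiagonal (G-weight z) (suc k)
    taylor-G z k = begin
      coeff (shift z G) k
        ≡⟨ shift-⊕ z (P ⊗ D f) ((- ι m) · (D P ⊗ f)) k ⟩
      coeff (shift z (P ⊗ D f)) k + coeff (shift z ((- ι m) · (D P ⊗ f))) k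
        ≡⟨ cong₂ _+_ (trans (shift-⊗ z P (D f) k) (coeff-⊗ (shift z P) (shift z (D f)) k))
                     (trans (shift-· z (- ι m) (D P ⊗ f) k) (cong ((- ι m) *_)
                       (trans (shift-⊗ z (D P) f k) (coeff-⊗ (shift z (D P)) (shift z f) k)))) ⟩
      convolution (U z) (coeff (shift z (D f))) k + (- ι m) * convolution (coeff (shift z (D P))) (Φ z) k
        ≡⟨ cong₂ (λ x y → x + (- ι m) * y)
             (trans (antidiagonal-cong (λ i j → trans (cong (U z i *_) (coeff-shift-D z f j))
                      (solve 3 (λ u c v → u :* (c :* v) := c :* (u :* v)) refl (U z i) (ι (suc j)) (Φ z (suc j)))) k)
                    (antidiagonal-sucʳ (λ i j → ι j * (U z i * Φ z j)) (λ i → zeroˡ _) k))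
             (trans (antidiagonal-cong (λ i j → trans (cong (_* Φ z j) (coeff-shift-D z P i))
                      (*-assoc (ι (suc i)) (U z (suc i)) (Φ z j))) k)
                    (antidiagonal-sucˡ (λ i j → ι i * (U z i * Φ z j)) (λ j → zeroˡ _) k)) ⟩
      antidiagonal (λ i j → ι j * (U z i * Φ z j)) (suc k) + (- ι m) * antidiagonal (λ i j → ι i * (U z i * Φ z j)) (suc k)
        ≡⟨ cong (antidiagonal (λ i j → ι j * (U z i * Φ z j)) (suc k) +_) (antidiagonal-* (- ι m) (λ i j → ι i * (U z i * Φ z j)) (suc k)) ⟨
      antidiagonal (λ i j → ι j * (U z i * Φ z j)) (suc k) + antidiagonal (λ i j → (- ι m) * (ι i * (U z i * Φ z j))) (suc k)
        ≡⟨ antidiagonal-+ (λ i j → ι j * (U z i * Φ z j)) (λ i j → (- ι m) * (ι i * (U z i * Φ z j))) (suc k) ⟨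
      antidiagonal (λ i j → ι j * (U z i * Φ z j) + (- ι m) * (ι i * (U z i * Φ z j))) (suc k)
        ≡⟨ antidiagonal-cong (λ i j → solve 4 (λ i j m x → j :* x :+ (:- m) :* (i :* x) := (j :- m :* i) :* x) refl
             (ι i) (ι j) (ι m) (U z i * Φ z j)) (suc k) ⟩
      antidiagonal (G-weight z) (suc k) ∎

    G-weight-zeroˡ : ∀ z {i} j → U z i ≡ 0# → G-weight z i j ≡ 0#
    G-weight-zeroˡ z j e = *0≡0 _ (0*≡0 _ e)

    G-weight-zeroʳ : ∀ z i {j} → Φ z j ≡ 0# → G-weight z i j ≡ 0#
    G-weight-zeroʳ z i e = *0≡0 _ (*0≡0 _ e)

    -- P f' and m P' f have the same leading Taylor coefficient at a root, so G gains one order.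
    VanishesTo-G : ∀ {a} → a ∈ A → VanishesTo n a G
    VanishesTo-G {a} a∈A k (s≤s k≤m) = trans (taylor-G a k) (antidiagonal-zero (suc k) vanish)
      where
      vanish : ∀ i j → i ℕ.+ j ≡ suc k → G-weight a i j ≡ 0#
      vanish zero          j eq = G-weight-zeroˡ a j (U-root a∈A)
      vanish (suc zero)    j refl with ℕ.m≤n⇒m<n∨m≡n k≤m
      ... | inj₁ k<m  = G-weight-zeroʳ a 1 (Φ-root a∈A j k<m)
      ... | inj₂ refl = 0*≡0 _ (solve 1 (λ x → x :- x :* (κ 1 :+ κ 0) := κ 0) refl (ι m))
      vanish (suc (suc i)) j refl = G-weight-zeroʳ a (suc (suc i)) (Φ-root a∈A j (ℕ.≤-trans (s≤s (ℕ.m≤n+m j i)) k≤m))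

    Degree<-G : Degree< (n ℕ.* n) G
    Degree<-G k le = trans (coeff-⊕ (P ⊗ D f) _ k) (0+0≡0
      (Degree<-⊗ (suc n) (3 ℕ.+ d′) P (D f) Degree<-P (Degree<-D d f Degree<-f) k (subst (_≤ k) n*n≡ le))
      (trans (coeff-· (- ι m) (D P ⊗ f) k) (*0≡0 _
        (Degree<-⊗ n d (D P) f (Degree<-D n P Degree<-P) Degree<-f k (subst (_≤ k) (trans n*n≡ (sym (ℕ.+-suc n (3 ℕ.+ d′)))) le)))))
      where
      n*n≡ : n ℕ.* n ≡ suc n ℕ.+ (3 ℕ.+ d′)
      n*n≡ = trans (ℕ.*-suc n m) (trans (cong (n ℕ.+_) (sym d≡nm)) (ℕ.+-suc n (3 ℕ.+ d′)))

    -- The Taylor expansion of P f' = m P' f at z.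
    G≡0 : ∀ z k → antidiagonal (G-weight z) k ≡ 0#
    G≡0 z zero    = 0+0≡0 (0*≡0 _ (solve 1 (λ x → κ 0 :- x :* κ 0 := κ 0) refl (ι m))) refl
    G≡0 z (suc k) = trans (sym (taylor-G z k)) (shift-zero z G
      (zero-by-roots n G A unique (All.tabulate VanishesTo-G) (subst (λ l → Degree< (l ℕ.* n) G) (sym |A|≡n) Degree<-G)) k)

    -- Second and third order relations at a point of A.

    module AtRoot {a : K} (a∈A : a ∈ A) where
      u : ℕ → K
      u = U a

      M-zero : ∀ i → suc i < m → M a (suc (d ℕ.+ i)) ≡ 0#
      M-zero i i<m = trans (cong (M a) (sym (ℕ.+-suc d i))) (trans (M-periodic a∈A i) (moment-< a (suc i) i<m))

      -- `M a d` is the sum of all weights except that of a, hence minus the residue of 1/P at a. In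
      -- the recurrence with exponent d - 1, periodicity removes every term strictly between i = 1
      -- and i = n.
      u₁M≡-1 : u 1 * M a d + 1# ≡ 0#
      u₁M≡-1 = begin
        u 1 * M a d + 1#
          ≡⟨ cong (u 1 * M a d +_) (trans (cong₂ _*_ (U-lead a) (trans (cong (M a) n+e≡d+m) (trans (M-periodic a∈A (2 ℕ.+ t)) (moment-≡ a)))) (*-identityˡ 1#)) ⟨
        u 1 * M a d + u n * M a (n ℕ.+ e)
          ≡⟨ ∑-pair (suc n) 1 n (s≤s (s≤s z≤n)) ℕ.≤-refl vanish ⟨
        ∑ (suc n) (λ i → u i * M a (i ℕ.+ e))
          ≡⟨ M-recurrence a e ⟩
        0# ∎
        where
        e = 3 ℕ.+ d′
        n+e≡d+m : n ℕ.+ e ≡ d ℕ.+ m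
        n+e≡d+m = trans (ℕ.+-comm n e) (ℕ.+-suc e m)
        vanish : ∀ i → i < suc n → i ≢ 1 → i ≢ n → u i * M a (i ℕ.+ e) ≡ 0#
        vanish zero          _ _   _   = 0*≡0 _ (U-root a∈A)
        vanish (suc zero)    _ i≢1 _   = contradiction refl i≢1
        vanish (suc (suc i)) (s≤s i<n) _ i≢n = *0≡0 _ (trans (cong (M a) eq) (M-zero i (ℕ.≤-pred (ℕ.≤∧≢⇒< i<n i≢n))))
          where
          eq : suc (suc i) ℕ.+ e ≡ suc (d ℕ.+ i)
          eq = trans (cong suc (ℕ.+-comm (suc i) e)) (cong suc (ℕ.+-suc e i))

      M≢0 : M a d ≢ 0#
      M≢0 e = 1≢0 (trans (solve 1 (λ x → κ 1 := x :* κ 0 :+ κ 1) refl (u 1)) (trans (cong (λ y → u 1 * y + 1#) (sym e)) u₁M≡-1))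

      u₁≢0 : u 1 ≢ 0#
      u₁≢0 e = 1≢0 (trans (solve 1 (λ x → κ 1 := κ 0 :* x :+ κ 1) refl (M a d)) (trans (cong (λ y → y * M a d + 1#) (sym e)) u₁M≡-1))

      -- The moment of order d - k acts as the sum of c_b (b - a)^(-k) over b ≠ a. Up to sign it is
      -- the coefficient of x^(k-1) in the Laurent series of 1/P(a + x), and the three recurrences
      -- below multiply this series by P.
      M₀ M₁ M₂ M₃ : K
      M₀ = M a (4 ℕ.+ d′)
      M₁ = M a (3 ℕ.+ d′)
      M₂ = M a (2 ℕ.+ d′)
      M₃ = M a (1 ℕ.+ d′)

      private
        -- These moments have orders d + 1, ..., d + l with l below m, so periodicity reduces them
        -- to moments of positive order below m.
        tail-zero : ∀ k l e → k ℕ.+ e ≡ suc d → l < m → ∑ l (λ i → u (k ℕ.+ i) * M a (k ℕ.+ i ℕ.+ e)) ≡ 0#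
        tail-zero k l e eq l<m = ∑-zero l (λ i i<l → *0≡0 _ (trans (cong (M a) (eq′ i)) (M-zero i (ℕ.≤-<-trans i<l l<m))))
          where
          eq′ : ∀ i → k ℕ.+ i ℕ.+ e ≡ suc (d ℕ.+ i)
          eq′ i = trans (ℕ.+-assoc k i e) (trans (cong (k ℕ.+_) (ℕ.+-comm i e)) (trans (sym (ℕ.+-assoc k e i)) (cong (ℕ._+ i) eq)))

        simplify : ∀ {x y z} → u 0 * x + y ≡ 0# → y ≡ z → z ≡ 0#
        simplify {x} {y} {z} eq refl = trans (sym (trans (cong (_+ y) (0*≡0 x (U-root a∈A))) (+-identityˡ y))) eq

      recurrence₁ : u 1 * M₁ + u 2 * M₀ ≡ 0#
      recurrence₁ = simplify (M-recurrence a (2 ℕ.+ d′))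
        (trans (cong (λ y → u 1 * M₁ + (u 2 * M₀ + y)) (tail-zero 3 (2 ℕ.+ t) (2 ℕ.+ d′) refl ℕ.≤-refl))
        (solve 2 (λ x y → x :+ (y :+ κ 0) := x :+ y) refl _ _))

      recurrence₂ : u 1 * M₂ + u 2 * M₁ + u 3 * M₀ ≡ 0#
      recurrence₂ = simplify (M-recurrence a (1 ℕ.+ d′))
        (trans (cong (λ y → u 1 * M₂ + (u 2 * M₁ + (u 3 * M₀ + y))) (tail-zero 4 (1 ℕ.+ t) (1 ℕ.+ d′) refl (s≤s (s≤s (ℕ.m≤n+m t 1)))))
        (solve 3 (λ x y z → x :+ (y :+ (z :+ κ 0)) := x :+ y :+ z) refl _ _ _))

      recurrence₃ : u 1 * M₃ + u 2 * M₂ + u 3 * M₁ + u 4 * M₀ ≡ 0#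
      recurrence₃ = simplify (M-recurrence a d′)
        (trans (cong (λ y → u 1 * M₃ + (u 2 * M₂ + (u 3 * M₁ + (u 4 * M₀ + y)))) (tail-zero 5 t d′ refl (s≤s (ℕ.m≤n+m t 2))))
        (solve 4 (λ x y z w → x :+ (y :+ (z :+ (w :+ κ 0))) := x :+ y :+ z :+ w) refl _ _ _ _))

      Φ₀ Φ₁ Φ₂ Φ₃ : K
      Φ₀ = Φ a m
      Φ₁ = Φ a (1 ℕ.+ m)
      Φ₂ = Φ a (2 ℕ.+ m)
      Φ₃ = Φ a (3 ℕ.+ m)

      private
        Φ-tail-zero : ∀ k → ∑ m (λ i → G-weight a (suc k ℕ.+ i) (m ∸ suc i)) ≡ 0#
        Φ-tail-zero k = ∑-zero m (λ i i<m → G-weight-zeroʳ a (suc k ℕ.+ i) (Φ-root a∈A (m ∸ suc i) (ℕ.∸-monoʳ-< (s≤s z≤n) i<m)))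

        G-simplify : ∀ {j y z} → G-weight a 0 j + y ≡ 0# → y ≡ z → z ≡ 0#
        G-simplify {j} {y} eq refl = trans (sym (trans (cong (_+ y) (G-weight-zeroˡ a j (U-root a∈A))) (+-identityˡ y))) eq

      -- One order lower the differential identity reads u₁ Φ₁ = m u₂ Φ₀, which the moments give as
      -- well because d = n m. A condition on P alone can first appear at this order.
      G₃ : ι 2 * (u 1 * Φ₂) + (1# - ι m) * (u 2 * Φ₁) - ι 2 * ι m * (u 3 * Φ₀) ≡ 0#
      G₃ = G-simplify (G≡0 a (3 ℕ.+ m))
        (trans (cong (λ y → G-weight a 1 (2 ℕ.+ m) + (G-weight a 2 (1 ℕ.+ m) + (G-weight a 3 m + y))) (Φ-tail-zero 3))
        (solve 4 (λ m x y z →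
          (κ 1 :+ (κ 1 :+ m) :- m :* (κ 1 :+ κ 0)) :* x :+ ((κ 1 :+ m :- m :* κ 2) :* y :+ ((m :- m :* κ 3) :* z :+ κ 0))
          := κ 2 :* x :+ (κ 1 :- m) :* y :- κ 2 :* m :* z) refl (ι m) (u 1 * Φ₂) (u 2 * Φ₁) (u 3 * Φ₀)))

      G₄ : ι 3 * (u 1 * Φ₃) + (ι 2 - ι m) * (u 2 * Φ₂) + (1# - ι 2 * ι m) * (u 3 * Φ₁) - ι 3 * ι m * (u 4 * Φ₀) ≡ 0#
      G₄ = G-simplify (G≡0 a (4 ℕ.+ m))
        (trans (cong (λ y → G-weight a 1 (3 ℕ.+ m) + (G-weight a 2 (2 ℕ.+ m) + (G-weight a 3 (1 ℕ.+ m) + (G-weight a 4 m + y)))) (Φ-tail-zero 4))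
        (solve 5 (λ m x y z w →
          (κ 1 :+ (κ 1 :+ (κ 1 :+ m)) :- m :* (κ 1 :+ κ 0)) :* x :+ ((κ 1 :+ (κ 1 :+ m) :- m :* κ 2) :* y
            :+ ((κ 1 :+ m :- m :* κ 3) :* z :+ ((m :- m :* κ 4) :* w :+ κ 0)))
          := κ 3 :* x :+ (κ 2 :- m) :* y :+ (κ 1 :- κ 2 :* m) :* z :- κ 3 :* m :* w) refl
          (ι m) (u 1 * Φ₃) (u 2 * Φ₂) (u 3 * Φ₁) (u 4 * Φ₀)))

      private
        s : K
        s = (- 1#) ^ m

        C₀ C₁ C₂ C₃ : K
        C₀ = bin m d
        C₁ = bin (1 ℕ.+ m) (3 ℕ.+ d′)
        C₂ = bin (2 ℕ.+ m) (2 ℕ.+ d′)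
        C₃ = bin (3 ℕ.+ m) (1 ℕ.+ d′)

        δ δ₁ δ₂ : K
        δ  = ι d
        δ₁ = ι (3 ℕ.+ d′)
        δ₂ = ι (2 ℕ.+ d′)

        ratio₂ : ν * (1# + ν) * C₂ ≡ δ * δ₁ * C₀
        ratio₂ = begin
          ν * (1# + ν) * C₂    ≡⟨ *-assoc ν (1# + ν) C₂ ⟩
          ν * ((1# + ν) * C₂)  ≡⟨ cong (ν *_) (bin-ratio (1 ℕ.+ m) (2 ℕ.+ d′)) ⟩
          ν * (δ₁ * C₁)        ≡⟨ solve 3 (λ x y z → x :* (y :* z) := y :* (x :* z)) refl ν δ₁ C₁ ⟩
          δ₁ * (ν * C₁)        ≡⟨ cong (δ₁ *_) (bin-ratio m (3 ℕ.+ d′)) ⟩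
          δ₁ * (δ * C₀)        ≡⟨ solve 3 (λ x y z → x :* (y :* z) := y :* x :* z) refl δ₁ δ C₀ ⟩
          δ * δ₁ * C₀          ∎

        ratio₃ : ν * (1# + ν) * (1# + (1# + ν)) * C₃ ≡ δ * δ₁ * δ₂ * C₀
        ratio₃ = begin
          ν * (1# + ν) * (1# + (1# + ν)) * C₃    ≡⟨ *-assoc (ν * (1# + ν)) (1# + (1# + ν)) C₃ ⟩
          ν * (1# + ν) * ((1# + (1# + ν)) * C₃)  ≡⟨ cong (ν * (1# + ν) *_) (bin-ratio (2 ℕ.+ m) (1 ℕ.+ d′)) ⟩
          ν * (1# + ν) * (δ₂ * C₂)               ≡⟨ solve 3 (λ x y z → x :* (y :* z) := y :* (x :* z)) refl (ν * (1# + ν)) δ₂ C₂ ⟩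
          δ₂ * (ν * (1# + ν) * C₂)               ≡⟨ cong (δ₂ *_) ratio₂ ⟩
          δ₂ * (δ * δ₁ * C₀)                     ≡⟨ solve 3 (λ x y z → x :* (y :* z) := y :* x :* z) refl δ₂ (δ * δ₁) C₀ ⟩
          δ * δ₁ * δ₂ * C₀                       ∎

        u₁M₁ : u 1 * M₁ ≡ - (u 2 * M₀)
        u₁M₁ = trans (solve 2 (λ x y → x := x :+ y :- y) refl (u 1 * M₁) (u 2 * M₀))
          (trans (cong (_- u 2 * M₀) recurrence₁) (+-identityˡ _))

        u₁²M₂ : u 1 * u 1 * M₂ ≡ (u 2 * u 2 - u 1 * u 3) * M₀
        u₁²M₂ = begin
          u 1 * u 1 * M₂
            ≡⟨ solve 6 (λ a b c x y z → a :* a :* z := a :* (a :* z :+ b :* y :+ c :* x) :- b :* (a :* y) :- a :* (c :* x))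
                 refl (u 1) (u 2) (u 3) M₀ M₁ M₂ ⟩
          u 1 * (u 1 * M₂ + u 2 * M₁ + u 3 * M₀) - u 2 * (u 1 * M₁) - u 1 * (u 3 * M₀)
            ≡⟨ cong₂ (λ x y → u 1 * x - u 2 * y - u 1 * (u 3 * M₀)) recurrence₂ u₁M₁ ⟩
          u 1 * 0# - u 2 * - (u 2 * M₀) - u 1 * (u 3 * M₀)
            ≡⟨ solve 4 (λ a b c x → a :* κ 0 :- b :* :- (b :* x) :- a :* (c :* x) := (b :* b :- a :* c) :* x) refl (u 1) (u 2) (u 3) M₀ ⟩
          (u 2 * u 2 - u 1 * u 3) * M₀ ∎

        -- Up to sign, the numerator of the coefficient of x^3 in the reciprocal of u₁ + u₂ x + u₃
        -- x^2 + u₄ x^3.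
        cubic : K
        cubic = u 2 * u 2 * u 2 - ι 2 * u 1 * u 2 * u 3 + u 1 * u 1 * u 4

        u₁³M₃ : u 1 * u 1 * u 1 * M₃ ≡ - (cubic * M₀)
        u₁³M₃ = begin
          u 1 * u 1 * u 1 * M₃
            ≡⟨ solve 8 (λ a b c d x y z w → a :* a :* a :* w := a :* a :* (a :* w :+ b :* z :+ c :* y :+ d :* x)
                 :- b :* (a :* a :* z) :- a :* c :* (a :* y) :- a :* a :* d :* x) refl (u 1) (u 2) (u 3) (u 4) M₀ M₁ M₂ M₃ ⟩
          u 1 * u 1 * (u 1 * M₃ + u 2 * M₂ + u 3 * M₁ + u 4 * M₀) - u 2 * (u 1 * u 1 * M₂) - u 1 * u 3 * (u 1 * M₁) - u 1 * u 1 * u 4 * M₀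
            ≡⟨ cong₂ (λ x y → u 1 * u 1 * x - u 2 * y - u 1 * u 3 * (u 1 * M₁) - u 1 * u 1 * u 4 * M₀) recurrence₃ u₁²M₂ ⟩
          u 1 * u 1 * 0# - u 2 * ((u 2 * u 2 - u 1 * u 3) * M₀) - u 1 * u 3 * (u 1 * M₁) - u 1 * u 1 * u 4 * M₀
            ≡⟨ cong (λ x → u 1 * u 1 * 0# - u 2 * ((u 2 * u 2 - u 1 * u 3) * M₀) - u 1 * u 3 * x - u 1 * u 1 * u 4 * M₀) u₁M₁ ⟩
          u 1 * u 1 * 0# - u 2 * ((u 2 * u 2 - u 1 * u 3) * M₀) - u 1 * u 3 * - (u 2 * M₀) - u 1 * u 1 * u 4 * M₀
            ≡⟨ solve 5 (λ a b c d x → a :* a :* κ 0 :- b :* ((b :* b :- a :* c) :* x) :- a :* c :* :- (b :* x) :- a :* a :* d :* x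
                 := :- ((b :* b :* b :- κ 2 :* a :* b :* c :+ a :* a :* d) :* x)) refl (u 1) (u 2) (u 3) (u 4) M₀ ⟩
          - (cubic * M₀) ∎

        index : ∀ k {e} → k ℕ.+ e ≡ d → k ℕ.+ m ℕ.+ e ≡ N
        index k {e} eq = trans (ℕ.+-assoc k m e) (trans (cong (k ℕ.+_) (ℕ.+-comm m e))
          (trans (sym (ℕ.+-assoc k e m)) (cong (ℕ._+ m) eq)))

        Φ₀≡ : Φ₀ ≡ C₀ * s * M₀
        Φ₀≡ = Φ-suc a (2 ℕ.+ t) d (ℕ.+-comm m d)

      Φ₀≢0 : Φ₀ ≢ 0#
      Φ₀≢0 e = *-≢0 (*-≢0 (bin≢0 m d (subst (_< p) (ℕ.+-comm d m) N<p)) (-1^n≢0 m)) M≢0 (trans (sym Φ₀≡) e)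

      -- The second evaluation of the coefficients of f, by binomials times coefficients of 1/P. The
      -- denominators n, n + 1, n + 2 of the binomial ratios and the powers of u₁ from the
      -- reciprocal series are cleared.
      Φ₁-closed : ν * (u 1 * Φ₁) ≡ δ * u 2 * Φ₀
      Φ₁-closed = begin
        ν * (u 1 * Φ₁)                       ≡⟨ cong (λ x → ν * (u 1 * x)) (Φ-suc a m (3 ℕ.+ d′) (index 1 refl)) ⟩
        ν * (u 1 * (C₁ * (- 1# * s) * M₁))   ≡⟨ solve 5 (λ v u c s x → v :* (u :* (c :* (:- κ 1 :* s) :* x)) := (:- s) :* ((v :* c) :* (u :* x))) refl ν (u 1) C₁ s M₁ ⟩
        (- s) * ((ν * C₁) * (u 1 * M₁))      ≡⟨ cong₂ (λ x y → (- s) * (x * y)) (bin-ratio m (3 ℕ.+ d′)) u₁M₁ ⟩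
        (- s) * ((δ * C₀) * - (u 2 * M₀))    ≡⟨ solve 5 (λ s d c u x → (:- s) :* ((d :* c) :* :- (u :* x)) := d :* u :* (c :* s :* x)) refl s δ C₀ (u 2) M₀ ⟩
        δ * u 2 * (C₀ * s * M₀)              ≡⟨ cong (δ * u 2 *_) Φ₀≡ ⟨
        δ * u 2 * Φ₀                         ∎

      Φ₂-closed : ν * (1# + ν) * (u 1 * u 1 * Φ₂) ≡ δ * δ₁ * (u 2 * u 2 - u 1 * u 3) * Φ₀
      Φ₂-closed = begin
        ν * (1# + ν) * (u 1 * u 1 * Φ₂)
          ≡⟨ cong (λ x → ν * (1# + ν) * (u 1 * u 1 * x)) (Φ-suc a (1 ℕ.+ m) (2 ℕ.+ d′) (index 2 refl)) ⟩
        ν * (1# + ν) * (u 1 * u 1 * (C₂ * (- 1# * (- 1# * s)) * M₂))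
          ≡⟨ solve 5 (λ v u c s x → v :* (u :* (c :* (:- κ 1 :* (:- κ 1 :* s)) :* x)) := s :* ((v :* c) :* (u :* x)))
               refl (ν * (1# + ν)) (u 1 * u 1) C₂ s M₂ ⟩
        s * ((ν * (1# + ν) * C₂) * (u 1 * u 1 * M₂))
          ≡⟨ cong₂ (λ x y → s * (x * y)) ratio₂ u₁²M₂ ⟩
        s * ((δ * δ₁ * C₀) * ((u 2 * u 2 - u 1 * u 3) * M₀))
          ≡⟨ solve 5 (λ s d c u x → s :* ((d :* c) :* (u :* x)) := d :* u :* (c :* s :* x)) refl s (δ * δ₁) C₀ (u 2 * u 2 - u 1 * u 3) M₀ ⟩
        δ * δ₁ * (u 2 * u 2 - u 1 * u 3) * (C₀ * s * M₀)
          ≡⟨ cong (δ * δ₁ * (u 2 * u 2 - u 1 * u 3) *_) Φ₀≡ ⟨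
        δ * δ₁ * (u 2 * u 2 - u 1 * u 3) * Φ₀ ∎

      Φ₃-closed : ν * (1# + ν) * (1# + (1# + ν)) * (u 1 * u 1 * u 1 * Φ₃) ≡ δ * δ₁ * δ₂ * cubic * Φ₀
      Φ₃-closed = begin
        ν * (1# + ν) * (1# + (1# + ν)) * (u 1 * u 1 * u 1 * Φ₃)
          ≡⟨ cong (λ x → ν * (1# + ν) * (1# + (1# + ν)) * (u 1 * u 1 * u 1 * x)) (Φ-suc a (2 ℕ.+ m) (1 ℕ.+ d′) (index 3 refl)) ⟩
        ν * (1# + ν) * (1# + (1# + ν)) * (u 1 * u 1 * u 1 * (C₃ * (- 1# * (- 1# * (- 1# * s))) * M₃))
          ≡⟨ solve 5 (λ v u c s x → v :* (u :* (c :* (:- κ 1 :* (:- κ 1 :* (:- κ 1 :* s))) :* x)) := (:- s) :* ((v :* c) :* (u :* x)))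
               refl (ν * (1# + ν) * (1# + (1# + ν))) (u 1 * u 1 * u 1) C₃ s M₃ ⟩
        (- s) * ((ν * (1# + ν) * (1# + (1# + ν)) * C₃) * (u 1 * u 1 * u 1 * M₃))
          ≡⟨ cong₂ (λ x y → (- s) * (x * y)) ratio₃ u₁³M₃ ⟩
        (- s) * ((δ * δ₁ * δ₂ * C₀) * - (cubic * M₀))
          ≡⟨ solve 5 (λ s d c u x → (:- s) :* ((d :* c) :* :- (u :* x)) := d :* u :* (c :* s :* x)) refl s (δ * δ₁ * δ₂) C₀ cubic M₀ ⟩
        δ * δ₁ * δ₂ * cubic * (C₀ * s * M₀)
          ≡⟨ cong (δ * δ₁ * δ₂ * cubic *_) Φ₀≡ ⟨
        δ * δ₁ * δ₂ * cubic * Φ₀ ∎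

      private
        R₂ R₃ : K
        R₂ = ι 2 * ν * u 1 * u 3 - ι m * u 2 * u 2
        R₃ = ι 3 * ν * u 1 * u 4 - (ι m - 1#) * u 2 * u 3

        ν*m : K
        ν*m = ν * ι m

      -- Inserting the closed forms in `G₃`, multiplied by n (n + 1) u₁, leaves R₂ with the factor -
      -- d n Φ₀, which is nonzero.
      quadratic-relation : R₂ ≡ 0#
      quadratic-relation = xy≡0⇒y≡0 (*-≢0 (*-≢0 Φ₀≢0 (λ e → ι-d≢0 (trans ι-d e))) ν≢0) (begin
        Φ₀ * ν*m * ν * R₂
          ≡⟨ solve 5 (λ m a b c x → let v = κ 1 :+ m ; d = v :* m in
               x :* d :* v :* (κ 2 :* v :* a :* c :- m :* b :* b) :=
               :- (κ 2 :* (d :* (d :- κ 1) :* (b :* b :- a :* c) :* x) :+ (κ 1 :- m) :* (κ 1 :+ v) :* b :* (d :* b :* x)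
                 :- κ 2 :* m :* v :* (κ 1 :+ v) :* a :* (c :* x))) refl (ι m) (u 1) (u 2) (u 3) Φ₀ ⟩
        - (ι 2 * (ν*m * (ν*m - 1#) * (u 2 * u 2 - u 1 * u 3) * Φ₀) + (1# - ι m) * (1# + ν) * u 2 * (ν*m * u 2 * Φ₀)
          - ι 2 * ι m * ν * (1# + ν) * u 1 * (u 3 * Φ₀))
          ≡⟨ cong₂ (λ x y → - (ι 2 * (x * y * (u 2 * u 2 - u 1 * u 3) * Φ₀) + (1# - ι m) * (1# + ν) * u 2 * (x * u 2 * Φ₀)
               - ι 2 * ι m * ν * (1# + ν) * u 1 * (u 3 * Φ₀))) ι-d ι[d-1] ⟨
        - (ι 2 * (δ * δ₁ * (u 2 * u 2 - u 1 * u 3) * Φ₀) + (1# - ι m) * (1# + ν) * u 2 * (δ * u 2 * Φ₀)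
          - ι 2 * ι m * ν * (1# + ν) * u 1 * (u 3 * Φ₀))
          ≡⟨ cong₂ (λ x y → - (ι 2 * x + (1# - ι m) * (1# + ν) * u 2 * y - ι 2 * ι m * ν * (1# + ν) * u 1 * (u 3 * Φ₀))) Φ₂-closed Φ₁-closed ⟨
        - (ι 2 * (ν * (1# + ν) * (u 1 * u 1 * Φ₂)) + (1# - ι m) * (1# + ν) * u 2 * (ν * (u 1 * Φ₁))
          - ι 2 * ι m * ν * (1# + ν) * u 1 * (u 3 * Φ₀))
          ≡⟨ solve 7 (λ m a b c x y z → let v = κ 1 :+ m in
               :- (κ 2 :* (v :* (κ 1 :+ v) :* (a :* a :* z)) :+ (κ 1 :- m) :* (κ 1 :+ v) :* b :* (v :* (a :* y))
                 :- κ 2 :* m :* v :* (κ 1 :+ v) :* a :* (c :* x))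
               := :- (v :* (κ 1 :+ v) :* a) :* (κ 2 :* (a :* z) :+ (κ 1 :- m) :* (b :* y) :- κ 2 :* m :* (c :* x)))
               refl (ι m) (u 1) (u 2) (u 3) Φ₀ Φ₁ Φ₂ ⟩
        - (ν * (1# + ν) * u 1) * (ι 2 * (u 1 * Φ₂) + (1# - ι m) * (u 2 * Φ₁) - ι 2 * ι m * (u 3 * Φ₀))
          ≡⟨ *0≡0 _ G₃ ⟩
        0# ∎)

      -- Here the closed forms turn `G₄` into a combination of R₃ and u₂ R₂ rather than a multiple
      -- of R₃. The second term drops out by `quadratic-relation`, and the coefficient of R₃
      -- contains n - 3.
      cubic-relation : R₃ ≡ 0#
      cubic-relation = xy≡0⇒y≡0
        (*-≢0 (*-≢0 (*-≢0 (*-≢0 (*-≢0 Φ₀≢0 (λ e → ι-d≢0 (trans ι-d e))) ν≢0) ν-3≢0) 1+ν≢0) u₁≢0) (begin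
        Φ₀ * ν*m * ν * (ι m - ι 2) * (1# + ν) * u 1 * R₃
          ≡⟨ solve 6 (λ m a b c e x → let v = κ 1 :+ m ; d = v :* m in
               x :* d :* v :* (m :- κ 2) :* (κ 1 :+ v) :* a :* (κ 3 :* v :* a :* e :- (m :- κ 1) :* b :* c) :=
               κ 3 :* (d :* (d :- κ 1) :* (d :- κ 2) :* (b :* b :* b :- κ 2 :* a :* b :* c :+ a :* a :* e) :* x)
               :+ (κ 2 :- m) :* (κ 1 :+ (κ 1 :+ v)) :* b :* (d :* (d :- κ 1) :* (b :* b :- a :* c) :* x)
               :+ (κ 1 :- κ 2 :* m) :* (κ 1 :+ v) :* (κ 1 :+ (κ 1 :+ v)) :* a :* c :* (d :* b :* x)
               :- κ 3 :* m :* v :* (κ 1 :+ v) :* (κ 1 :+ (κ 1 :+ v)) :* a :* a :* (e :* x)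
               :+ x :* d :* κ 2 :* v :* (d :- κ 1) :* b :* (κ 2 :* v :* a :* c :- m :* b :* b)) refl (ι m) (u 1) (u 2) (u 3) (u 4) Φ₀ ⟩
        expr (ν*m * (ν*m - 1#) * (ν*m - ι 2) * cubic * Φ₀) (ν*m * (ν*m - 1#) * (u 2 * u 2 - u 1 * u 3) * Φ₀) (ν*m * u 2 * Φ₀)
          + Φ₀ * ν*m * ι 2 * ν * (ν*m - 1#) * u 2 * R₂
          ≡⟨ cong₂ _+_ (cong₂ (λ x (y , z) → expr (x * y * z * cubic * Φ₀) (x * y * (u 2 * u 2 - u 1 * u 3) * Φ₀) (x * u 2 * Φ₀))
               (sym ι-d) (cong₂ _,_ (sym ι[d-1]) (sym ι[d-2]))) (*0≡0 _ quadratic-relation) ⟩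
        expr (δ * δ₁ * δ₂ * cubic * Φ₀) (δ * δ₁ * (u 2 * u 2 - u 1 * u 3) * Φ₀) (δ * u 2 * Φ₀) + 0#
          ≡⟨ cong₂ (λ x (y , z) → expr x y z + 0#) (sym Φ₃-closed) (cong₂ _,_ (sym Φ₂-closed) (sym Φ₁-closed)) ⟩
        expr (ν * (1# + ν) * (1# + (1# + ν)) * (u 1 * u 1 * u 1 * Φ₃)) (ν * (1# + ν) * (u 1 * u 1 * Φ₂)) (ν * (u 1 * Φ₁)) + 0#
          ≡⟨ solve 9 (λ m a b c e x y z w → let v = κ 1 :+ m in
               κ 3 :* (v :* (κ 1 :+ v) :* (κ 1 :+ (κ 1 :+ v)) :* (a :* a :* a :* w))
               :+ (κ 2 :- m) :* (κ 1 :+ (κ 1 :+ v)) :* b :* (v :* (κ 1 :+ v) :* (a :* a :* z))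
               :+ (κ 1 :- κ 2 :* m) :* (κ 1 :+ v) :* (κ 1 :+ (κ 1 :+ v)) :* a :* c :* (v :* (a :* y))
               :- κ 3 :* m :* v :* (κ 1 :+ v) :* (κ 1 :+ (κ 1 :+ v)) :* a :* a :* (e :* x) :+ κ 0
               := (v :* (κ 1 :+ v) :* (κ 1 :+ (κ 1 :+ v)) :* a :* a) :*
                  (κ 3 :* (a :* w) :+ (κ 2 :- m) :* (b :* z) :+ (κ 1 :- κ 2 :* m) :* (c :* y) :- κ 3 :* m :* (e :* x)))
               refl (ι m) (u 1) (u 2) (u 3) (u 4) Φ₀ Φ₁ Φ₂ Φ₃ ⟩
        (ν * (1# + ν) * (1# + (1# + ν)) * u 1 * u 1) *
          (ι 3 * (u 1 * Φ₃) + (ι 2 - ι m) * (u 2 * Φ₂) + (1# - ι 2 * ι m) * (u 3 * Φ₁) - ι 3 * ι m * (u 4 * Φ₀))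
          ≡⟨ *0≡0 _ G₄ ⟩
        0# ∎)
        where
        expr : K → K → K → K
        expr x y z = ι 3 * x + (ι 2 - ι m) * (1# + (1# + ν)) * u 2 * y
          + (1# - ι 2 * ι m) * (1# + ν) * (1# + (1# + ν)) * u 1 * u 3 * z
          - ι 3 * ι m * ν * (1# + ν) * (1# + (1# + ν)) * u 1 * u 1 * (u 4 * Φ₀)

    -- The transvectant T and its vanishing.

    ∂ : (ℕ → K) → ℕ → K
    ∂ v k = ι (suc k) * v (suc k)

    taylor-D : ∀ z g v → (∀ k → coeff (shift z g) k ≡ v k) → ∀ k → coeff (shift z (D g)) k ≡ ∂ v k
    taylor-D z g v eq k = trans (coeff-shift-D z g k) (cong (ι (suc k) *_) (eq (suc k)))

    -- At a root of P the value of T involves only c₁ and c₂, and their ratio is dictated by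
    -- `quadratic-relation`. The derivative there has u₁ u₄ with factor 24 (c₁ + c₃) and u₂ u₃ with
    -- factor 12 (c₁ + 2 c₂), so `cubic-relation` then dictates c₃.
    c₁ c₂ c₃ : K
    c₁ = (ι m - 1#) * (ι 4 * ν)
    c₂ = - ((ι m - 1#) * (ι 3 * ι m))
    c₃ = - (ν * (ν + 1#))

    -- The fourth transvectant of P with itself, P being read as a form of degree n + 1.
    T : Poly
    T = c₁ · (D P ⊗ D (D (D P))) ⊕ (c₂ · (D (D P) ⊗ D (D P)) ⊕ c₃ · (P ⊗ D (D (D (D P)))))

    taylor-T : ∀ z k → coeff (shift z T) k ≡
      c₁ * convolution (∂ (U z)) (∂ (∂ (∂ (U z)))) k +
      (c₂ * convolution (∂ (∂ (U z))) (∂ (∂ (U z))) k + c₃ * convolution (U z) (∂ (∂ (∂ (∂ (U z))))) k)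
    taylor-T z k = trans (shift-⊕ z (c₁ · (D P ⊗ D (D (D P)))) _ k) (cong₂ _+_
      (taylor-product c₁ (D P) (D (D (D P))) d¹ d³)
      (trans (shift-⊕ z (c₂ · (D (D P) ⊗ D (D P))) (c₃ · (P ⊗ D (D (D (D P))))) k) (cong₂ _+_
        (taylor-product c₂ (D (D P)) (D (D P)) d² d²)
        (taylor-product c₃ P (D (D (D (D P)))) (λ _ → refl) d⁴))))
      where
      taylor-product : ∀ c g h {v w : ℕ → K} → (∀ k → coeff (shift z g) k ≡ v k) → (∀ k → coeff (shift z h) k ≡ w k) →
                coeff (shift z (c · (g ⊗ h))) k ≡ c * convolution v w k
      taylor-product c g h eq eq′ = trans (shift-· z c (g ⊗ h) k) (cong (c *_)
        (trans (shift-⊗ z g h k) (trans (coeff-⊗ (shift z g) (shift z h) k) (convolution-cong eq eq′ k))))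
      d¹ = taylor-D z P (U z) (λ _ → refl)
      d² = taylor-D z (D P) (∂ (U z)) d¹
      d³ = taylor-D z (D (D P)) (∂ (∂ (U z))) d²
      d⁴ = taylor-D z (D (D (D P))) (∂ (∂ (∂ (U z)))) d³

    VanishesTo-T : ∀ {a} → a ∈ A → VanishesTo 2 a T
    VanishesTo-T {a} a∈A zero _ = begin
      coeff (shift a T) 0
        ≡⟨ taylor-T a 0 ⟩
      c₁ * (∂ u 0 * ∂ (∂ (∂ u)) 0 + 0#) + (c₂ * (∂ (∂ u) 0 * ∂ (∂ u) 0 + 0#) + c₃ * (u 0 * ∂ (∂ (∂ (∂ u))) 0 + 0#))
        ≡⟨ cong (λ x → c₁ * (∂ u 0 * ∂ (∂ (∂ u)) 0 + 0#) + (c₂ * (∂ (∂ u) 0 * ∂ (∂ u) 0 + 0#) + c₃ * (x * ∂ (∂ (∂ (∂ u))) 0 + 0#)))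
             (U-root a∈A) ⟩
      c₁ * (∂ u 0 * ∂ (∂ (∂ u)) 0 + 0#) + (c₂ * (∂ (∂ u) 0 * ∂ (∂ u) 0 + 0#) + c₃ * (0# * ∂ (∂ (∂ (∂ u))) 0 + 0#))
        ≡⟨ solve 5 (λ m a b c e → let v = κ 1 :+ m ; o = κ 1 :+ κ 0 in
             (m :- κ 1) :* (κ 4 :* v) :* (o :* a :* (o :* (κ 2 :* (κ 3 :* c))) :+ κ 0)
             :+ ((:- ((m :- κ 1) :* (κ 3 :* m))) :* (o :* (κ 2 :* b) :* (o :* (κ 2 :* b)) :+ κ 0)
             :+ (:- (v :* (v :+ κ 1))) :* (κ 0 :* (o :* (κ 2 :* (κ 3 :* (κ 4 :* e)))) :+ κ 0))
             := κ 12 :* (m :- κ 1) :* (κ 2 :* v :* a :* c :- m :* b :* b)) refl (ι m) (u 1) (u 2) (u 3) (u 4) ⟩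
      ι 12 * (ι m - 1#) * (ι 2 * ν * u 1 * u 3 - ι m * u 2 * u 2)
        ≡⟨ *0≡0 _ (AtRoot.quadratic-relation a∈A) ⟩
      0# ∎
      where u = U a
    VanishesTo-T {a} a∈A (suc zero) _ = begin
      coeff (shift a T) 1
        ≡⟨ taylor-T a 1 ⟩
      expr (u 0)
        ≡⟨ cong expr (U-root a∈A) ⟩
      expr 0#
        ≡⟨ solve 6 (λ m a b c e g → let v = κ 1 :+ m ; o = κ 1 :+ κ 0 in
             (m :- κ 1) :* (κ 4 :* v) :* (o :* a :* (κ 2 :* (κ 3 :* (κ 4 :* e))) :+ (κ 2 :* b :* (o :* (κ 2 :* (κ 3 :* c))) :+ κ 0))
             :+ ((:- ((m :- κ 1) :* (κ 3 :* m))) :* (o :* (κ 2 :* b) :* (κ 2 :* (κ 3 :* c)) :+ (κ 2 :* (κ 3 :* c) :* (o :* (κ 2 :* b)) :+ κ 0))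
             :+ (:- (v :* (v :+ κ 1))) :* (κ 0 :* (κ 2 :* (κ 3 :* (κ 4 :* (κ 5 :* g)))) :+ (a :* (o :* (κ 2 :* (κ 3 :* (κ 4 :* e)))) :+ κ 0)))
             := κ 24 :* (m :- κ 2) :* (κ 3 :* v :* a :* e :- (m :- κ 1) :* b :* c)) refl (ι m) (u 1) (u 2) (u 3) (u 4) (u 5) ⟩
      ι 24 * (ι m - ι 2) * (ι 3 * ν * u 1 * u 4 - (ι m - 1#) * u 2 * u 3)
        ≡⟨ *0≡0 _ (AtRoot.cubic-relation a∈A) ⟩
      0# ∎
      where
      u = U a
      expr : K → K
      expr x = c₁ * (∂ u 0 * ∂ (∂ (∂ u)) 1 + (∂ u 1 * ∂ (∂ (∂ u)) 0 + 0#))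
        + (c₂ * (∂ (∂ u) 0 * ∂ (∂ u) 1 + (∂ (∂ u) 1 * ∂ (∂ u) 0 + 0#))
        + c₃ * (x * ∂ (∂ (∂ (∂ u))) 1 + (u 1 * ∂ (∂ (∂ (∂ u))) 0 + 0#)))
    VanishesTo-T a∈A (suc (suc j)) (s≤s (s≤s ()))

    Degree<-T : Degree< (n ℕ.* 2) T
    Degree<-T k le = trans (coeff-⊕ (c₁ · (D P ⊗ D (D (D P)))) _ k) (0+0≡0
      (trans (coeff-· c₁ (D P ⊗ D (D (D P))) k) (*0≡0 _ (Degree<-⊗ n n (D P) (D (D (D P))) d¹ (weaken (D (D (D P))) (ℕ.m≤n+m (2 ℕ.+ t) 3) d³) k n+n≤k)))
      (trans (coeff-⊕ (c₂ · (D (D P) ⊗ D (D P))) _ k) (0+0≡0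
        (trans (coeff-· c₂ (D (D P) ⊗ D (D P)) k) (*0≡0 _ (Degree<-⊗ n n (D (D P)) (D (D P)) (weaken (D (D P)) (ℕ.n≤1+n m) d²) (weaken (D (D P)) (ℕ.m≤n+m m 2) d²) k n+n≤k)))
        (trans (coeff-· c₃ (P ⊗ D (D (D (D P)))) k) (*0≡0 _ (Degree<-⊗ (suc n) m P (D (D (D (D P)))) Degree<-P (weaken (D (D (D (D P)))) (ℕ.m≤n+m (1 ℕ.+ t) 3) d⁴) k
          (subst (_≤ k) (ℕ.+-suc n m) n+n≤k)))))))
      where
      n+n≤k : n ℕ.+ n ≤ k
      n+n≤k = subst (_≤ k) (trans (ℕ.*-comm n 2) (cong (n ℕ.+_) (ℕ.+-identityʳ n))) le
      weaken : ∀ {x y} g → x ≤ y → Degree< x g → Degree< y g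
      weaken g x≤y dg k y≤k = dg k (ℕ.≤-trans x≤y y≤k)
      d¹ = Degree<-D n P Degree<-P
      d² = Degree<-D m (D P) d¹
      d³ = Degree<-D (2 ℕ.+ t) (D (D P)) d²
      d⁴ = Degree<-D (1 ℕ.+ t) (D (D (D P))) d³

    falling₁₃ falling₂₂ falling₀₄ : K → K → K
    falling₁₃ x y = x * (y * (y - 1#) * (y - ι 2))
    falling₂₂ x y = x * (x - 1#) * (y * (y - 1#))
    falling₀₄ x y = y * (y - 1#) * (y - ι 2) * (y - ι 3)

    -- The factor of the pair (i, j) in the coefficient of T of degree i + j - 4. Each of the three
    -- products in T carries four derivatives in all, whence the common shift by 4.
    T-weight : K → ℕ → ℕ → K
    T-weight z i j = (c₁ * falling₁₃ (ι i) (ι j) + (c₂ * falling₂₂ (ι i) (ι j) + c₃ * falling₀₄ (ι i) (ι j))) * (U z i * U z j)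

    private
      ∂₁₃ : ∀ (v : ℕ → K) k → convolution (∂ v) (∂ (∂ (∂ v))) k ≡ antidiagonal (λ i j → falling₁₃ (ι i) (ι j) * (v i * v j)) (4 ℕ.+ k)
      ∂₁₃ v k = trans (antidiagonal-cong (λ i j → solve 4 (λ i j x y →
            (κ 1 :+ i) :* x :* ((κ 1 :+ j) :* ((κ 1 :+ (κ 1 :+ j)) :* ((κ 1 :+ (κ 1 :+ (κ 1 :+ j))) :* y))) :=
            (κ 1 :+ i) :* ((κ 1 :+ (κ 1 :+ (κ 1 :+ j))) :* ((κ 1 :+ (κ 1 :+ (κ 1 :+ j))) :- κ 1) :* ((κ 1 :+ (κ 1 :+ (κ 1 :+ j))) :- κ 2)) :* (x :* y))
            refl (ι i) (ι j) (v (suc i)) (v (3 ℕ.+ j))) k)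
        (trans (antidiagonal-sucʳ (λ i j → h (suc i) (2 ℕ.+ j)) (λ i → solve 2 (λ x y → x :* (κ 2 :* (κ 2 :- κ 1) :* (κ 2 :- κ 2)) :* y := κ 0) refl (ι (suc i)) _) k)
        (trans (antidiagonal-sucʳ (λ i j → h (suc i) (1 ℕ.+ j)) (λ i → solve 2 (λ x y → let o = κ 1 :+ κ 0 in x :* (o :* (o :- κ 1) :* (o :- κ 2)) :* y := κ 0) refl (ι (suc i)) _) (1 ℕ.+ k))
        (trans (antidiagonal-sucʳ (λ i j → h (suc i) j) (λ i → solve 2 (λ x y → x :* (κ 0 :* (κ 0 :- κ 1) :* (κ 0 :- κ 2)) :* y := κ 0) refl (ι (suc i)) _) (2 ℕ.+ k))
        (antidiagonal-sucˡ h (λ j → solve 2 (λ x y → κ 0 :* x :* y := κ 0) refl _ _) (3 ℕ.+ k)))))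
        where
        h : ℕ → ℕ → K
        h i j = falling₁₃ (ι i) (ι j) * (v i * v j)

      ∂₂₂ : ∀ (v : ℕ → K) k → convolution (∂ (∂ v)) (∂ (∂ v)) k ≡ antidiagonal (λ i j → falling₂₂ (ι i) (ι j) * (v i * v j)) (4 ℕ.+ k)
      ∂₂₂ v k = trans (antidiagonal-cong (λ i j → solve 4 (λ i j x y →
            (κ 1 :+ i) :* ((κ 1 :+ (κ 1 :+ i)) :* x) :* ((κ 1 :+ j) :* ((κ 1 :+ (κ 1 :+ j)) :* y)) :=
            (κ 1 :+ (κ 1 :+ i)) :* ((κ 1 :+ (κ 1 :+ i)) :- κ 1) :* ((κ 1 :+ (κ 1 :+ j)) :* ((κ 1 :+ (κ 1 :+ j)) :- κ 1)) :* (x :* y))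
            refl (ι i) (ι j) (v (2 ℕ.+ i)) (v (2 ℕ.+ j))) k)
        (trans (antidiagonal-sucʳ (λ i j → h (2 ℕ.+ i) (1 ℕ.+ j)) (λ i → solve 2 (λ x y → let o = κ 1 :+ κ 0 in x :* (o :* (o :- κ 1)) :* y := κ 0) refl _ _) k)
        (trans (antidiagonal-sucʳ (λ i j → h (2 ℕ.+ i) j) (λ i → solve 2 (λ x y → x :* (κ 0 :* (κ 0 :- κ 1)) :* y := κ 0) refl _ _) (1 ℕ.+ k))
        (trans (antidiagonal-sucˡ (λ i j → h (1 ℕ.+ i) j) (λ j → solve 2 (λ x y → let o = κ 1 :+ κ 0 in o :* (o :- κ 1) :* x :* y := κ 0) refl _ _) (2 ℕ.+ k))
        (antidiagonal-sucˡ h (λ j → solve 2 (λ x y → κ 0 :* (κ 0 :- κ 1) :* x :* y := κ 0) refl _ _) (3 ℕ.+ k)))))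
        where
        h : ℕ → ℕ → K
        h i j = falling₂₂ (ι i) (ι j) * (v i * v j)

      ∂₀₄ : ∀ (v : ℕ → K) k → convolution v (∂ (∂ (∂ (∂ v)))) k ≡ antidiagonal (λ i j → falling₀₄ (ι i) (ι j) * (v i * v j)) (4 ℕ.+ k)
      ∂₀₄ v k = trans (antidiagonal-cong (λ i j → solve 3 (λ j x y → let j₄ = κ 1 :+ (κ 1 :+ (κ 1 :+ (κ 1 :+ j))) in
            x :* ((κ 1 :+ j) :* ((κ 1 :+ (κ 1 :+ j)) :* ((κ 1 :+ (κ 1 :+ (κ 1 :+ j))) :* (j₄ :* y)))) :=
            j₄ :* (j₄ :- κ 1) :* (j₄ :- κ 2) :* (j₄ :- κ 3) :* (x :* y))
            refl (ι j) (v i) (v (4 ℕ.+ j))) k)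
        (trans (antidiagonal-sucʳ (λ i j → h i (3 ℕ.+ j)) (λ i → solve 1 (λ y → κ 3 :* (κ 3 :- κ 1) :* (κ 3 :- κ 2) :* (κ 3 :- κ 3) :* y := κ 0) refl _) k)
        (trans (antidiagonal-sucʳ (λ i j → h i (2 ℕ.+ j)) (λ i → solve 1 (λ y → κ 2 :* (κ 2 :- κ 1) :* (κ 2 :- κ 2) :* (κ 2 :- κ 3) :* y := κ 0) refl _) (1 ℕ.+ k))
        (trans (antidiagonal-sucʳ (λ i j → h i (1 ℕ.+ j)) (λ i → solve 1 (λ y → let o = κ 1 :+ κ 0 in o :* (o :- κ 1) :* (o :- κ 2) :* (o :- κ 3) :* y := κ 0) refl _) (2 ℕ.+ k))
        (antidiagonal-sucʳ h (λ i → solve 1 (λ y → κ 0 :* (κ 0 :- κ 1) :* (κ 0 :- κ 2) :* (κ 0 :- κ 3) :* y := κ 0) refl _) (3 ℕ.+ k)))))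
        where
        h : ℕ → ℕ → K
        h i j = falling₀₄ (ι i) (ι j) * (v i * v j)

    T≡0 : ∀ z k → antidiagonal (T-weight z) (4 ℕ.+ k) ≡ 0#
    T≡0 z k = begin
      antidiagonal (T-weight z) (4 ℕ.+ k)
        ≡⟨ antidiagonal-cong (λ i j → solve 7 (λ a x b y c w u → (a :* x :+ (b :* y :+ c :* w)) :* u := a :* (x :* u) :+ (b :* (y :* u) :+ c :* (w :* u)))
             refl c₁ (falling₁₃ (ι i) (ι j)) c₂ (falling₂₂ (ι i) (ι j)) c₃ (falling₀₄ (ι i) (ι j)) (U z i * U z j)) (4 ℕ.+ k) ⟩
      antidiagonal (λ i j → c₁ * h₁ i j + (c₂ * h₂ i j + c₃ * h₃ i j)) (4 ℕ.+ k)
        ≡⟨ antidiagonal-+ (λ i j → c₁ * h₁ i j) (λ i j → c₂ * h₂ i j + c₃ * h₃ i j) (4 ℕ.+ k) ⟩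
      antidiagonal (λ i j → c₁ * h₁ i j) (4 ℕ.+ k) + antidiagonal (λ i j → c₂ * h₂ i j + c₃ * h₃ i j) (4 ℕ.+ k)
        ≡⟨ cong₂ _+_ (antidiagonal-* c₁ h₁ (4 ℕ.+ k)) (trans (antidiagonal-+ (λ i j → c₂ * h₂ i j) (λ i j → c₃ * h₃ i j) (4 ℕ.+ k))
             (cong₂ _+_ (antidiagonal-* c₂ h₂ (4 ℕ.+ k)) (antidiagonal-* c₃ h₃ (4 ℕ.+ k)))) ⟩
      c₁ * antidiagonal h₁ (4 ℕ.+ k) + (c₂ * antidiagonal h₂ (4 ℕ.+ k) + c₃ * antidiagonal h₃ (4 ℕ.+ k))
        ≡⟨ cong₂ (λ x y → c₁ * x + y) (∂₁₃ (U z) k) (cong₂ (λ x y → c₂ * x + c₃ * y) (∂₂₂ (U z) k) (∂₀₄ (U z) k)) ⟨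
      c₁ * convolution (∂ (U z)) (∂ (∂ (∂ (U z)))) k +
        (c₂ * convolution (∂ (∂ (U z))) (∂ (∂ (U z))) k + c₃ * convolution (U z) (∂ (∂ (∂ (∂ (U z))))) k)
        ≡⟨ taylor-T z k ⟨
      coeff (shift z T) k
        ≡⟨ shift-zero z T (zero-by-roots 2 T A unique (All.tabulate VanishesTo-T)
             (subst (λ l → Degree< (l ℕ.* 2) T) (sym |A|≡n) Degree<-T)) k ⟩
      0# ∎
      where
      h₁ h₂ h₃ : ℕ → ℕ → K
      h₁ i j = falling₁₃ (ι i) (ι j) * (U z i * U z j)
      h₂ i j = falling₂₂ (ι i) (ι j) * (U z i * U z j)
      h₃ i j = falling₀₄ (ι i) (ι j) * (U z i * U z j)

    -- Relations for a single coefficient of P.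

    resonance : K → K
    resonance x = (ν + 1#) * x - ι 6 * ι m

    -- Only pairs containing the index n survive, so this is the linearisation of T at x^n, where T
    -- vanishes, in the direction x^(n-k). By covariance its kernel contains the directions of
    -- scaling, translation and x ↦ x/(1 + c x), which are k = 0, 1, -1. This explains three
    -- factors; the one that remains is linear in k.
    T-relation : ∀ z k r → k ℕ.+ r ≡ n → 0 < k →
      (∀ i j → i ℕ.+ j ≡ n ℕ.+ r → i ≢ r → i ≢ n → U z i * U z j ≡ 0#) →
      ν * (ι k + 1#) * ι k * (ι k - 1#) * resonance (ι k) * U z r ≡ 0#
    T-relation z k r k+r≡n 0<k vanish = begin
      ν * (ι k + 1#) * ι k * (ι k - 1#) * resonance (ι k) * U z r
        ≡⟨ cong (λ x → ν * (x + 1#) * x * (x - 1#) * resonance x * U z r) ι-k ⟩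
      ν * ((ν - ι r) + 1#) * (ν - ι r) * ((ν - ι r) - 1#) * resonance (ν - ι r) * U z r
        ≡⟨ solve 3 (λ m r x → let v = κ 1 :+ m ; k = v :- r ; a = (m :- κ 1) :* (κ 4 :* v) ; b = :- ((m :- κ 1) :* (κ 3 :* m)) ; c = :- (v :* (v :+ κ 1)) in
             v :* (k :+ κ 1) :* k :* (k :- κ 1) :* ((v :+ κ 1) :* k :- κ 6 :* m) :* x :=
             :- ((a :* (r :* (v :* (v :- κ 1) :* (v :- κ 2))) :+ (b :* (r :* (r :- κ 1) :* (v :* (v :- κ 1))) :+ c :* (v :* (v :- κ 1) :* (v :- κ 2) :* (v :- κ 3)))) :* (x :* κ 1)
               :+ (a :* (v :* (r :* (r :- κ 1) :* (r :- κ 2))) :+ (b :* (v :* (v :- κ 1) :* (r :* (r :- κ 1))) :+ c :* (r :* (r :- κ 1) :* (r :- κ 2) :* (r :- κ 3)))) :* (κ 1 :* x)))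
             refl (ι m) (ι r) (U z r) ⟩
      - (w (ι r) ν * (U z r * 1#) + w ν (ι r) * (1# * U z r))
        ≡⟨ cong (λ x → - (w (ι r) ν * (U z r * x) + w ν (ι r) * (x * U z r))) (U-lead z) ⟨
      - (T-weight z r n + T-weight z n r)
        ≡⟨ cong -_ (antidiagonal-pair {T-weight z} (n ℕ.+ r) r<n (ℕ.+-comm r n) refl (λ i j eq i≢r i≢n → *0≡0 (w (ι i) (ι j)) (vanish i j eq i≢r i≢n))) ⟨
      - antidiagonal (T-weight z) (4 ℕ.+ (t ℕ.+ r))
        ≡⟨ cong -_ (T≡0 z (t ℕ.+ r)) ⟩
      - 0#
        ≡⟨ solve 0 (:- κ 0 := κ 0) refl ⟩
      0# ∎
      where
      w : K → K → K
      w x y = c₁ * falling₁₃ x y + (c₂ * falling₂₂ x y + c₃ * falling₀₄ x y)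
      ι-k : ι k ≡ ν - ι r
      ι-k = trans (solve 2 (λ k r → k := k :+ r :- r) refl (ι k) (ι r)) (cong (_- ι r) (trans (sym (ι-+ k r)) (cong ι k+r≡n)))
      r<n : r < n
      r<n = subst (r <_) k+r≡n (ℕ.+-monoˡ-< r 0<k)

    -- The coefficient of x^(n + d - k) in P f' = m P' f.
    top-relation : ∀ z k r q → k ℕ.+ r ≡ n → k ℕ.+ q ≡ d → 0 < k → 0 < q →
      (∀ i → r < i → i < n → U z i ≡ 0#) →
      (bin q (k ℕ.+ m) + (- 1#) ^ k * ι m * bin d m) * U z r ≡ 0#
    top-relation z k@(suc e) r q@(suc q′) k+r≡n k+q≡d 0<k 0<q low =
      xy≡0⇒y≡0 (-1^n≢0 q) (begin
        σ * ((bin q (k ℕ.+ m) + (- 1#) ^ k * ι m * bin d m) * U z r)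
          ≡⟨ solve 6 (λ s b ρ m c x → s :* ((b :+ ρ :* m :* c) :* x) := m :* (x :* (c :* (ρ :* s))) :- b :* s :* :- x)
               refl σ (bin q (k ℕ.+ m)) ((- 1#) ^ k) (ι m) (bin d m) (U z r) ⟩
        ι m * (U z r * (bin d m * ((- 1#) ^ k * σ))) - bin q (k ℕ.+ m) * σ * - U z r
          ≡⟨ cong₂ (λ x y → ι m * (U z r * (bin d m * x)) - bin q (k ℕ.+ m) * σ * y)
               (trans (sym (^-homo-* (- 1#) k q)) (cong ((- 1#) ^_) k+q≡d)) (sym M-top) ⟩
        ι m * (U z r * (bin d m * (- 1#) ^ d)) - bin q (k ℕ.+ m) * σ * M z (k ℕ.+ m)
          ≡⟨ cong₂ (λ x y → ι m * (U z r * x) - y) (Φ-lead z) (Φ-suc z q′ (k ℕ.+ m) q+[k+m]≡N) ⟨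
        ι m * (U z r * Φ z d) - Φ z q
          ≡⟨ xy≡0⇒y≡0 (ι≢0-small k (s≤s z≤n) k≤N) k*≡0 ⟩
        0# ∎)
      where
      σ = (- 1#) ^ q
      r<n : r < n
      r<n = subst (r <_) k+r≡n (ℕ.+-monoˡ-< r 0<k)
      r+e≡m : r ℕ.+ e ≡ m
      r+e≡m = ℕ.suc-injective (trans (cong suc (ℕ.+-comm r e)) k+r≡n)
      n+e≡k+m : n ℕ.+ e ≡ k ℕ.+ m
      n+e≡k+m = cong suc (ℕ.+-comm m e)
      k≤N : k ≤ N
      k≤N = ℕ.≤-trans (ℕ.m≤m+n k q) (subst (_≤ N) (sym k+q≡d) (ℕ.m≤m+n d m))
      q+[k+m]≡N : q ℕ.+ (k ℕ.+ m) ≡ N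
      q+[k+m]≡N = trans (sym (ℕ.+-assoc q k m)) (cong (ℕ._+ m) (trans (ℕ.+-comm q k) k+q≡d))

      -- The moments of order at least m are the coefficients of 1/P at infinity. With a gap between
      -- the powers r and n of P, the first correction to x^(-n) is - `U z r` times x^(-n-k).
      M-top : M z (k ℕ.+ m) ≡ - U z r
      M-top = begin
        M z (k ℕ.+ m)
          ≡⟨ solve 2 (λ x u → x := u :* κ 1 :+ κ 1 :* x :- u) refl (M z (k ℕ.+ m)) (U z r) ⟩
        U z r * 1# + 1# * M z (k ℕ.+ m) - U z r
          ≡⟨ cong (_- U z r) (cong₂ _+_ (cong (U z r *_) (trans (sym (moment-≡ z)) (cong (M z) (sym r+e≡m))))
               (cong₂ _*_ (sym (U-lead z)) (cong (M z) (sym n+e≡k+m)))) ⟩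
        U z r * M z (r ℕ.+ e) + U z n * M z (n ℕ.+ e) - U z r
          ≡⟨ cong (_- U z r) (∑-pair (suc n) r n r<n ℕ.≤-refl vanish) ⟨
        ∑ (suc n) (λ i → U z i * M z (i ℕ.+ e)) - U z r
          ≡⟨ cong (_- U z r) (M-recurrence z e) ⟩
        0# - U z r
          ≡⟨ +-identityˡ _ ⟩
        - U z r ∎
        where
        vanish : ∀ i → i < suc n → i ≢ r → i ≢ n → U z i * M z (i ℕ.+ e) ≡ 0#
        vanish i (s≤s i≤n) i≢r i≢n with ℕ.<-cmp i r
        ... | tri< i<r _ _ = *0≡0 _ (moment-< z _ (subst (i ℕ.+ e <_) r+e≡m (ℕ.+-monoˡ-< e i<r)))
        ... | tri≈ _ i≡r _ = contradiction i≡r i≢r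
        ... | tri> _ _ r<i = 0*≡0 _ (low i r<i (ℕ.≤∧≢⇒< i≤n i≢n))

      ι-n : ν ≡ ι k + ι r
      ι-n = trans (cong ι (sym k+r≡n)) (ι-+ k r)

      -- Proportionality of f and P^m would give `Φ z q` as m times `U z r` times the leading
      -- coefficient. In the differential identity the weights of the two surviving pairs are d - m
      -- r = m k and q - m n = - k, hence the extra factor k.
      k*≡0 : ι k * (ι m * (U z r * Φ z d) - Φ z q) ≡ 0#
      k*≡0 = begin
        ι k * (ι m * (U z r * Φ z d) - Φ z q)
          ≡⟨ solve 6 (λ k r q m x y → k :* (m :* x :- y) :=
                 ((k :+ r) :* m :- m :* r) :* x :+ (q :- (k :+ q)) :* (κ 1 :* y))
               refl (ι k) (ι r) (ι q) (ι m) (U z r * Φ z d) (Φ z q) ⟩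
        ((ι k + ι r) * ι m - ι m * ι r) * (U z r * Φ z d) + (ι q - (ι k + ι q)) * (1# * Φ z q)
          ≡⟨ cong₂ (λ x y → (x - ι m * ι r) * (U z r * Φ z d) + (ι q - y) * (1# * Φ z q))
               (trans (cong (_* ι m) (sym ι-n)) (sym ι-d))
               (trans (sym (ι-+ k q)) (trans (cong ι k+q≡d) (trans ι-d (*-comm ν (ι m))))) ⟩
        (ι d - ι m * ι r) * (U z r * Φ z d) + (ι q - ι m * ν) * (1# * Φ z q)
          ≡⟨ cong (λ x → (ι d - ι m * ι r) * (U z r * Φ z d) + (ι q - ι m * ν) * (x * Φ z q)) (U-lead z) ⟨
        G-weight z r d + G-weight z n q
          ≡⟨ antidiagonal-pair (n ℕ.+ q) r<n r+d≡n+q refl vanish ⟨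
        antidiagonal (G-weight z) (n ℕ.+ q)
          ≡⟨ G≡0 z (n ℕ.+ q) ⟩
        0# ∎
        where
        r+d≡n+q : r ℕ.+ d ≡ n ℕ.+ q
        r+d≡n+q = trans (cong (r ℕ.+_) (sym k+q≡d)) (trans (sym (ℕ.+-assoc r k q)) (cong (ℕ._+ q) (trans (ℕ.+-comm r k) k+r≡n)))
        vanish : ∀ i j → i ℕ.+ j ≡ n ℕ.+ q → i ≢ r → i ≢ n → G-weight z i j ≡ 0#
        vanish i j eq i≢r i≢n with ℕ.<-cmp i r | ℕ.<-cmp i n
        ... | tri≈ _ i≡r _ | _            = contradiction i≡r i≢r
        ... | tri> _ _ r<i | tri< i<n _ _ = G-weight-zeroˡ z j (low i r<i i<n)
        ... | tri> _ _ r<i | tri≈ _ i≡n _ = contradiction i≡n i≢n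
        ... | tri> _ _ r<i | tri> _ _ n<i = G-weight-zeroˡ z j (U-degree z i n<i)
        ... | tri< i<r _ _ | _            = G-weight-zeroʳ z i (Φ-degree z j
          (ℕ.+-cancelˡ-< r d j (subst (_< r ℕ.+ j) (trans eq (sym r+d≡n+q)) (ℕ.+-monoˡ-< j i<r))))

    -- The k coefficients just below the leading one vanish. The lower bound is put as n ≤ i + k,
    -- which stays meaningful for k > n.
    Low : K → ℕ → Set
    Low z k = ∀ i → i < n → n ≤ i ℕ.+ k → U z i ≡ 0#

    Low-suc : ∀ z k → Low z k → (∀ r → suc k ℕ.+ r ≡ n → U z r ≡ 0#) → Low z (suc k)
    Low-suc z k low new i i<n le with ℕ.m≤n⇒m<n∨m≡n le
    ... | inj₁ lt = low i i<n (ℕ.≤-pred (subst (n <_) (ℕ.+-suc i k) lt))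
    ... | inj₂ eq = new i (trans (cong suc (ℕ.+-comm k i)) (trans (sym (ℕ.+-suc i k)) (sym eq)))

    Low-above : ∀ z k r → Low z k → suc k ℕ.+ r ≡ n → ∀ i → r < i → i < n → U z i ≡ 0#
    Low-above z k r low eq i r<i i<n = low i i<n
      (subst (_≤ i ℕ.+ k) (trans (cong suc (ℕ.+-comm r k)) eq) (ℕ.+-monoˡ-≤ k r<i))

    Low-top : ∀ z k → Low z k → ∀ q → suc k ℕ.+ q ≡ d → 0 < q →
              bin q (suc k ℕ.+ m) + (- 1#) ^ suc k * ι m * bin d m ≢ 0# → Low z (suc k)
    Low-top z k low q k+q≡d 0<q ≢0 = Low-suc z k low (λ r eq →
      xy≡0⇒y≡0 ≢0 (top-relation z (suc k) r q eq k+q≡d (s≤s z≤n) 0<q (Low-above z k r low eq)))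

    private
      C₀ C₁ C₂ C₃ : K
      C₀ = bin (4 ℕ.+ d′) m
      C₁ = bin (3 ℕ.+ d′) (1 ℕ.+ m)
      C₂ = bin (2 ℕ.+ d′) (2 ℕ.+ m)
      C₃ = bin (1 ℕ.+ d′) (3 ℕ.+ m)

      C₀≢0 : C₀ ≢ 0#
      C₀≢0 = bin≢0 d m N<p

    -- For k = 1 the factor in `top-relation` is zero, since d = n m and translation is free;
    -- therefore centring supplies that coefficient. For k = 2, clearing the denominators n (n + 1)
    -- of C₂/C₀ turns the factor into d n^2 C₀.
    Low-2 : ∀ z → Low z 1 → Low z 2
    Low-2 z low = Low-top z 1 low (2 ℕ.+ d′) refl (s≤s z≤n)
      (λ e → *-≢0 (*-≢0 (*-≢0 C₀≢0 (λ e → ι-d≢0 (trans ι-d e))) ν≢0) ν≢0 (begin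
        C₀ * (ν * ι m) * ν * ν
          ≡⟨ solve 2 (λ m c → let v = κ 1 :+ m in c :* (v :* m) :* v :* v := (v :* m :- κ 1) :* (v :* m :* c) :+ v :* (κ 1 :+ v) :* m :* c) refl (ι m) C₀ ⟩
        (ν * ι m - 1#) * (ν * ι m * C₀) + ν * (1# + ν) * ι m * C₀
          ≡⟨ cong₂ (λ x y → x * (y * C₀) + ν * (1# + ν) * ι m * C₀) ι[d-1] ι-d ⟨
        ι (3 ℕ.+ d′) * (ι d * C₀) + ν * (1# + ν) * ι m * C₀
          ≡⟨ cong (λ x → ι (3 ℕ.+ d′) * x + ν * (1# + ν) * ι m * C₀) (bin-ratio (3 ℕ.+ d′) m) ⟩
        ι (3 ℕ.+ d′) * (ν * C₁) + ν * (1# + ν) * ι m * C₀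
          ≡⟨ solve 5 (λ δ v c x m → δ :* (v :* c) :+ v :* (κ 1 :+ v) :* m :* x := v :* (δ :* c) :+ v :* (κ 1 :+ v) :* m :* x) refl (ι (3 ℕ.+ d′)) ν C₁ C₀ (ι m) ⟩
        ν * (ι (3 ℕ.+ d′) * C₁) + ν * (1# + ν) * ι m * C₀
          ≡⟨ cong (λ x → ν * x + ν * (1# + ν) * ι m * C₀) (bin-ratio (2 ℕ.+ d′) (1 ℕ.+ m)) ⟩
        ν * ((1# + ν) * C₂) + ν * (1# + ν) * ι m * C₀
          ≡⟨ solve 4 (λ v c x m → v :* ((κ 1 :+ v) :* c) :+ v :* (κ 1 :+ v) :* m :* x :=
               v :* (κ 1 :+ v) :* (c :+ (:- κ 1 :* (:- κ 1 :* κ 1)) :* m :* x)) refl ν C₂ C₀ (ι m) ⟩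
        ν * (1# + ν) * (C₂ + (- 1#) ^ 2 * ι m * C₀)
          ≡⟨ *0≡0 _ e ⟩
        0# ∎))

    -- With the denominators n (n + 1) (n + 2) cleared, the factor is d n^2 (n - 3) (n + 1) C₀. The
    -- coefficient k = 3 is precisely the one that the tetrahedral case n = 3 retains.
    Low-3 : ∀ z → Low z 2 → Low z 3
    Low-3 z low = Low-top z 2 low (1 ℕ.+ d′) refl (s≤s z≤n)
      (λ e → *-≢0 (*-≢0 (*-≢0 (*-≢0 (*-≢0 C₀≢0 (λ e → ι-d≢0 (trans ι-d e))) ν≢0) ν≢0) ν-3≢0) 1+ν≢0 (begin
        C₀ * (ν * ι m) * ν * ν * (ι m - ι 2) * (1# + ν)
          ≡⟨ solve 2 (λ m c → let v = κ 1 :+ m in c :* (v :* m) :* v :* v :* (m :- κ 2) :* (κ 1 :+ v)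
               := (v :* m :- κ 2) :* ((v :* m :- κ 1) :* (v :* m :* c)) :- v :* (κ 1 :+ v) :* (κ 1 :+ (κ 1 :+ v)) :* m :* c) refl (ι m) C₀ ⟩
        (ν * ι m - ι 2) * ((ν * ι m - 1#) * (ν * ι m * C₀)) - y
          ≡⟨ cong₂ (λ x (u , w) → x * (u * (w * C₀)) - y) (sym ι[d-2]) (cong₂ _,_ (sym ι[d-1]) (sym ι-d)) ⟩
        ι (2 ℕ.+ d′) * (ι (3 ℕ.+ d′) * (ι d * C₀)) - y
          ≡⟨ cong (λ x → ι (2 ℕ.+ d′) * (ι (3 ℕ.+ d′) * x) - y) (bin-ratio (3 ℕ.+ d′) m) ⟩
        ι (2 ℕ.+ d′) * (ι (3 ℕ.+ d′) * (ν * C₁)) - y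
          ≡⟨ solve 5 (λ δ ε v c y → δ :* (ε :* (v :* c)) :- y := δ :* (v :* (ε :* c)) :- y) refl (ι (2 ℕ.+ d′)) (ι (3 ℕ.+ d′)) ν C₁ y ⟩
        ι (2 ℕ.+ d′) * (ν * (ι (3 ℕ.+ d′) * C₁)) - y
          ≡⟨ cong (λ x → ι (2 ℕ.+ d′) * (ν * x) - y) (bin-ratio (2 ℕ.+ d′) (1 ℕ.+ m)) ⟩
        ι (2 ℕ.+ d′) * (ν * ((1# + ν) * C₂)) - y
          ≡⟨ solve 4 (λ δ v c y → δ :* (v :* ((κ 1 :+ v) :* c)) :- y := v :* (κ 1 :+ v) :* (δ :* c) :- y) refl (ι (2 ℕ.+ d′)) ν C₂ y ⟩
        ν * (1# + ν) * (ι (2 ℕ.+ d′) * C₂) - y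
          ≡⟨ cong (λ x → ν * (1# + ν) * x - y) (bin-ratio (1 ℕ.+ d′) (2 ℕ.+ m)) ⟩
        ν * (1# + ν) * ((1# + (1# + ν)) * C₃) - y
          ≡⟨ solve 4 (λ v c x m → v :* (κ 1 :+ v) :* ((κ 1 :+ (κ 1 :+ v)) :* c) :- v :* (κ 1 :+ v) :* (κ 1 :+ (κ 1 :+ v)) :* m :* x :=
               v :* (κ 1 :+ v) :* (κ 1 :+ (κ 1 :+ v)) :* (c :+ (:- κ 1 :* (:- κ 1 :* (:- κ 1 :* κ 1))) :* m :* x)) refl ν C₃ C₀ (ι m) ⟩
        ν * (1# + ν) * (1# + (1# + ν)) * (C₃ + (- 1#) ^ 3 * ι m * C₀)
          ≡⟨ *0≡0 _ e ⟩
        0# ∎))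
      where
      y = ν * (1# + ν) * (1# + (1# + ν)) * ι m * C₀

    -- Indices from 2 on avoid the zero of the factor k - 1. The three consecutive factors are
    -- positive and at most n + 1, hence below p.
    T-relation′ : ∀ z k r → suc (suc k) ℕ.+ r ≡ n → resonance (ι (suc (suc k))) ≢ 0# →
      (∀ i j → i ℕ.+ j ≡ n ℕ.+ r → i ≢ r → i ≢ n → U z i * U z j ≡ 0#) → U z r ≡ 0#
    T-relation′ z k r eq res≢0 vanish = xy≡0⇒y≡0
      (*-≢0 (*-≢0 (*-≢0 (*-≢0 ν≢0
        (λ e → ι≢0-small (3 ℕ.+ k) (s≤s z≤n) (ℕ.≤-trans (s≤s k≤n) n+1≤N) (trans (+-comm 1# _) e)))
        (ι≢0-small (2 ℕ.+ k) (s≤s z≤n) (ℕ.≤-trans k≤n n≤N)))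
        (λ e → ι≢0-small (1 ℕ.+ k) (s≤s z≤n) (ℕ.≤-trans (ℕ.n≤1+n _) (ℕ.≤-trans k≤n n≤N))
          (trans (solve 1 (λ x → x := κ 1 :+ x :- κ 1) refl (ι (suc k))) e)))
        res≢0)
      (T-relation z (suc (suc k)) r eq (s≤s z≤n) vanish)
      where
      k≤n : suc (suc k) ≤ n
      k≤n = subst (suc (suc k) ≤_) eq (ℕ.m≤m+n _ r)
      n+1≤N : suc n ≤ N
      n+1≤N = ℕ.+-monoˡ-≤ m {2} {d} (s≤s (s≤s z≤n))
      n≤N : n ≤ N
      n≤N = ℕ.≤-trans (ℕ.n≤1+n n) n+1≤N

    Low-T : ∀ z k → Low z (suc k) → resonance (ι (suc (suc k))) ≢ 0# → Low z (suc (suc k))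
    Low-T z k low res≢0 = Low-suc z (suc k) low (λ r eq → T-relation′ z k r eq res≢0 (vanish r eq))
      where
      vanish : ∀ r → suc (suc k) ℕ.+ r ≡ n → ∀ i j → i ℕ.+ j ≡ n ℕ.+ r → i ≢ r → i ≢ n → U z i * U z j ≡ 0#
      vanish r eq i j i+j≡n+r i≢r i≢n with ℕ.<-cmp i r | ℕ.<-cmp i n
      ... | tri≈ _ i≡r _ | _            = contradiction i≡r i≢r
      ... | tri> _ _ r<i | tri< i<n _ _ = 0*≡0 _ (Low-above z (suc k) r low eq i r<i i<n)
      ... | tri> _ _ r<i | tri≈ _ i≡n _ = contradiction i≡n i≢n
      ... | tri> _ _ r<i | tri> _ _ n<i = 0*≡0 _ (U-degree z i n<i)
      ... | tri< i<r _ _ | _            = *0≡0 _ (U-degree z j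
        (ℕ.+-cancelˡ-< r n j (subst (_< r ℕ.+ j) (trans i+j≡n+r (ℕ.+-comm n r)) (ℕ.+-monoˡ-< j i<r))))

    -- P(z + x) would be the pure power x^n, so z would be a multiple root, contrary to `u₁≢0`.
    Low-contradiction : ∀ z → ¬ Low z n
    Low-contradiction z low = AtRoot.u₁≢0 z∈A (low 1 (s≤s (s≤s z≤n)) (ℕ.m≤n+m n 1))
      where
      z∈A : z ∈ A
      z∈A = eval-rootPoly-≡0 A (trans (sym (coeff₀-shift z P)) (low 0 (s≤s z≤n) ℕ.≤-refl))

    12≤d : 12 ≤ d
    12≤d = subst (12 ≤_) (sym d≡nm) (ℕ.*-mono-≤ (ℕ.m≤m+n 4 t) (ℕ.m≤m+n 3 t))

    resonance≢0 : ∀ l → 6 ℕ.+ l ≤ n → resonance (ι (6 ℕ.+ l)) ≢ 0#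
    resonance≢0 l l≤n e = ι≢0 (12 ℕ.+ (2 ℕ.+ m) ℕ.* l) (s≤s z≤n) (ℕ.≤-<-trans (subst (λ x → 12 ℕ.+ (2 ℕ.+ m) ℕ.* l ≤ x ℕ.+ x) (sym d≡nm) (resonance-bound m n l (s≤s (s≤s z≤n)) l≤n)) d+d<p) (begin
      ι (12 ℕ.+ (2 ℕ.+ m) ℕ.* l)
        ≡⟨ trans (ι-+ 12 ((2 ℕ.+ m) ℕ.* l)) (cong (ι 12 +_) (ι-* (2 ℕ.+ m) l)) ⟩
      ι 12 + ι (2 ℕ.+ m) * ι l
        ≡⟨ solve 2 (λ m l → κ 12 :+ (κ 1 :+ (κ 1 :+ m)) :* l :=
             (κ 1 :+ m :+ κ 1) :* (κ 1 :+ (κ 1 :+ (κ 1 :+ (κ 1 :+ (κ 1 :+ (κ 1 :+ l)))))) :- κ 6 :* m) refl (ι m) (ι l) ⟩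
      resonance (ι (6 ℕ.+ l))
        ≡⟨ e ⟩
      0# ∎)

    Low-from-5 : ∀ z → Low z 5 → Low z n
    Low-from-5 z low₅ = [ (λ n≤5 i i<n _ → low₅ i i<n (ℕ.≤-trans n≤5 (ℕ.m≤n+m 5 i)))
                        , (λ 5≤n → subst (Low z) (ℕ.m+[n∸m]≡n 5≤n) (go (n ∸ 5) (ℕ.≤-reflexive (ℕ.m+[n∸m]≡n 5≤n)))) ]′
                        (ℕ.≤-total n 5)
      where
      go : ∀ l → 5 ℕ.+ l ≤ n → Low z (5 ℕ.+ l)
      go zero    _  = low₅
      go (suc l) le = Low-T z (4 ℕ.+ l) (go l (ℕ.≤-trans (ℕ.n≤1+n _) le)) (resonance≢0 l le)

    mean : K
    mean = (ν ⁻¹) * total A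

    U-mean : U mean m ≡ 0#
    U-mean = lemma A refl
      where
      lemma : ∀ B → B ≡ A → U mean m ≡ 0#
      lemma []      refl = contradiction |A|≡n λ ()
      lemma (b ∷ B) refl = begin
        U mean m
          ≡⟨ cong (U mean) (ℕ.suc-injective |A|≡n) ⟨
        U mean (length B)
          ≡⟨ taylor-rootPoly-second mean b B ⟩
        deviation mean A
          ≡⟨ deviation-total mean A ⟩
        ι (length A) * ((ν ⁻¹) * total A) - total A
          ≡⟨ cong (λ l → ι l * ((ν ⁻¹) * total A) - total A) |A|≡n ⟩
        ν * ((ν ⁻¹) * total A) - total A
          ≡⟨ solve 3 (λ v w s → v :* (w :* s) :- s := (v :* w :- κ 1) :* s) refl ν (ν ⁻¹) (total A) ⟩
        (ν * (ν ⁻¹) - 1#) * total A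
          ≡⟨ 0*≡0 _ (x≡y⇒x-y≡0 (inverseʳ ν ν≢0)) ⟩
        0# ∎

    Low-1 : Low mean 1
    Low-1 i i<n n≤i+1 = subst (λ i → U mean i ≡ 0#)
      (ℕ.≤-antisym (ℕ.≤-pred (subst (n ≤_) (ℕ.+-comm i 1) n≤i+1)) (ℕ.≤-pred i<n)) U-mean

    Low-mean-3 : Low mean 3
    Low-mean-3 = Low-3 mean (Low-2 mean Low-1)

    24<p : 24 < p
    24<p = ℕ.≤-<-trans (ℕ.+-mono-≤ 12≤d 12≤d) d+d<p

    ι-injective : ∀ a b → a < p → b < p → a ≢ b → ι a - ι b ≢ 0#
    ι-injective a b a<p b<p a≢b e with ℕ.<-cmp a b
    ... | tri< a<b _ _ = ι≢0 (b ∸ a) (ℕ.m<n⇒0<n∸m a<b) (ℕ.≤-<-trans (ℕ.m∸n≤m b a) b<p) (begin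
      ι (b ∸ a)              ≡⟨ solve 2 (λ x a → x := :- (a :- (a :+ x))) refl (ι (b ∸ a)) (ι a) ⟩
      - (ι a - (ι a + ι (b ∸ a)))  ≡⟨ cong (λ x → - (ι a - x)) (trans (sym (ι-+ a (b ∸ a))) (cong ι (ℕ.m+[n∸m]≡n (ℕ.<⇒≤ a<b)))) ⟩
      - (ι a - ι b)          ≡⟨ cong -_ e ⟩
      - 0#                   ≡⟨ solve 0 (:- κ 0 := κ 0) refl ⟩
      0#                     ∎)
    ... | tri≈ _ a≡b _ = a≢b a≡b
    ... | tri> _ _ b<a = ι≢0 (a ∸ b) (ℕ.m<n⇒0<n∸m b<a) (ℕ.≤-<-trans (ℕ.m∸n≤m a b) a<p) (begin
      ι (a ∸ b)              ≡⟨ solve 2 (λ x b → x := b :+ x :- b) refl (ι (a ∸ b)) (ι b) ⟩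
      ι b + ι (a ∸ b) - ι b  ≡⟨ cong (_- ι b) (trans (sym (ι-+ b (a ∸ b))) (cong ι (ℕ.m+[n∸m]≡n (ℕ.<⇒≤ b<a)))) ⟩
      ι a - ι b              ≡⟨ e ⟩
      0#                     ∎)

    t<p : t < p
    t<p = ℕ.≤-<-trans (ℕ.≤-trans (ℕ.m≤n+m t 3) (ℕ.m≤n+m m d)) N<p

    -- The resonance is 2 (5 - n) at k = 4 and 11 - n at k = 5, that is 2 (1 - t) and 7 - t. As t is
    -- below p, these vanish in the field only if they vanish as integers.
    resonance-4 : t ≢ 1 → resonance (ι 4) ≢ 0#
    resonance-4 t≢1 e = *-≢0 (ι≢0 2 (s≤s z≤n) (ℕ.≤-<-trans (ℕ.m≤m+n 2 22) 24<p))
      (ι-injective 1 t (ℕ.≤-<-trans (ℕ.m≤m+n 1 23) 24<p) t<p (t≢1 ∘ sym))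
      (trans (solve 1 (λ t → let m = κ 1 :+ (κ 1 :+ (κ 1 :+ t)) in
        κ 2 :* (κ 1 :+ κ 0 :- t) := (κ 1 :+ m :+ κ 1) :* κ 4 :- κ 6 :* m) refl (ι t)) e)

    resonance-5 : t ≢ 7 → resonance (ι 5) ≢ 0#
    resonance-5 t≢7 e = ι-injective 7 t (ℕ.≤-<-trans (ℕ.m≤m+n 7 17) 24<p) t<p (t≢7 ∘ sym)
      (trans (solve 1 (λ t → let m = κ 1 :+ (κ 1 :+ (κ 1 :+ t)) in
        κ 7 :- t := (κ 1 :+ m :+ κ 1) :* κ 5 :- κ 6 :* m) refl (ι t)) e)

    -- The icosahedral case n = 11, k = 5: p would divide 110·109·108·107·106 − 15·14·13·12·11·10,
    -- which has no prime factor above 163.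
    icosahedral : t ≡ 7 → ∀ q → 5 ℕ.+ q ≡ d → bin q (5 ℕ.+ m) + (- 1#) ^ 5 * ι m * bin d m ≢ 0#
    icosahedral t≡7 q 5+q≡d e = ratio-chain 11 12 13 14 15 110 109 108 107 106 10
      (110 ∷ 2 ∷ 11 ∷ 11 ∷ 47 ∷ 8 ∷ 9 ∷ 163 ∷ [])
      (bin d m) (bin (4 ℕ.+ q) (1 ℕ.+ m)) (bin (3 ℕ.+ q) (2 ℕ.+ m)) (bin (2 ℕ.+ q) (3 ℕ.+ m)) (bin (1 ℕ.+ q) (4 ℕ.+ m)) (bin q (5 ℕ.+ m))
      (ratio 110 11 d≡110 (cong (1 ℕ.+_) m≡10) (subst (λ x → ι x * bin x m ≡ ι (1 ℕ.+ m) * bin (4 ℕ.+ q) (1 ℕ.+ m)) 5+q≡d (bin-ratio (4 ℕ.+ q) m)))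
      (ratio 109 12 (cong (4 ℕ.+_) q≡105) (cong (2 ℕ.+_) m≡10) (bin-ratio (3 ℕ.+ q) (1 ℕ.+ m)))
      (ratio 108 13 (cong (3 ℕ.+_) q≡105) (cong (3 ℕ.+_) m≡10) (bin-ratio (2 ℕ.+ q) (2 ℕ.+ m)))
      (ratio 107 14 (cong (2 ℕ.+_) q≡105) (cong (4 ℕ.+_) m≡10) (bin-ratio (1 ℕ.+ q) (3 ℕ.+ m)))
      (ratio 106 15 (cong (1 ℕ.+_) q≡105) (cong (5 ℕ.+_) m≡10) (bin-ratio q (4 ℕ.+ m)))
      refl
      (small 110 110 refl ∷ small 2 218 refl ∷ small 11 209 refl ∷ small 11 209 refl ∷ small 47 173 refl ∷ small 8 212 refl
        ∷ small 9 211 refl ∷ small 163 57 refl ∷ [])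
      C₀≢0
      (x-y≡0⇒x≡y _ _ (trans (trans
        (solve 3 (λ c m x → c :- m :* x := c :+ (:- κ 1 :* (:- κ 1 :* (:- κ 1 :* (:- κ 1 :* (:- κ 1 :* κ 1))))) :* m :* x)
          refl (bin q (5 ℕ.+ m)) (ι 10) (bin d m))
        (cong (λ x → bin q (5 ℕ.+ m) + (- 1#) ^ 5 * ι x * bin d m) (sym m≡10))) e))
      where
      m≡10 : m ≡ 10
      m≡10 = cong (3 ℕ.+_) t≡7
      d≡110 : d ≡ 110
      d≡110 = trans d≡nm (cong (λ t → (4 ℕ.+ t) ℕ.* (3 ℕ.+ t)) t≡7)
      q≡105 : q ≡ 105
      q≡105 = ℕ.+-cancelˡ-≡ 5 q 105 (trans 5+q≡d d≡110)
      ratio : ∀ b a {x y : ℕ} {C C′ : K} → x ≡ b → y ≡ a → ι x * C ≡ ι y * C′ → ι b * C ≡ ι a * C′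
      ratio b a refl refl r = r
      -- Here 2 d is 220, so p exceeds 220; the slack l witnesses that k is at most 220.
      small : ∀ k l → k ℕ.+ l ≡ 220 → .{{_ : ℕ.NonZero k}} → ι k ≢ 0#
      small k l k+l≡220 = ι≢0 k (ℕ.>-nonZero⁻¹ k) (ℕ.≤-<-trans (subst (k ≤_) (trans k+l≡220 (sym (cong₂ ℕ._+_ d≡110 d≡110))) (ℕ.m≤m+n k l)) d+d<p)

    other : ∀ z → ∃[ a ] a ∈ A × a ≢ z
    other z = lemma A refl
      where
      lemma : ∀ B → B ≡ A → ∃[ a ] a ∈ A × a ≢ z
      lemma []            refl = contradiction |A|≡n λ ()
      lemma (_ ∷ [])      refl = contradiction |A|≡n λ ()
      lemma (b ∷ b′ ∷ B)  refl with b ≟ z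
      ... | no  b≢z = b , here refl , b≢z
      ... | yes b≡z = b′ , there (here refl) , λ b′≡z → b≢b′ unique (trans b≡z (sym b′≡z))
        where
        b≢b′ : ∀ {b b′ B} → Unique (b ∷ b′ ∷ B) → b ≢ b′
        b≢b′ ((b≢b′ ∷ _) ∷ _) = b≢b′

    private
      odd-quintic : ∀ {u₀ u₂ u₃ u₄ : K} u₁ u₅ x → u₀ ≡ 0# → u₂ ≡ 0# → u₃ ≡ 0# → u₄ ≡ 0# →
        let E = λ x → u₀ * 1# + (u₁ * (x * 1#) + (u₂ * (x * (x * 1#)) + (u₃ * (x * (x * (x * 1#)))
                  + (u₄ * (x * (x * (x * (x * 1#)))) + (u₅ * (x * (x * (x * (x * (x * 1#))))) + 0#))))) in
        E (- x) ≡ - E x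
      odd-quintic u₁ u₅ x refl refl refl refl = solve 3 (λ a b x →
        let E = λ x → κ 0 :* κ 1 :+ (a :* (x :* κ 1) :+ (κ 0 :* (x :* (x :* κ 1)) :+ (κ 0 :* (x :* (x :* (x :* κ 1)))
                  :+ (κ 0 :* (x :* (x :* (x :* (x :* κ 1)))) :+ (b :* (x :* (x :* (x :* (x :* (x :* κ 1))))) :+ κ 0))))) in
        E (:- x) := :- E x) refl u₁ u₅ x

    -- The octahedral case n = 5, k = 4: P(z + x) = x⁵ + c x is odd, so a − z = z − (2z − a) for a in A.
    octahedral : t ≡ 1 → ∃[ z ] ∃[ a ] ∃[ a′ ] z ∈ A × a ∈ A × a′ ∈ A × a ≢ z × z - a ≡ a′ - z
    octahedral t≡1 = z , a , a′ , z∈A , a∈A , a′∈A , a≢z ,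
      solve 2 (λ z a → z :- a := z :- (a :- z) :- z) refl z a
      where
      z  = mean
      a  = proj₁ (other z)
      a′ = z - (a - z)
      a∈A = proj₁ (proj₂ (other z))
      a≢z = proj₂ (proj₂ (other z))
      n≡5 : n ≡ 5
      n≡5 = cong (4 ℕ.+_) t≡1

      U-mid : ∀ i → 2 ≤ i → i < n → U z i ≡ 0#
      U-mid i 2≤i i<n = Low-mean-3 i i<n (subst (_≤ i ℕ.+ 3) (sym n≡5) (ℕ.+-monoˡ-≤ 3 2≤i))

      -- The coefficient of index 1 need not vanish, so there is no gap down to the constant term.
      -- Still, its partner has index n - 1 and is zero by centring, and this is enough for the
      -- T-relation at r = 0.
      vanish : ∀ i j → i ℕ.+ j ≡ n ℕ.+ 0 → i ≢ 0 → i ≢ n → U z i * U z j ≡ 0#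
      vanish zero          j eq i≢0 _   = contradiction refl i≢0
      vanish (suc zero)    j eq _   _   = *0≡0 _ (subst (λ j → U z j ≡ 0#)
        (sym (ℕ.suc-injective (trans eq (ℕ.+-identityʳ n)))) U-mean)
      vanish (suc (suc i)) j eq _   i≢n = 0*≡0 _ (U-mid (suc (suc i)) (s≤s (s≤s z≤n))
        (ℕ.≤∧≢⇒< (subst (suc (suc i) ≤_) (trans eq (ℕ.+-identityʳ n)) (ℕ.m≤m+n _ j)) i≢n))

      U₀ : U z 0 ≡ 0#
      U₀ = T-relation′ z 3 0 (sym n≡5) (resonance-5 (λ t≡7 → contradiction (trans (sym t≡1) t≡7) λ ())) vanish

      z∈A : z ∈ A
      z∈A = eval-rootPoly-≡0 A (trans (sym (coeff₀-shift z P)) U₀)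

      expand : ∀ x → eval P (x + z) ≡ ∑ 6 (λ i → U z i * x ^ i)
      expand x = trans (sym (eval-shift z P x)) (eval-∑ 6 (shift z P) x
        (λ k 6≤k → U-degree z k (subst (_< k) (sym n≡5) 6≤k)))

      u-zero : ∀ i → 2 ≤ i → i < 5 → U z i ≡ 0#
      u-zero i 2≤i i<5 = U-mid i 2≤i (subst (i <_) (sym n≡5) i<5)

      a′∈A : a′ ∈ A
      a′∈A = eval-rootPoly-≡0 A (begin
        eval P (z - (a - z))
          ≡⟨ cong (eval P) (solve 2 (λ z a → z :- (a :- z) := :- (a :- z) :+ z) refl z a) ⟩
        eval P (- (a - z) + z)
          ≡⟨ expand (- (a - z)) ⟩
        ∑ 6 (λ i → U z i * (- (a - z)) ^ i)
          ≡⟨ odd-quintic (U z 1) (U z 5) (a - z) U₀ (u-zero 2 (ℕ.m≤m+n 2 0) (ℕ.m≤m+n 3 2)) (u-zero 3 (ℕ.m≤m+n 2 1) (ℕ.m≤m+n 4 1))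
               (u-zero 4 (ℕ.m≤m+n 2 2) (ℕ.m≤m+n 5 0)) ⟩
        - ∑ 6 (λ i → U z i * (a - z) ^ i)
          ≡⟨ cong -_ (expand (a - z)) ⟨
        - eval P ((a - z) + z)
          ≡⟨ cong (λ x → - eval P x) (solve 2 (λ z a → a :- z :+ z := a) refl z a) ⟩
        - eval P a
          ≡⟨ cong -_ (eval-rootPoly-∈ A a∈A) ⟩
        - 0#
          ≡⟨ solve 0 (:- κ 0 := κ 0) refl ⟩
        0# ∎)

    -- For n ≠ 5 the claim holds vacuously, as every coefficient of P around the mean except the
    -- leading one would vanish. When n = 11 the step k = 5, where T is silent, is taken with the
    -- expansion at infinity.
    repeated-difference : ∃[ z ] ∃[ a ] ∃[ a′ ] z ∈ A × a ∈ A × a′ ∈ A × a ≢ z × z - a ≡ a′ - z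
    repeated-difference with t ℕ.≟ 1
    ... | yes t≡1 = octahedral t≡1
    ... | no  t≢1 = contradiction (Low-from-5 mean low₅) (Low-contradiction mean)
      where
      low₄ : Low mean 4
      low₄ = Low-T mean 2 Low-mean-3 (resonance-4 t≢1)
      low₅ : Low mean 5
      low₅ with t ℕ.≟ 7
      ... | no  t≢7 = Low-T mean 3 low₄ (resonance-5 t≢7)
      ... | yes t≡7 = Low-top mean 4 low₄ (d ∸ 5) 5+q≡d (ℕ.m<n⇒0<n∸m (ℕ.≤-trans (ℕ.m≤m+n 6 6) 12≤d)) (icosahedral t≡7 (d ∸ 5) 5+q≡d)
        where
        5+q≡d : 5 ℕ.+ (d ∸ 5) ≡ d
        5+q≡d = ℕ.m+[n∸m]≡n (ℕ.≤-trans (ℕ.m≤m+n 5 7) 12≤d)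

-- Repetitions in lists.

Unique-++-disjoint : ∀ {X : Set} (xs : List X) {ys x y} → Unique (xs ++ ys) → x ∈ xs → y ∈ ys → x ≢ y
Unique-++-disjoint (x ∷ xs) (x≢ ∷ unique) (here refl)  y∈ys refl = All.lookup x≢ (∈-++⁺ʳ xs y∈ys) refl
Unique-++-disjoint (_ ∷ xs) (_  ∷ unique) (there x∈xs) y∈ys      = Unique-++-disjoint xs unique x∈xs y∈ys

Unique-++⁻ʳ : ∀ {X : Set} (xs : List X) {ys} → Unique (xs ++ ys) → Unique ys
Unique-++⁻ʳ []       unique       = unique
Unique-++⁻ʳ (x ∷ xs) (_ ∷ unique) = Unique-++⁻ʳ xs unique

Unique-or-shorter : ∀ {X : Set} → DecidableEquality X → (xs : List X) →
  Unique xs ⊎ ∃[ ys ] (∀ {x} → x ∈ xs → x ∈ ys) × length ys < length xs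
Unique-or-shorter _≟_ []       = inj₁ []
Unique-or-shorter _≟_ (x ∷ xs) with x ∈? xs
  where open import Data.List.Membership.DecPropositional _≟_ using (_∈?_)
... | yes x∈xs = inj₂ (xs , (λ { (here refl) → x∈xs ; (there y∈xs) → y∈xs }) , ℕ.≤-refl)
... | no  x∉xs with Unique-or-shorter _≟_ xs
...   | inj₁ unique          = inj₁ (All.tabulate (λ { y∈xs refl → x∉xs y∈xs }) ∷ unique)
...   | inj₂ (ys , ⊆ , ys<xs) = inj₂ (x ∷ ys , (λ { (here refl) → here refl ; (there y∈xs) → there (⊆ y∈xs) }) , s≤s ys<xs)

-- The size of μ_d and the list of differences.

module Covering (F : DiscreteField) where
  open Extremal F public
  open ≡-Reasoning

  module Fermat (p : ℕ) (ι≢0 : ∀ k → 0 < k → k < p → ι k ≢ 0#) (0<p : 0 < p) (ι-p : ι p ≡ 0#) where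

    -- `bin-ratio` descends in j through multipliers below p, down to j = 0, where the multiplier is
    -- p itself.
    bin≡0 : ∀ j e → suc j ℕ.+ suc e ≡ p → bin (suc j) (suc e) ≡ 0#
    bin≡0 j e eq = xy≡0⇒y≡0 (ι≢0 (suc j) (s≤s z≤n) (subst (suc j <_) eq (ℕ.m<m+n (suc j) (s≤s z≤n))))
      (trans (bin-ratio j (suc e)) (lemma j eq))
      where
      lemma : ∀ j → suc j ℕ.+ suc e ≡ p → ι (suc (suc e)) * bin j (suc (suc e)) ≡ 0#
      lemma zero    eq = 0*≡0 _ (trans (cong ι eq) ι-p)
      lemma (suc j) eq = *0≡0 _ (bin≡0 j (suc e) (trans (cong suc (ℕ.+-suc j (suc e))) eq))

    frobenius : ∀ x → (1# + x) ^ p ≡ 1# + x ^ p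
    frobenius x = begin
      (1# + x) ^ p
        ≡⟨ cong (λ y → (1# + y) ^ p) (*-identityˡ x) ⟨
      (1# + 1# * x) ^ p
        ≡⟨ eval-linearPower 1# 1# p x ⟨
      eval (linearPower 1# 1# p) x
        ≡⟨ eval-∑ (suc p) (linearPower 1# 1# p) x (Degree<-linearPower 1# 1# p) ⟩
      ∑ (suc p) (λ i → coeff (linearPower 1# 1# p) i * x ^ i)
        ≡⟨ ∑-pair (suc p) 0 p 0<p ℕ.≤-refl vanish ⟩
      coeff (linearPower 1# 1# p) 0 * 1# + coeff (linearPower 1# 1# p) p * x ^ p
        ≡⟨ cong₂ (λ a b → a * 1# + b * x ^ p) (trans (coeff-linearPower 1# 1# p 0 p refl) (cong (λ y → 1# * (y * 1#)) (1^n≡1 p)))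
             (trans (coeff-linearPower 1# 1# p p 0 (ℕ.+-identityʳ p)) (cong₂ (λ b y → b * (1# * y)) (bin-0 p) (1^n≡1 p))) ⟩
      1# * (1# * 1#) * 1# + 1# * (1# * 1#) * x ^ p
        ≡⟨ solve 1 (λ y → κ 1 :* (κ 1 :* κ 1) :* κ 1 :+ κ 1 :* (κ 1 :* κ 1) :* y := κ 1 :+ y) refl (x ^ p) ⟩
      1# + x ^ p ∎
      where
      vanish : ∀ i → i < suc p → i ≢ 0 → i ≢ p → coeff (linearPower 1# 1# p) i * x ^ i ≡ 0#
      vanish zero    _         i≢0 _   = contradiction refl i≢0
      vanish (suc i) (s≤s i≤p) _   i≢p = 0*≡0 _ (trans (coeff-linearPower 1# 1# p (suc i) (suc e) eq) (0*≡0 _ (bin≡0 i e eq)))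
        where
        e = p ∸ suc (suc i)
        eq : suc i ℕ.+ suc e ≡ p
        eq = trans (ℕ.+-suc (suc i) e) (ℕ.m+[n∸m]≡n (ℕ.≤∧≢⇒< i≤p i≢p))

    ι^p≡ι : ∀ k → ι k ^ p ≡ ι k
    ι^p≡ι zero    = lemma p 0<p
      where
      lemma : ∀ p → 0 < p → 0# ^ p ≡ 0#
      lemma (suc p) _ = zeroˡ _
    ι^p≡ι (suc k) = trans (frobenius (ι k)) (cong (1# +_) (ι^p≡ι k))

  X^_·_ : ℕ → Poly → Poly
  X^ zero  · f = f
  X^ suc d · f = 0# ∷ (X^ d · f)

  eval-X^ : ∀ d f x → eval (X^ d · f) x ≡ x ^ d * eval f x
  eval-X^ zero    f x = sym (*-identityˡ _)
  eval-X^ (suc d) f x = trans (cong (λ y → 0# + x * y) (eval-X^ d f x))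
    (solve 3 (λ x y z → κ 0 :+ x :* (y :* z) := x :* y :* z) refl _ _ _)

  coeff-X^ : ∀ d f k → coeff (X^ d · f) (d ℕ.+ k) ≡ coeff f k
  coeff-X^ zero    f k = refl
  coeff-X^ (suc d) f k = coeff-X^ d f k

  Degree<-X^ : ∀ d f n → Degree< n f → Degree< (d ℕ.+ n) (X^ d · f)
  Degree<-X^ zero    f n df k       le       = df k le
  Degree<-X^ (suc d) f n df (suc k) (s≤s le) = Degree<-X^ d f n df k le

  -- The cofactor of X^d - 1 in X^(d (e+1)) - 1. When the group of nonzero elements has order d (e +
  -- 1), its roots include all nonzero elements outside μ_d.
  geometric : ℕ → ℕ → Poly
  geometric d zero    = 1# ∷ []
  geometric d (suc e) = (1# ∷ []) ⊕ (X^ d · geometric d e)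

  eval-geometric : ∀ d e x → (x ^ d - 1#) * eval (geometric d e) x ≡ x ^ (d ℕ.* suc e) - 1#
  eval-geometric d zero    x = trans (solve 2 (λ y x → (y :- κ 1) :* (κ 1 :+ x :* κ 0) := y :- κ 1) refl (x ^ d) x)
    (cong (λ k → x ^ k - 1#) (sym (ℕ.*-identityʳ d)))
  eval-geometric d (suc e) x = begin
    (x ^ d - 1#) * eval ((1# ∷ []) ⊕ (X^ d · geometric d e)) x
      ≡⟨ cong ((x ^ d - 1#) *_) (trans (eval-⊕ (1# ∷ []) (X^ d · geometric d e) x) (cong (1# + x * 0# +_) (eval-X^ d (geometric d e) x))) ⟩
    (x ^ d - 1#) * (1# + x * 0# + x ^ d * eval (geometric d e) x)
      ≡⟨ solve 3 (λ y x g → (y :- κ 1) :* (κ 1 :+ x :* κ 0 :+ y :* g) := y :- κ 1 :+ y :* ((y :- κ 1) :* g)) refl (x ^ d) x _ ⟩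
    x ^ d - 1# + x ^ d * ((x ^ d - 1#) * eval (geometric d e) x)
      ≡⟨ cong (λ y → x ^ d - 1# + x ^ d * y) (eval-geometric d e x) ⟩
    x ^ d - 1# + x ^ d * (x ^ (d ℕ.* suc e) - 1#)
      ≡⟨ solve 2 (λ y w → y :- κ 1 :+ y :* (w :- κ 1) := y :* w :- κ 1) refl (x ^ d) (x ^ (d ℕ.* suc e)) ⟩
    x ^ d * x ^ (d ℕ.* suc e) - 1#
      ≡⟨ cong (_- 1#) (trans (sym (^-homo-* x d (d ℕ.* suc e))) (cong (x ^_) (sym (ℕ.*-suc d (suc e))))) ⟩
    x ^ (d ℕ.* suc (suc e)) - 1# ∎

  Degree<-geometric : ∀ d e → Degree< (suc (d ℕ.* e)) (geometric d e)
  Degree<-geometric d zero    (suc k) _  = refl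
  Degree<-geometric d (suc e) (suc k) le = trans (coeff-⊕ (1# ∷ []) (X^ d · geometric d e) (suc k)) (trans (+-identityˡ _)
    (Degree<-X^ d (geometric d e) (suc (d ℕ.* e)) (Degree<-geometric d e) (suc k)
      (subst (_≤ suc k) (trans (cong suc (ℕ.*-suc d e)) (sym (ℕ.+-suc d (d ℕ.* e)))) le)))

  geometric-lead : ∀ d e → 0 < d → coeff (geometric d e) (d ℕ.* e) ≡ 1#
  geometric-lead d       zero    _   = cong (coeff (1# ∷ [])) (ℕ.*-zeroʳ d)
  geometric-lead (suc d) (suc e) 0<d = begin
    coeff ((1# ∷ []) ⊕ (X^ suc d · g)) (suc d ℕ.* suc e)
      ≡⟨ trans (coeff-⊕ (1# ∷ []) (X^ suc d · g) (suc d ℕ.* suc e)) (+-identityˡ _) ⟩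
    coeff (X^ suc d · g) (suc d ℕ.* suc e)
      ≡⟨ cong (coeff (X^ suc d · g)) (ℕ.*-suc (suc d) e) ⟩
    coeff (X^ suc d · g) (suc d ℕ.+ suc d ℕ.* e)
      ≡⟨ coeff-X^ (suc d) g (suc d ℕ.* e) ⟩
    coeff g (suc d ℕ.* e)
      ≡⟨ geometric-lead (suc d) e 0<d ⟩
    1# ∎
    where g = geometric (suc d) e

  -- X ∏ (X − s) (1 + X^d + … + X^(de)) vanishes on the whole field, so it has degree at least p.
  μ-size : ∀ d e p → p ≡ suc (d ℕ.* suc e) → 0 < d → (E : List K) → Unique E → length E ≡ p →
    (∀ x → x ≢ 0# → x ^ (d ℕ.* suc e) ≡ 1#) →
    (S : List K) → (∀ x → x ^ d ≡ 1# → x ∈ S) → d ≤ length S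
  μ-size d e p p≡ 0<d E uniqueE |E|≡p fermat S cover with d ℕ.≤? length S
  ... | yes d≤S = d≤S
  ... | no  d≰S = contradiction (trans (sym lead) (zero-by-roots 1 Q E uniqueE (All.tabulate (λ {x} _ → root⇒VanishesTo-1 Q x (root x))) degree (suc (s ℕ.+ d ℕ.* e)))) 1≢0
    where
    R = rootPoly S
    g = geometric d e
    Q = 0# ∷ R ⊗ g
    s = length S
    S<d : s < d
    S<d = ℕ.≰⇒> d≰S
    Degree<-R : Degree< (suc s) R
    Degree<-R k le = trans (sym (shift-0 R k)) (taylor-rootPoly-degree 0# S k le)
    lead : coeff Q (suc (s ℕ.+ d ℕ.* e)) ≡ 1#
    lead = begin
      coeff (R ⊗ g) (s ℕ.+ d ℕ.* e)
        ≡⟨ coeff-⊗ R g (s ℕ.+ d ℕ.* e) ⟩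
      convolution (coeff R) (coeff g) (s ℕ.+ d ℕ.* e)
        ≡⟨ antidiagonal-single (s ℕ.+ d ℕ.* e) refl vanish ⟩
      coeff R s * coeff g (d ℕ.* e)
        ≡⟨ cong₂ _*_ (trans (sym (shift-0 R s)) (taylor-rootPoly-lead 0# S)) (geometric-lead d e 0<d) ⟩
      1# * 1#
        ≡⟨ *-identityˡ 1# ⟩
      1# ∎
      where
      vanish : ∀ i j → i ℕ.+ j ≡ s ℕ.+ d ℕ.* e → i ≢ s → coeff R i * coeff g j ≡ 0#
      vanish i j eq i≢s with ℕ.<-cmp i s
      ... | tri< i<s _ _ = *0≡0 _ (Degree<-geometric d e j (ℕ.+-cancelˡ-< s (d ℕ.* e) j (subst (_< s ℕ.+ j) eq (ℕ.+-monoˡ-< j i<s))))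
      ... | tri≈ _ i≡s _ = contradiction i≡s i≢s
      ... | tri> _ _ s<i = 0*≡0 _ (Degree<-R i s<i)
    degree : Degree< (length E ℕ.* 1) Q
    degree zero    le = refl
    degree (suc k) le = Degree<-⊗ (suc s) (d ℕ.* e) R g Degree<-R (Degree<-geometric d e) k (ℕ.≤-trans (ℕ.+-monoˡ-≤ (d ℕ.* e) S<d)
      (subst (_≤ k) (ℕ.*-suc d e) (ℕ.≤-pred (subst (_≤ suc k) (trans (ℕ.*-identityʳ _) (trans |E|≡p p≡)) le))))
    factor : ∀ x → x ≢ 0# → eval R x * eval g x ≡ 0#
    factor x x≢0 with (x ^ d) ≟ 1#
    ... | yes x^d≡1 = 0*≡0 _ (eval-rootPoly-∈ S (cover x x^d≡1))
    ... | no  x^d≢1 = *0≡0 _ (xy≡0⇒y≡0 (x^d≢1 ∘ x-y≡0⇒x≡y _ _) (trans (eval-geometric d e x) (x≡y⇒x-y≡0 (fermat x x≢0))))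
    root : ∀ x → eval Q x ≡ 0#
    root x with x ≟ 0#
    ... | yes refl = trans (+-identityˡ _) (zeroˡ _)
    ... | no  x≢0  = trans (+-identityˡ _) (*0≡0 x (trans (eval-⊗ R g x) (factor x x≢0)))

  -- One entry for each ordered pair of distinct positions, so that a repeated entry is a
  -- coincidence of differences. The recursion separates the pairs by whether the head comes first,
  -- second or not at all.
  differences : List K → List K
  differences []      = []
  differences (a ∷ A) = map (λ b → a - b) A ++ (map (_- a) A ++ differences A)

  length-differences : ∀ A → length (differences A) ℕ.+ length A ≡ length A ℕ.* length A
  length-differences []      = refl
  length-differences (a ∷ A) = begin
    length (map (λ b → a - b) A ++ (map (_- a) A ++ differences A)) ℕ.+ suc n
      ≡⟨ cong (ℕ._+ suc n) (trans (length-++ (map (λ b → a - b) A)) (cong₂ ℕ._+_ (length-map (λ b → a - b) A)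
           (trans (length-++ (map (_- a) A)) (cong (ℕ._+ length (differences A)) (length-map (_- a) A))))) ⟩
    n ℕ.+ (n ℕ.+ length (differences A)) ℕ.+ suc n
      ≡⟨ rearrange n (length (differences A)) ⟩
    suc (n ℕ.+ n ℕ.+ (length (differences A) ℕ.+ n))
      ≡⟨ cong (λ k → suc (n ℕ.+ n ℕ.+ k)) (length-differences A) ⟩
    suc (n ℕ.+ n ℕ.+ n ℕ.* n)
      ≡⟨ square n ⟩
    suc n ℕ.* suc n ∎
    where
    n = length A
    rearrange : ∀ n l → n ℕ.+ (n ℕ.+ l) ℕ.+ suc n ≡ suc (n ℕ.+ n ℕ.+ (l ℕ.+ n))
    rearrange = solve-∀
    square : ∀ n → suc (n ℕ.+ n ℕ.+ n ℕ.* n) ≡ suc n ℕ.* suc n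
    square = solve-∀

  |differences| : ∀ A m → length A ≡ suc m → length (differences A) ≡ suc m ℕ.* m
  |differences| A m eq = ℕ.+-cancelʳ-≡ (suc m) _ _ (trans (subst (λ k → length (differences A) ℕ.+ k ≡ k ℕ.* k) eq (length-differences A))
    (trans (ℕ.*-suc (suc m) m) (ℕ.+-comm (suc m) _)))

  data Position (h : K) (A : List K) (a b : K) : Set where
    first  : a ≡ h → b ∈ A → Position h A a b
    second : b ≡ h → a ∈ A → Position h A a b
    later  : a ∈ A → b ∈ A → Position h A a b

  position : ∀ {h A a b} → a ∈ h ∷ A → b ∈ h ∷ A → a ≢ b → Position h A a b
  position (here refl) (here refl) a≢b = contradiction refl a≢b
  position (here a≡h)  (there b∈A) _   = first a≡h b∈A
  position (there a∈A) (here b≡h)  _   = second b≡h a∈A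
  position (there a∈A) (there b∈A) _   = later a∈A b∈A

  ∈-differences : ∀ A {a b} → a ∈ A → b ∈ A → a ≢ b → a - b ∈ differences A
  ∈-differences (h ∷ A) a∈A b∈A a≢b with position a∈A b∈A a≢b
  ... | first  refl b∈A = ∈-++⁺ˡ (∈-map⁺ (λ b → h - b) b∈A)
  ... | second refl a∈A = ∈-++⁺ʳ (map (λ b → h - b) A) (∈-++⁺ˡ (∈-map⁺ (_- h) a∈A))
  ... | later  a∈A  b∈A = ∈-++⁺ʳ (map (λ b → h - b) A) (∈-++⁺ʳ (map (_- h) A) (∈-differences A a∈A b∈A a≢b))

  -- Pairs in which the head plays different roles lie in disjoint segments of the list, so equal
  -- differences force equal roles. Then either both first members are the head, or the second
  -- members agree and cancel, or the tail decides.
  differences-injective : ∀ A → Unique (differences A) → ∀ {a b a′ b′} → a ∈ A → b ∈ A → a′ ∈ A → b′ ∈ A →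
    a ≢ b → a′ ≢ b′ → a - b ≡ a′ - b′ → a ≡ a′
  differences-injective (h ∷ A) unique {a} {b} {a′} {b′} a∈ b∈ a′∈ b′∈ a≢b a′≢b′ eq
    with position a∈ b∈ a≢b | position a′∈ b′∈ a′≢b′
  ... | first  refl b∈A | first  refl b′∈A = refl
  ... | second refl a∈A | second refl a′∈A = begin
    a             ≡⟨ solve 2 (λ a h → a := a :- h :+ h) refl a h ⟩
    a - h + h     ≡⟨ cong (_+ h) eq ⟩
    a′ - h + h    ≡⟨ solve 2 (λ a h → a :- h :+ h := a) refl a′ h ⟩
    a′            ∎
  ... | later  a∈A b∈A  | later  a′∈A b′∈A =
    differences-injective A (Unique-++⁻ʳ (map (_- h) A) (Unique-++⁻ʳ (map (λ b → h - b) A) unique)) a∈A b∈A a′∈A b′∈A a≢b a′≢b′ eq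
  ... | first  refl b∈A | second refl a′∈A = contradiction eq (Unique-++-disjoint (map (λ b → h - b) A) unique
    (∈-map⁺ (λ b → h - b) b∈A) (∈-++⁺ˡ (∈-map⁺ (_- h) a′∈A)))
  ... | first  refl b∈A | later  a′∈A b′∈A = contradiction eq (Unique-++-disjoint (map (λ b → h - b) A) unique
    (∈-map⁺ (λ b → h - b) b∈A) (∈-++⁺ʳ (map (_- h) A) (∈-differences A a′∈A b′∈A a′≢b′)))
  ... | second refl a∈A | first  refl b′∈A = contradiction (sym eq) (Unique-++-disjoint (map (λ b → h - b) A) unique
    (∈-map⁺ (λ b → h - b) b′∈A) (∈-++⁺ˡ (∈-map⁺ (_- h) a∈A)))
  ... | later  a∈A b∈A  | first  refl b′∈A = contradiction (sym eq) (Unique-++-disjoint (map (λ b → h - b) A) unique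
    (∈-map⁺ (λ b → h - b) b′∈A) (∈-++⁺ʳ (map (_- h) A) (∈-differences A a∈A b∈A a≢b)))
  ... | second refl a∈A | later  a′∈A b′∈A = contradiction eq (Unique-++-disjoint (map (_- h) A) (Unique-++⁻ʳ (map (λ b → h - b) A) unique)
    (∈-map⁺ (_- h) a∈A) (∈-differences A a′∈A b′∈A a′≢b′))
  ... | later  a∈A b∈A  | second refl a′∈A = contradiction (sym eq) (Unique-++-disjoint (map (_- h) A) (Unique-++⁻ʳ (map (λ b → h - b) A) unique)
    (∈-map⁺ (_- h) a′∈A) (∈-differences A a∈A b∈A a≢b))

  -- Combination of the bounds and the cases by the size of A.

  module Classification
    (p d e : ℕ) (p≡ : p ≡ suc (d ℕ.* suc (suc e))) (1<d : 1 < d)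
    (ι≢0 : ∀ k → 0 < k → k < p → ι k ≢ 0#) (ι-p : ι p ≡ 0#) (ι-surjective : ∀ x → ∃[ k ] x ≡ ι k)
    (E : List K) (uniqueE : Unique E) (|E|≡p : length E ≡ p)
    (A : List K) (unique : Unique A)
    (A-A⊆μ : ∀ {a b} → a ∈ A → b ∈ A → a ≢ b → (a - b) ^ d ≡ 1#)
    (μ⊆A-A : ∀ x → x ^ d ≡ 1# → ∃[ a ] ∃[ b ] a ∈ A × b ∈ A × x ≡ a - b)
    where

    0<d : 0 < d
    0<d = ℕ.<⇒≤ 1<d

    d+d<p : d ℕ.+ d < p
    d+d<p = subst (d ℕ.+ d <_) (sym p≡) (s≤s (subst (_≤ d ℕ.* suc (suc e)) (trans (ℕ.*-comm d 2) (cong (d ℕ.+_) (ℕ.+-identityʳ d)))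
      (ℕ.*-monoʳ-≤ d (s≤s (s≤s z≤n)))))

    0^d≢1 : 0# ^ d ≢ 1#
    0^d≢1 = lemma d 0<d
      where
      lemma : ∀ d → 0 < d → 0# ^ d ≢ 1#
      lemma (suc d) _ e = 1≢0 (trans (sym e) (zeroˡ _))

    fermat : ∀ x → x ≢ 0# → x ^ (d ℕ.* suc (suc e)) ≡ 1#
    fermat x x≢0 = x-y≡0⇒x≡y _ _ (xy≡0⇒y≡0 x≢0 (begin
      x * (x ^ (d ℕ.* suc (suc e)) - 1#)
        ≡⟨ solve 2 (λ x y → x :* (y :- κ 1) := x :* y :- x) refl x (x ^ (d ℕ.* suc (suc e))) ⟩
      x ^ suc (d ℕ.* suc (suc e)) - x
        ≡⟨ cong (λ k → x ^ k - x) p≡ ⟨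
      x ^ p - x
        ≡⟨ x≡y⇒x-y≡0 (subst (λ x → x ^ p ≡ x) (sym (proj₂ (ι-surjective x))) (Fermat.ι^p≡ι p ι≢0 (subst (0 <_) (sym p≡) (s≤s z≤n)) ι-p (proj₁ (ι-surjective x)))) ⟩
      0# ∎))

    cover : ∀ x → x ^ d ≡ 1# → x ∈ differences A
    cover x x^d≡1 with μ⊆A-A x x^d≡1
    ... | a , b , a∈A , b∈A , refl = ∈-differences A a∈A b∈A (λ a≡b → 0^d≢1 (trans (cong (_^ d) (sym (x≡y⇒x-y≡0 a≡b))) x^d≡1))

    d≤-cover : ∀ S → (∀ x → x ^ d ≡ 1# → x ∈ S) → d ≤ length S
    d≤-cover = μ-size d (suc e) p p≡ 0<d E uniqueE |E|≡p fermat

    d≤|differences| : d ≤ length (differences A)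
    d≤|differences| = d≤-cover (differences A) cover

    differences-unique : length (differences A) ≤ d → Unique (differences A)
    differences-unique le with Unique-or-shorter _≟_ (differences A)
    ... | inj₁ unique           = unique
    ... | inj₂ (S , ⊆ , S<diff) = contradiction (d≤-cover S (λ x x^d≡1 → ⊆ (cover x x^d≡1))) (ℕ.<⇒≱ (ℕ.<-≤-trans S<diff le))

    classification : d ≡ 2 ⊎ d ≡ 6
    classification = by-size (length A) refl
      where
      d≤ : ∀ m → length A ≡ suc m → d ≤ suc m ℕ.* m
      d≤ m eq = subst (d ≤_) (|differences| A m eq) d≤|differences|

      ≤d : ∀ m → 0 < m → length A ≡ suc m → suc m ℕ.* m ≤ d
      ≤d m 0<m eq = Setting.|A|[|A|-1]≤d p d m ι≢0 0<d 0<m d+d<p A unique eq A-A⊆μ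

      large : ∀ t d′ → 4 ℕ.+ d′ ≡ d → length A ≡ 4 ℕ.+ t → ⊥
      large t d′ refl eq with repeated-difference p d′ t ι≢0 d+d<p A unique eq A-A⊆μ (ℕ.≤-antisym (d≤ (3 ℕ.+ t) eq) (≤d (3 ℕ.+ t) (s≤s z≤n) eq))
      ... | z , a , a′ , z∈A , a∈A , a′∈A , a≢z , z-a≡a′-z = a≢z (sym (x-y≡0⇒x≡y z a (trans z-a≡a′-z (x≡y⇒x-y≡0 (sym z≡a′)))))
        where
        a′≢z : a′ ≢ z
        a′≢z a′≡z = a≢z (sym (x-y≡0⇒x≡y z a (trans z-a≡a′-z (x≡y⇒x-y≡0 a′≡z))))
        -- The differences z - a and a′ - z have the same value, so the uniqueness of differences
        -- identifies their first members. Then the common value is zero, against a ≠ z.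
        z≡a′ : z ≡ a′
        z≡a′ = differences-injective A
          (differences-unique (subst (_≤ d) (sym (|differences| A (3 ℕ.+ t) eq)) (≤d (3 ℕ.+ t) (s≤s z≤n) eq)))
          z∈A a∈A a′∈A z∈A (a≢z ∘ sym) a′≢z z-a≡a′-z

      by-size : ∀ n → length A ≡ n → d ≡ 2 ⊎ d ≡ 6
      by-size 0 eq = contradiction (ℕ.<-≤-trans 1<d (subst (d ≤_) (empty A eq) d≤|differences|)) λ ()
        where
        empty : ∀ B → length B ≡ 0 → length (differences B) ≡ 0
        empty [] _ = refl
      by-size 1 eq = contradiction (ℕ.<-≤-trans 1<d (d≤ 0 eq)) λ ()
      -- For two and three points n (n - 1) is 2 and 6. The lower bound on d is the hypothesis d > 1
      -- in the first case and the Stepanov bound in the second.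
      by-size 2 eq = inj₁ (ℕ.≤-antisym (d≤ 1 eq) 1<d)
      by-size 3 eq = inj₂ (ℕ.≤-antisym (d≤ 2 eq) (≤d 2 (s≤s z≤n) eq))
      by-size (suc (suc (suc (suc t)))) eq = ⊥-elim (large t (d ∸ 4) (ℕ.m+[n∸m]≡n 4≤d) eq)
        where
        4≤d : 4 ≤ d
        4≤d = ℕ.≤-trans (ℕ.m≤m+n 4 8) (ℕ.≤-trans (ℕ.*-mono-≤ (ℕ.m≤m+n 4 t) (ℕ.m≤m+n 3 t)) (≤d (3 ℕ.+ t) (s≤s z≤n) eq))

-- Residues modulo a prime as a field.

module PrimeField (p : ℕ) .{{_ : NonZero p}} (p-prime : Prime p) where
  open ≡-Reasoning

  infixl 6 _⊞_
  infixl 7 _⊠_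

  π : ℕ → Fin p
  π n = n mod p

  toℕ-π : ∀ n → toℕ (π n) ≡ n % p
  toℕ-π n = toℕ-fromℕ< (m%n<n n p)

  π-toℕ : ∀ x → π (toℕ x) ≡ x
  π-toℕ x = toℕ-injective (trans (toℕ-π (toℕ x)) (m<n⇒m%n≡m (toℕ<n x)))

  π-cong : ∀ m n → m % p ≡ n % p → π m ≡ π n
  π-cong m n eq = toℕ-injective (trans (toℕ-π m) (trans eq (sym (toℕ-π n))))

  _⊞_ _⊠_ : Fin p → Fin p → Fin p
  x ⊞ y = π (toℕ x ℕ.+ toℕ y)
  x ⊠ y = π (toℕ x ℕ.* toℕ y)

  ⊟_ : Fin p → Fin p
  ⊟ x = π (p ∸ toℕ x)

  π-+ : ∀ m n → π m ⊞ π n ≡ π (m ℕ.+ n)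
  π-+ m n = π-cong _ _ (trans (cong₂ (λ x y → (x ℕ.+ y) % p) (toℕ-π m) (toℕ-π n)) (sym (%-distribˡ-+ m n p)))

  π-* : ∀ m n → π m ⊠ π n ≡ π (m ℕ.* n)
  π-* m n = π-cong _ _ (trans (cong₂ (λ x y → (x ℕ.* y) % p) (toℕ-π m) (toℕ-π n)) (sym (%-distribˡ-* m n p)))

  π-+ˡ : ∀ x n → x ⊞ π n ≡ π (toℕ x ℕ.+ n)
  π-+ˡ x n = trans (cong (_⊞ π n) (sym (π-toℕ x))) (π-+ (toℕ x) n)

  π-+ʳ : ∀ m y → π m ⊞ y ≡ π (m ℕ.+ toℕ y)
  π-+ʳ m y = trans (cong (π m ⊞_) (sym (π-toℕ y))) (π-+ m (toℕ y))

  π-*ˡ : ∀ x n → x ⊠ π n ≡ π (toℕ x ℕ.* n)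
  π-*ˡ x n = trans (cong (_⊠ π n) (sym (π-toℕ x))) (π-* (toℕ x) n)

  π-*ʳ : ∀ m y → π m ⊠ y ≡ π (m ℕ.* toℕ y)
  π-*ʳ m y = trans (cong (π m ⊠_) (sym (π-toℕ y))) (π-* m (toℕ y))

  ⊞-comm : ∀ x y → x ⊞ y ≡ y ⊞ x
  ⊞-comm x y = cong π (ℕ.+-comm (toℕ x) (toℕ y))

  ⊠-comm : ∀ x y → x ⊠ y ≡ y ⊠ x
  ⊠-comm x y = cong π (ℕ.*-comm (toℕ x) (toℕ y))

  ⊞-assoc : ∀ x y z → (x ⊞ y) ⊞ z ≡ x ⊞ (y ⊞ z)
  ⊞-assoc x y z = trans (π-+ʳ _ z) (trans (cong π (ℕ.+-assoc (toℕ x) (toℕ y) (toℕ z))) (sym (π-+ˡ x _)))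

  ⊠-assoc : ∀ x y z → (x ⊠ y) ⊠ z ≡ x ⊠ (y ⊠ z)
  ⊠-assoc x y z = trans (π-*ʳ _ z) (trans (cong π (ℕ.*-assoc (toℕ x) (toℕ y) (toℕ z))) (sym (π-*ˡ x _)))

  ⊠-distribˡ-⊞ : ∀ x y z → x ⊠ (y ⊞ z) ≡ (x ⊠ y) ⊞ (x ⊠ z)
  ⊠-distribˡ-⊞ x y z = trans (π-*ˡ x _) (trans (cong π (ℕ.*-distribˡ-+ (toℕ x) (toℕ y) (toℕ z))) (sym (π-+ _ _)))

  ⊞-identityˡ : ∀ x → π 0 ⊞ x ≡ x
  ⊞-identityˡ x = trans (π-+ʳ 0 x) (π-toℕ x)

  ⊠-identityˡ : ∀ x → π 1 ⊠ x ≡ x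
  ⊠-identityˡ x = trans (π-*ʳ 1 x) (trans (cong π (ℕ.*-identityˡ (toℕ x))) (π-toℕ x))

  π-p : π p ≡ π 0
  π-p = π-cong p 0 (trans (n%n≡0 p) (sym (m<n⇒m%n≡m (ℕ.>-nonZero⁻¹ p))))

  ⊞-inverseʳ : ∀ x → x ⊞ (⊟ x) ≡ π 0
  ⊞-inverseʳ x = trans (π-+ˡ x (p ∸ toℕ x)) (trans (cong π (ℕ.m+[n∸m]≡n (ℕ.<⇒≤ (toℕ<n x)))) π-p)

  isCommutativeRing : IsCommutativeRing _≡_ _⊞_ _⊠_ ⊟_ (π 0) (π 1)
  isCommutativeRing = record
    { isRing = record
      { +-isAbelianGroup = record
        { isGroup = record
          { isMonoid = record
            { isSemigroup = record
              { isMagma = record { isEquivalence = isEquivalence ; ∙-cong = cong₂ _⊞_ }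
              ; assoc   = ⊞-assoc }
            ; identity = ⊞-identityˡ , λ x → trans (⊞-comm x (π 0)) (⊞-identityˡ x) }
          ; inverse = (λ x → trans (⊞-comm (⊟ x) x) (⊞-inverseʳ x)) , ⊞-inverseʳ
          ; ⁻¹-cong = cong ⊟_ }
        ; comm = ⊞-comm }
      ; *-cong     = cong₂ _⊠_
      ; *-assoc    = ⊠-assoc
      ; *-identity = ⊠-identityˡ , λ x → trans (⊠-comm x (π 1)) (⊠-identityˡ x)
      ; distrib    = ⊠-distribˡ-⊞ , λ x y z → trans (⊠-comm (y ⊞ z) x)
                       (trans (⊠-distribˡ-⊞ x y z) (cong₂ _⊞_ (⊠-comm x y) (⊠-comm x z))) }
    ; *-comm = ⊠-comm }

  commutativeRing : CommutativeRing 0ℓ 0ℓ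
  commutativeRing = record { isCommutativeRing = isCommutativeRing }

  1<p : 1 < p
  1<p = ℕ.nonTrivial⇒n>1 p {{prime⇒nonTrivial p-prime}}

  π≢0 : ∀ k → 0 < k → k < p → π k ≢ π 0
  π≢0 k 0<k k<p eq = ℕ.<⇒≢ 0<k (sym (begin
    k          ≡⟨ m<n⇒m%n≡m k<p ⟨
    k % p      ≡⟨ toℕ-π k ⟨
    toℕ (π k)  ≡⟨ cong toℕ eq ⟩
    toℕ (π 0)  ≡⟨ toℕ-π 0 ⟩
    0 % p      ≡⟨ m<n⇒m%n≡m (ℕ.<-trans (s≤s z≤n) 1<p) ⟩
    0          ∎))

  toℕ≡0⇒≡0 : ∀ x → toℕ x ≡ 0 → x ≡ π 0
  toℕ≡0⇒≡0 x eq = trans (sym (π-toℕ x)) (cong π eq)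

  inverse : ∀ x → x ≢ π 0 → ∃[ y ] x ⊠ y ≡ π 1
  inverse x x≢0 with coprime-Bézout (prime⇒coprime p-prime {{ℕ.≢-nonZero (x≢0 ∘ toℕ≡0⇒≡0 x)}} (toℕ<n x))
  ... | Bézout.-+ a b 1+ap≡bx = π b , (begin
    x ⊠ π b                 ≡⟨ π-*ˡ x b ⟩
    π (toℕ x ℕ.* b)         ≡⟨ cong π (trans (ℕ.*-comm (toℕ x) b) (sym 1+ap≡bx)) ⟩
    π (1 ℕ.+ a ℕ.* p)       ≡⟨ π-cong _ _ ([m+kn]%n≡m%n 1 a p) ⟩
    π 1                     ∎)
  -- In this sign of the Bézout identity b x is congruent to -1, so the inverse is the negative of
  -- b.
  ... | Bézout.+- a b 1+bx≡ap = ⊟ π b , (begin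
    x ⊠ (⊟ π b)             ≡⟨ -‿distribʳ-* x (π b) ⟨
    ⊟ (x ⊠ π b)             ≡⟨ cong ⊟_ (trans (π-*ˡ x b) (cong π (ℕ.*-comm (toℕ x) b))) ⟩
    ⊟ π (b ℕ.* toℕ x)       ≡⟨ sym (inverseʳ-unique (π (b ℕ.* toℕ x)) (π 1) (begin
      π (b ℕ.* toℕ x) ⊞ π 1     ≡⟨ trans (⊞-comm _ (π 1)) (π-+ 1 _) ⟩
      π (1 ℕ.+ b ℕ.* toℕ x)     ≡⟨ cong π 1+bx≡ap ⟩
      π (a ℕ.* p)               ≡⟨ π-cong _ 0 ([m+kn]%n≡m%n 0 a p) ⟩
      π 0                       ∎)) ⟩
    π 1                     ∎)
    where
    open Algebra.Properties.Ring (CommutativeRing.ring commutativeRing)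
      using (-‿distribʳ-*) renaming (+-inverseʳ-unique to inverseʳ-unique)

  reciprocal : Fin p → Fin p
  reciprocal x with x ≟ᶠ π 0
  ... | yes _   = π 0
  ... | no  x≢0 = proj₁ (inverse x x≢0)

  reciprocal-inverse : ∀ x → x ≢ π 0 → x ⊠ reciprocal x ≡ π 1
  reciprocal-inverse x x≢0 with x ≟ᶠ π 0
  ... | yes x≡0 = contradiction x≡0 x≢0
  ... | no  x≢0 = proj₂ (inverse x x≢0)

  𝔽ₚ : DiscreteField
  𝔽ₚ = record
    { K = Fin p ; _+_ = _⊞_ ; _*_ = _⊠_ ; -_ = ⊟_ ; 0# = π 0 ; 1# = π 1
    ; isCommutativeRing = isCommutativeRing
    ; _≟_ = _≟ᶠ_
    ; 1≢0 = π≢0 1 (s≤s z≤n) 1<p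
    ; _⁻¹ = reciprocal ; inverseʳ = reciprocal-inverse }

  open Covering 𝔽ₚ public using (ι; _^_; _-_; 0#; 1#; x-y≡0⇒x≡y; module Classification)

  ι≡π : ∀ k → ι k ≡ π k
  ι≡π zero    = refl
  ι≡π (suc k) = trans (cong (π 1 ⊞_) (ι≡π k)) (π-+ 1 k)

  toℕ-^ : ∀ x k → toℕ (x ^ k) ≡ (toℕ x ℕ.^ k) % p
  toℕ-^ x k = trans (cong toℕ (lemma k)) (toℕ-π _)
    where
    lemma : ∀ k → x ^ k ≡ π (toℕ x ℕ.^ k)
    lemma zero    = refl
    lemma (suc k) = trans (cong (x ⊠_) (lemma k)) (π-*ˡ x _)

  toℕ-1 : toℕ (π 1) ≡ 1
  toℕ-1 = trans (toℕ-π 1) (m<n⇒m%n≡m 1<p)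

  toℕ-sub : ∀ x y → toℕ (x - y) ≡ subₚ p x y
  toℕ-sub x y = trans (cong toℕ (π-+ˡ x (p ∸ toℕ y))) (toℕ-π _)

  μ⇒^≡1 : ∀ d x → μ p d x → x ^ d ≡ 1#
  μ⇒^≡1 d x x∈μ = toℕ-injective (trans (toℕ-^ x d) (trans x∈μ (sym toℕ-1)))

  ^≡1⇒μ : ∀ d x → x ^ d ≡ 1# → μ p d x
  ^≡1⇒μ d x eq = trans (sym (toℕ-^ x d)) (trans (cong toℕ eq) toℕ-1)

-- A proper divisor of p - 1 has a cofactor of at least 2; this is the origin of 2 d < p.
cofactor : ∀ p d → 1 < p → d ∣ p ∸ 1 → d < p ∸ 1 → ∃[ e ] p ≡ suc (d ℕ.* suc (suc e))
cofactor (suc p) d _ (divides (suc (suc e)) eq) d<p = e , cong suc (trans eq (ℕ.*-comm (suc (suc e)) d))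
cofactor (suc p) d _ (divides 1 eq) d<p = contradiction (subst (d <_) (trans eq (ℕ.+-identityʳ d)) d<p) (ℕ.<-irrefl refl)
cofactor (suc p) d _ (divides 0 eq) d<p = contradiction (subst (d <_) eq d<p) λ ()

theorem1 : (p d : ℕ) .{{_ : NonZero p}} → Prime p → d ∣ p ∸ 1 → 1 < d → d < p ∸ 1 →
    (A : Fin p → Set) →
    (∀ (x : Fin p) → (x ∈A-A A) ⇔ (μ p d x ⊎ toℕ x ≡ 0)) →
    d ≡ 2 ⊎ d ≡ 6
theorem1 p d p-prime d∣p-1 1<d d<p-1 A A-A≡μ =
  -- A is an arbitrary predicate, yet its points have to be listed. The conclusion is decidable and
  -- hence stable under double negation, and under a double negation membership may be decided at
  -- each of the finitely many residues.
  decidable-stable ((d ℕ.≟ 2) ⊎-dec (d ℕ.≟ 6)) (λ ¬d → sequence rawApplicative (λ x → ¬¬-excluded-middle {A = A x}) (¬d ∘ decided))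
  where
  open RawMonad (¬¬-Monad {0ℓ}) using (rawApplicative)
  open PrimeField p p-prime
  decided : (∀ x → Dec (A x)) → d ≡ 2 ⊎ d ≡ 6
  decided A? with cofactor p d 1<p d∣p-1 d<p-1
  ... | e , p≡ = Classification.classification p d e p≡ 1<d
    (λ k 0<k k<p eq → π≢0 k 0<k k<p (trans (sym (ι≡π k)) eq)) (trans (ι≡π p) π-p)
    (λ x → toℕ x , trans (sym (π-toℕ x)) (sym (ι≡π (toℕ x))))
    (allFin p) (allFin⁺ p) (length-tabulate {n = p} (λ x → x))
    B (filter⁺ A? (allFin⁺ p)) B-B⊆μ μ⊆B-B
    where
    B = filter A? (allFin p)
    B-B⊆μ : ∀ {a b} → a ∈ B → b ∈ B → a ≢ b → (a - b) ^ d ≡ 1#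
    B-B⊆μ {a} {b} a∈B b∈B a≢b with Equivalence.to (A-A≡μ (a - b))
      (a , b , proj₂ (∈-filter⁻ A? {xs = allFin p} a∈B) , proj₂ (∈-filter⁻ A? {xs = allFin p} b∈B) , toℕ-sub a b)
    ... | inj₁ ∈μ  = μ⇒^≡1 d (a - b) ∈μ
    ... | inj₂ ≡0  = contradiction (x-y≡0⇒x≡y a b (toℕ≡0⇒≡0 (a - b) ≡0)) a≢b
    μ⊆B-B : ∀ x → x ^ d ≡ 1# → ∃[ a ] ∃[ b ] a ∈ B × b ∈ B × x ≡ a - b
    μ⊆B-B x x^d≡1 with Equivalence.from (A-A≡μ x) (inj₁ (^≡1⇒μ d x x^d≡1))
    ... | a , b , Aa , Ab , x≡ = a , b , ∈-filter⁺ A? (∈-allFin a) Aa , ∈-filter⁺ A? (∈-allFin b) Ab ,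
      toℕ-injective (trans x≡ (sym (toℕ-sub a b)))
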